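{- Let $G=(U,W,E)$ be a graph in $\mathcal{X}$. Then the complement $\overline{G}$ of $G$ is a unit disk graph.
   Context: All graphs are finite and simple. A graph $G=(V,E)$ is a unit disk graph if there is a function $f:V\to\mathbb{R}^2$ such that for distinct $u,v\in V$, $uv\in E$ if and only if the Euclidean distance between $f(u)$ and $f(v)$ is at most $1$. $(U,W,E)$ denotes a bipartite graph with fixed partition of the vertex set into independent sets $U,W$ and edge set $E$. The class $\mathcal{X}$ consists of all graphs (necessarily bipartite) containing none of the following graphs as an induced subgraph: the cycles $C_n$ for $n\ge 3$, $n\neq 6$; the tree $S_{3,3,3}$ (one centre vertex with three attached disjoint paths of length 3); the graph $C_6^{+3c}$ ($C_6$ with one pendant vertex attached to each of three consecutive vertices of the cycle); the graph $C_6^{+3nc}$ ($C_6$ with one pendant vertex attached to each of three pairwise non-adjacent vertices of the cycle); the graph $C_6^{+2l2}$ ($C_6$ with a path of length 2 attached at each of two adjacent vertices of the cycle, i.e. with $C_6=c_1\dots c_6$, new vertices $x,x',y,y'$ and new edges $c_1x,xx',c_2y,yy'$). -}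

module Defs where

open import Data.Empty using (⊥-elim)
open import Data.Fin using (Fin; toℕ; #_)
open import Data.Fin.Properties using () renaming (_≟_ to _≟ᶠ_)
open import Data.Fin.Subset using (Subset; _∈_; _∉_)
open import Data.Integer.Base as ℤ using (ℤ; +_)
import Data.Integer.Properties as ℤP
import Data.Integer.Solver as ℤSolver
open import Data.List.Base using (List; []; _∷_)
open import Data.List.Membership.Propositional using () renaming (_∈_ to _∈ˡ_)
import Data.List.Membership.DecPropositional as DecMembership
open import Data.Nat.Base as ℕ using (ℕ; zero; suc)
import Data.Nat.Properties as ℕP
open import Data.Nat.Coprimality using (1-coprimeTo)
open import Data.Product using (∃; _×_; _,_; proj₁; proj₂)
open import Data.Product.Properties using (≡-dec)
open import Data.Rational.Base as ℚ
  using (ℚ; mkℚ; 0ℚ; 1ℚ; ½; ∣_∣; ↥_; ↧_; ↧ₙ_; _⊔_)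
  hiding (module ℚ)
import Data.Rational.Properties as ℚP
open import Data.Rational.Solver using (module +-*-Solver)
open import Data.Rational.Unnormalised.Base as ℚᵘ using (mkℚᵘ)
import Data.Rational.Unnormalised.Properties as ℚᵘP
open import Data.Sum using (_⊎_; inj₁; inj₂; swap)
open import Function using (_⇔_; Injective; _∘_)
open import Level using (0ℓ)
open import Relation.Binary using (Rel; Decidable; Symmetric; Irreflexive)
open import Relation.Binary.PropositionalEquality
  using (_≡_; _≢_; refl; sym; trans; cong; subst; subst₂; ≢-sym)
open import Relation.Nullary using (¬_; yes; no)
open import Relation.Nullary.Decidable using (Dec; _×-dec_; _⊎-dec_; ¬?)

------------------------------------------------------------------------
-- Auxiliary facts about ℚ

module ℚ-lemmas where
  open ℚ using (_≤_; _<_; _+_; _-_; _*_; -_)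
  open +-*-Solver

  half>0 : ∀ {ε} → 0ℚ < ε → 0ℚ < ½ * ε
  half>0 {ε} ε>0 =
    ℚP.positive⁻¹ (½ * ε) {{ℚP.pos*pos⇒pos ½ ε {{ℚ.positive ε>0}}}}

  halves : ∀ ε → ½ * ε + ½ * ε ≡ ε
  halves ε = trans (sym (ℚP.*-distribʳ-+ ε ½ ½)) (ℚP.*-identityˡ ε)

  +-nonNeg : ∀ {p q} → 0ℚ ≤ p → 0ℚ ≤ q → 0ℚ ≤ p + q
  +-nonNeg p≥0 q≥0 = ℚP.+-mono-≤ p≥0 q≥0

  *-nonNeg : ∀ {p q} → 0ℚ ≤ p → 0ℚ ≤ q → 0ℚ ≤ p * q
  *-nonNeg {p} {q} p≥0 q≥0 = ℚP.nonNegative⁻¹ (p * q)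
    {{ℚP.nonNeg*nonNeg⇒nonNeg p {{ℚ.nonNegative p≥0}} q {{ℚ.nonNegative q≥0}}}}

  *-pos : ∀ {p q} → 0ℚ < p → 0ℚ < q → 0ℚ < p * q
  *-pos {p} {q} p>0 q>0 = ℚP.positive⁻¹ (p * q)
    {{ℚP.pos*pos⇒pos p {{ℚ.positive p>0}} q {{ℚ.positive q>0}}}}

  *-mono-≤ : ∀ {p q r s} → 0ℚ ≤ p → 0ℚ ≤ s → p ≤ q → r ≤ s → p * r ≤ q * s
  *-mono-≤ {p} {q} {r} {s} p≥0 s≥0 p≤q r≤s = ℚP.≤-trans
    (ℚP.*-monoˡ-≤-nonNeg p {{ℚ.nonNegative p≥0}} r≤s)
    (ℚP.*-monoʳ-≤-nonNeg s {{ℚ.nonNegative s≥0}} p≤q)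

  square-mono : ∀ {p q} → 0ℚ ≤ p → p ≤ q → p * p ≤ q * q
  square-mono p≥0 p≤q = *-mono-≤ p≥0 (ℚP.≤-trans p≥0 p≤q) p≤q p≤q

  ≤-+ : ∀ {q} p → 0ℚ ≤ q → p ≤ p + q
  ≤-+ {q} p q≥0 = subst (_≤ p + q) (ℚP.+-identityʳ p) (ℚP.+-monoʳ-≤ p q≥0)

  p≤∣p∣ : ∀ p → p ≤ ∣ p ∣
  p≤∣p∣ p with ℚP.≤-total 0ℚ p
  ... | inj₁ p≥0 = ℚP.≤-reflexive (sym (ℚP.0≤p⇒∣p∣≡p p≥0))
  ... | inj₂ p≤0 = ℚP.≤-trans p≤0 (ℚP.0≤∣p∣ p)

  ∣-∣≤⇒≤+ : ∀ p q {ε} → ∣ p - q ∣ ≤ ε → p ≤ q + ε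
  ∣-∣≤⇒≤+ p q {ε} h = subst (_≤ q + ε)
    (solve 2 (λ x y → y :+ (x :+ :- y) := x) refl p q)
    (ℚP.+-monoʳ-≤ q (ℚP.≤-trans (p≤∣p∣ (p - q)) h))

  ≤+⇒-≤ : ∀ p q {ε} → p ≤ q + ε → p - q ≤ ε
  ≤+⇒-≤ p q {ε} h = subst (p - q ≤_)
    (solve 2 (λ y e → (y :+ e) :+ :- y := e) refl q ε)
    (ℚP.+-monoˡ-≤ (- q) h)

  ≤+⇒∣-∣≤ : ∀ p q {ε} → p ≤ q + ε → q ≤ p + ε → ∣ p - q ∣ ≤ ε
  ≤+⇒∣-∣≤ p q {ε} h₁ h₂ with ℚP.∣p∣≡p∨∣p∣≡-p (p - q)
  ... | inj₁ eq = subst (_≤ ε) (sym eq) (≤+⇒-≤ p q h₁)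
  ... | inj₂ eq = subst (_≤ ε)
    (trans (solve 2 (λ x y → y :+ :- x := :- (x :+ :- y)) refl p q) (sym eq))
    (≤+⇒-≤ q p h₂)

  ∣p∣≤∣q∣+ : ∀ p q {ε} → ∣ p - q ∣ ≤ ε → ∣ p ∣ ≤ ε + ∣ q ∣
  ∣p∣≤∣q∣+ p q {ε} h = ℚP.≤-trans
    (subst (λ r → ∣ r ∣ ≤ ∣ p - q ∣ + ∣ q ∣)
      (solve 2 (λ x y → (x :+ :- y) :+ y := x) refl p q)
      (ℚP.∣p+q∣≤∣p∣+∣q∣ (p - q) q))
    (ℚP.+-monoˡ-≤ ∣ q ∣ h)

  ∣+∣≤ : ∀ p q ε → ∣ p ∣ ≤ ½ * ε → ∣ q ∣ ≤ ½ * ε → ∣ p + q ∣ ≤ ε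
  ∣+∣≤ p q ε hp hq = subst (∣ p + q ∣ ≤_) (halves ε)
    (ℚP.≤-trans (ℚP.∣p+q∣≤∣p∣+∣q∣ p q) (ℚP.+-mono-≤ hp hq))

  +-interchange-- : ∀ a b c d → (a - c) + (b - d) ≡ (a + b) - (c + d)
  +-interchange-- = solve 4 (λ a b c d →
    (a :+ :- c) :+ (b :+ :- d) := (a :+ b) :+ :- (c :+ d)) refl

  *-split-- : ∀ a b c d → a * (b - d) + d * (a - c) ≡ a * b - c * d
  *-split-- = solve 4 (λ a b c d →
    a :* (b :+ :- d) :+ d :* (a :+ :- c) := a :* b :+ :- (c :* d)) refl

  *-swapˡ : ∀ p q r → p * (q * r) ≡ q * (p * r)
  *-swapˡ = solve 3 (λ p q r → p :* (q :* r) := q :* (p :* r)) refl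

  divide : ∀ C ε → 0ℚ < C → 0ℚ < ε → ∃ λ η → 0ℚ < η × C * η ≡ ε
  divide C ε C>0 ε>0 = ε * ℚ.1/ C ,
    ℚP.positive⁻¹ (ε * ℚ.1/ C)
      {{ℚP.pos*pos⇒pos ε {{ℚ.positive ε>0}} (ℚ.1/ C) {{ℚP.1/pos⇒pos C}}}} ,
    trans (*-swapˡ C ε (ℚ.1/ C))
      (trans (cong (ε *_) (ℚP.*-inverseʳ C)) (ℚP.*-identityʳ ε))
    where
    instance
      C-pos : ℚ.Positive C
      C-pos = ℚ.positive C>0
      C-nonZero : ℚ.NonZero C
      C-nonZero = ℚP.pos⇒nonZero C

  ∣*∣≤ : ∀ p q {C η ε} → 0ℚ ≤ η → C * η ≡ ε → ∣ p ∣ ≤ C → ∣ q ∣ ≤ η → ∣ p * q ∣ ≤ ε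
  ∣*∣≤ p q η≥0 eq hp hq = subst₂ _≤_ (sym (ℚP.∣p*q∣≡∣p∣*∣q∣ p q)) eq
    (*-mono-≤ (ℚP.0≤∣p∣ p) η≥0 hp hq)

  square-step : ∀ r h → ((r + h) * (r + h) + h * h) +
    ((r * h + r * h) + (h * h + h * h)) ≡ (r + (h + h)) * (r + (h + h))
  square-step = solve 2 (λ r h →
    ((r :+ h) :* (r :+ h) :+ h :* h) :+ ((r :* h :+ r :* h) :+ (h :* h :+ h :* h))
      := (r :+ (h :+ h)) :* (r :+ (h :+ h))) refl

  root-close : ∀ s t d h X Y → 0ℚ ≤ t → 0ℚ ≤ d → d ≤ h →
    s * s ≤ X → Y < (t + d) * (t + d) → X ≤ Y + h * h → s ≤ t + (h + h)
  root-close s t d h X Y t≥0 d≥0 d≤h ss≤X Y< X≤ with s ℚP.≤? t + (h + h)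
  ... | yes s≤ = s≤
  ... | no  s≰ = ⊥-elim (ℚP.<-irrefl refl (ℚP.<-≤-trans below above))
    where
    h≥0 = ℚP.≤-trans d≥0 d≤h
    th≥0 = *-nonNeg t≥0 h≥0
    hh≥0 = *-nonNeg h≥0 h≥0

    step : (t + h) * (t + h) + h * h ≤ (t + (h + h)) * (t + (h + h))
    step = subst ((t + h) * (t + h) + h * h ≤_) (square-step t h)
      (≤-+ _ (+-nonNeg (+-nonNeg th≥0 th≥0) (+-nonNeg hh≥0 hh≥0)))

    below : X < (t + (h + h)) * (t + (h + h))
    below = ℚP.≤-<-trans X≤ (ℚP.<-≤-trans
      (ℚP.+-monoˡ-< (h * h) Y<)
      (ℚP.≤-trans
        (ℚP.+-monoˡ-≤ (h * h)
          (square-mono (+-nonNeg t≥0 d≥0) (ℚP.+-monoʳ-≤ t d≤h)))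
        step))

    above : (t + (h + h)) * (t + (h + h)) ≤ X
    above = ℚP.≤-trans
      (square-mono (+-nonNeg t≥0 (+-nonNeg h≥0 h≥0)) (ℚP.<⇒≤ (ℚP.≰⇒> s≰)))
      ss≤X

  ⊔0-close : ∀ p q {ε} → 0ℚ ≤ ε → ∣ p - q ∣ ≤ ε → p ⊔ 0ℚ ≤ (q ⊔ 0ℚ) + ε
  ⊔0-close p q {ε} ε≥0 h = ℚP.⊔-lub
    (ℚP.≤-trans (∣-∣≤⇒≤+ p q h) (ℚP.+-monoˡ-≤ ε (ℚP.p≤p⊔q q 0ℚ)))
    (+-nonNeg (ℚP.p≤q⊔p q 0ℚ) ε≥0)

open ℚ-lemmas

------------------------------------------------------------------------
-- The real numbers, as Cauchy sequences of rationals

module _ where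
  open ℚ using (_≤_; _<_; _+_; _-_; _*_; -_)

  IsCauchy : (ℕ → ℚ) → Set
  IsCauchy x =
    ∀ ε → 0ℚ < ε → ∃ λ N → ∀ m n → N ℕ.≤ m → N ℕ.≤ n → ∣ x m - x n ∣ ≤ ε

  -- Distinct sequences may represent the same real: equality of reals is
  -- x ≤ᴿ y × y ≤ᴿ x, not _≡_.
  record ℝ : Set where
    constructor mkℝ
    field
      seq    : ℕ → ℚ
      cauchy : IsCauchy seq

  open ℝ public

  infix 4 _≤ᴿ_

  _≤ᴿ_ : Rel ℝ 0ℓ
  x ≤ᴿ y = ∀ ε → 0ℚ < ε → ∃ λ N → ∀ n → N ℕ.≤ n → seq x n ≤ seq y n + ε

  fromℚ : ℚ → ℝ
  seq    (fromℚ q) _ = q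
  cauchy (fromℚ q) ε ε>0 =
    0 , λ _ _ _ _ → subst (λ r → ∣ r ∣ ≤ ε) (sym (ℚP.+-inverseʳ q)) (ℚP.<⇒≤ ε>0)

  1ᴿ : ℝ
  1ᴿ = fromℚ 1ℚ

  infixl 6 _+ᴿ_ _-ᴿ_
  infixl 7 _*ᴿ_
  infix  8 -ᴿ_

  _+ᴿ_ : ℝ → ℝ → ℝ
  seq    (x +ᴿ y) n = seq x n + seq y n
  cauchy (x +ᴿ y) ε ε>0 = let
      M , hM = cauchy x (½ * ε) (half>0 ε>0)
      N , hN = cauchy y (½ * ε) (half>0 ε>0)
    in M ℕ.⊔ N , λ m n hm hn → let
      a = seq x m ; b = seq y m ; c = seq x n ; d = seq y n
      h₁ = hM m n (ℕP.m⊔n≤o⇒m≤o M N hm) (ℕP.m⊔n≤o⇒m≤o M N hn)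
      h₂ = hN m n (ℕP.m⊔n≤o⇒n≤o M N hm) (ℕP.m⊔n≤o⇒n≤o M N hn)
    in subst (λ p → ∣ p ∣ ≤ ε) (+-interchange-- a b c d)
      (∣+∣≤ (a - c) (b - d) ε h₁ h₂)

  -ᴿ_ : ℝ → ℝ
  seq    (-ᴿ x) n = - seq x n
  cauchy (-ᴿ x) ε ε>0 = let N , hN = cauchy x ε ε>0 in
    N , λ m n hm hn → subst (_≤ ε)
      (trans (sym (ℚP.∣-p∣≡∣p∣ (seq x m - seq x n)))
        (cong ∣_∣ (ℚP.neg-distrib-+ (seq x m) (- seq x n))))
      (hN m n hm hn)

  _-ᴿ_ : ℝ → ℝ → ℝ
  x -ᴿ y = x +ᴿ (-ᴿ y)

  eventually-bounded : ∀ x →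
    ∃ λ K → 0ℚ < K × ∃ λ N → ∀ n → N ℕ.≤ n → ∣ seq x n ∣ ≤ K
  eventually-bounded x = let N , hN = cauchy x 1ℚ (ℚP.positive⁻¹ 1ℚ) in
    1ℚ + ∣ seq x N ∣ ,
    ℚP.<-≤-trans (ℚP.positive⁻¹ 1ℚ) (≤-+ 1ℚ (ℚP.0≤∣p∣ (seq x N))) ,
    N , λ n hn → ∣p∣≤∣q∣+ (seq x n) (seq x N) (hN n N hn ℕP.≤-refl)

  _*ᴿ_ : ℝ → ℝ → ℝ
  seq    (x *ᴿ y) n = seq x n * seq y n
  cauchy (x *ᴿ y) ε ε>0 = let
      K , K>0 , A , hA = eventually-bounded x
      L , L>0 , B , hB = eventually-bounded y
      C = K + L
      η , η>0 , Cη = divide C (½ * ε) (ℚP.+-mono-< K>0 L>0) (half>0 ε>0)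
      M , hM = cauchy x η η>0
      N , hN = cauchy y η η>0
      K≤C = ≤-+ K (ℚP.<⇒≤ L>0)
      L≤C = subst (L ≤_) (ℚP.+-comm L K) (≤-+ L (ℚP.<⇒≤ K>0))
    in (A ℕ.⊔ B) ℕ.⊔ (M ℕ.⊔ N) , λ m n hm hn → let
      a = seq x m ; b = seq y m ; c = seq x n ; d = seq y n
      hmAB = ℕP.m⊔n≤o⇒m≤o (A ℕ.⊔ B) (M ℕ.⊔ N) hm
      hmMN = ℕP.m⊔n≤o⇒n≤o (A ℕ.⊔ B) (M ℕ.⊔ N) hm
      hnAB = ℕP.m⊔n≤o⇒m≤o (A ℕ.⊔ B) (M ℕ.⊔ N) hn
      hnMN = ℕP.m⊔n≤o⇒n≤o (A ℕ.⊔ B) (M ℕ.⊔ N) hn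
      a≤C = ℚP.≤-trans (hA m (ℕP.m⊔n≤o⇒m≤o A B hmAB)) K≤C
      d≤C = ℚP.≤-trans (hB n (ℕP.m⊔n≤o⇒n≤o A B hnAB)) L≤C
      h₁ = hM m n (ℕP.m⊔n≤o⇒m≤o M N hmMN) (ℕP.m⊔n≤o⇒m≤o M N hnMN)
      h₂ = hN m n (ℕP.m⊔n≤o⇒n≤o M N hmMN) (ℕP.m⊔n≤o⇒n≤o M N hnMN)
    in subst (λ p → ∣ p ∣ ≤ ε) (*-split-- a b c d)
      (∣+∣≤ (a * (b - d)) (d * (a - c)) ε
        (∣*∣≤ a (b - d) (ℚP.<⇒≤ η>0) Cη a≤C h₂)
        (∣*∣≤ d (a - c) (ℚP.<⇒≤ η>0) Cη d≤C h₁))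

------------------------------------------------------------------------
-- Square roots

module _ where
  open ℚ using (_≤_; _<_; _+_; _-_; _*_; -_)

  -- mesh n = 1 / (n + 1)
  mesh : ℕ → ℚ
  mesh n = mkℚ (+ 1) n (1-coprimeTo (suc n))

  -- grid n k = k / (n + 1)
  grid : ℕ → ℕ → ℚ
  grid n zero    = 0ℚ
  grid n (suc k) = grid n k + mesh n

  mesh≥0 : ∀ n → 0ℚ ≤ mesh n
  mesh≥0 n = ℚP.nonNegative⁻¹ (mesh n)

  grid≥0 : ∀ n k → 0ℚ ≤ grid n k
  grid≥0 n zero    = ℚP.≤-refl
  grid≥0 n (suc k) = +-nonNeg (grid≥0 n k) (mesh≥0 n)

  grid≃ : ∀ n k → ℚ.toℚᵘ (grid n k) ℚᵘ.≃ mkℚᵘ (+ k) n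
  grid≃ n zero    = ℚᵘ.*≡* refl
  grid≃ n (suc k) =
    ℚᵘP.≃-trans (ℚP.toℚᵘ-homo-+ (grid n k) (mesh n))
    (ℚᵘP.≃-trans (ℚᵘP.+-congˡ (mkℚᵘ (+ 1) n) (grid≃ n k))
    (ℚᵘ.*≡* (cross (+ k) (+ suc n))))
    where
    cross : ∀ i d → (i ℤ.* d ℤ.+ + 1 ℤ.* d) ℤ.* d ≡ (+ 1 ℤ.+ i) ℤ.* (d ℤ.* d)
    cross = S.solve 2 (λ i d →
      (i S.:* d S.:+ S.con (+ 1) S.:* d) S.:* d
        S.:= (S.con (+ 1) S.:+ i) S.:* (d S.:* d)) refl
      where module S = ℤSolver.+-*-Solver

  gridBound : ℕ → ℚ → ℕ
  gridBound n q = suc ℤ.∣ ↥ q ∣ ℕ.* suc n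

  gridBound≃ : ∀ n q →
    ℚ.toℚᵘ (grid n (gridBound n q)) ℚᵘ.≃ mkℚᵘ (+ suc ℤ.∣ ↥ q ∣) 0
  gridBound≃ n q = ℚᵘP.≃-trans (grid≃ n (gridBound n q))
    (ℚᵘ.*≡* (trans (ℤP.*-identityʳ _) (ℤP.pos-* (suc ℤ.∣ ↥ q ∣) (suc n))))

  1≤gridBound : ∀ n q → 1ℚ ≤ grid n (gridBound n q)
  1≤gridBound n q = ℚP.toℚᵘ-cancel-≤
    (ℚᵘP.≤-respʳ-≃ (ℚᵘP.≃-sym (gridBound≃ n q))
      (ℚᵘ.*≤* (ℤP.*-monoʳ-≤-nonNeg (+ 1) {+ 1} {+ suc ℤ.∣ ↥ q ∣}
        (ℤ.+≤+ (ℕ.s≤s ℕ.z≤n)))))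

  q<gridBound : ∀ n q → q < grid n (gridBound n q)
  q<gridBound n q@record{} = ℚP.toℚᵘ-cancel-<
    (ℚᵘP.<-respʳ-≃ (ℚᵘP.≃-sym (gridBound≃ n q)) (ℚᵘ.*<* lt))
    where
    i≤∣i∣ : ∀ i → i ℤ.≤ + ℤ.∣ i ∣
    i≤∣i∣ (+ _)       = ℤP.≤-refl
    i≤∣i∣ ℤ.-[1+ _ ] = ℤ.-≤+
    lt : ↥ q ℤ.* + 1 ℤ.< + suc ℤ.∣ ↥ q ∣ ℤ.* ↧ q
    lt = ℤP.≤-<-trans (ℤP.≤-reflexive (ℤP.*-identityʳ (↥ q)))
      (ℤP.≤-<-trans (i≤∣i∣ (↥ q))
      (ℤP.<-≤-trans (ℤ.+<+ (ℕP.n<1+n _))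
      (subst (+ suc ℤ.∣ ↥ q ∣ ℤ.≤_) (ℤP.pos-* (suc ℤ.∣ ↥ q ∣) (↧ₙ q))
        (ℤ.+≤+ (ℕP.m≤m*n (suc ℤ.∣ ↥ q ∣) (↧ₙ q))))))

  gridBound² : ∀ n q →
    ¬ grid n (gridBound n q) * grid n (gridBound n q) ≤ q
  gridBound² n q gg≤q = ℚP.<-irrefl refl
    (ℚP.<-≤-trans (q<gridBound n q)
    (ℚP.≤-trans (subst (_≤ g * g) (ℚP.*-identityˡ g)
      (ℚP.*-monoʳ-≤-nonNeg g {{ℚ.nonNegative (grid≥0 n (gridBound n q))}}
        (1≤gridBound n q)))
    gg≤q))
    where g = grid n (gridBound n q)

  lastBelow : (P : ℕ → Set) → (∀ k → Dec (P k)) → P 0 → ∀ B → ¬ P B →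
    ∃ λ k → P k × ¬ P (suc k)
  lastBelow P P? P0 zero    ¬PB = ⊥-elim (¬PB P0)
  lastBelow P P? P0 (suc B) ¬PB with P? B
  ... | yes PB = B , PB , ¬PB
  ... | no ¬PB′ = lastBelow P P? P0 B ¬PB′

  rootIndex : ∀ n q → 0ℚ ≤ q →
    ∃ λ k → grid n k * grid n k ≤ q × ¬ grid n (suc k) * grid n (suc k) ≤ q
  rootIndex n q q≥0 = lastBelow (λ k → grid n k * grid n k ≤ q)
    (λ k → (grid n k * grid n k) ℚP.≤? q) q≥0 (gridBound n q) (gridBound² n q)

  -- Opaque, as otherwise the conversion checker unfolds the search above.
  opaque
    -- The largest multiple r of 1 / (n + 1) with r² ≤ max (q , 0).
    root : ℕ → ℚ → ℚ
    root n q = grid n (proj₁ (rootIndex n (q ⊔ 0ℚ) (ℚP.p≤q⊔p q 0ℚ)))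

    root≥0 : ∀ n q → 0ℚ ≤ root n q
    root≥0 n q = grid≥0 n (proj₁ (rootIndex n (q ⊔ 0ℚ) (ℚP.p≤q⊔p q 0ℚ)))

    root²≤ : ∀ n q → root n q * root n q ≤ q ⊔ 0ℚ
    root²≤ n q = proj₁ (proj₂ (rootIndex n (q ⊔ 0ℚ) (ℚP.p≤q⊔p q 0ℚ)))

    <root+mesh² : ∀ n q → q ⊔ 0ℚ < (root n q + mesh n) * (root n q + mesh n)
    <root+mesh² n q =
      ℚP.≰⇒> (proj₂ (proj₂ (rootIndex n (q ⊔ 0ℚ) (ℚP.p≤q⊔p q 0ℚ))))

  mesh≤ : ∀ ε → 0ℚ < ε → ∀ n → ↧ₙ ε ℕ.≤ n → mesh n ≤ ε
  mesh≤ ε@(mkℚ (+ suc a) d _) ε>0 n hn = ℚ.*≤*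
    (subst₂ ℤ._≤_ (ℤP.pos-* 1 (suc d)) (ℤP.pos-* (suc a) (suc n))
      (ℤ.+≤+ (ℕP.*-mono-≤ {1} {suc a} (ℕ.s≤s ℕ.z≤n) (ℕP.m≤n⇒m≤1+n hn))))
  mesh≤ (mkℚ (+ 0) d _) (ℚ.*<* (ℤ.+<+ ())) n hn
  mesh≤ (mkℚ ℤ.-[1+ a ] d _) (ℚ.*<* ()) n hn

  root-shift : ∀ m n p q ε → 0ℚ < ε → ↧ₙ (½ * ε) ℕ.≤ n →
    ∣ p - q ∣ ≤ (½ * ε) * (½ * ε) → root m p ≤ root n q + ε
  root-shift m n p q ε ε>0 hn pq = subst (λ e → root m p ≤ root n q + e) (halves ε)
    (root-close (root m p) (root n q) (mesh n) (½ * ε) (p ⊔ 0ℚ) (q ⊔ 0ℚ)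
      (root≥0 n q) (mesh≥0 n) (mesh≤ (½ * ε) (half>0 ε>0) n hn)
      (root²≤ m p) (<root+mesh² n q)
      (⊔0-close p q (*-nonNeg h≥0 h≥0) pq))
    where h≥0 = ℚP.<⇒≤ (half>0 ε>0)

  -- For x ≤ 0 this is 0.
  √_ : ℝ → ℝ
  seq    (√ x) n = root n (seq x n)
  cauchy (√ x) ε ε>0 = let
      h = ½ * ε
      M , hM = cauchy x (h * h) (*-pos (half>0 ε>0) (half>0 ε>0))
    in M ℕ.⊔ ↧ₙ h , λ m n hm hn → let
      p = seq x m ; q = seq x n
      m≥M = ℕP.m⊔n≤o⇒m≤o M (↧ₙ h) hm
      n≥M = ℕP.m⊔n≤o⇒m≤o M (↧ₙ h) hn
    in ≤+⇒∣-∣≤ (root m p) (root n q)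
      (root-shift m n p q ε ε>0 (ℕP.m⊔n≤o⇒n≤o M (↧ₙ h) hn) (hM m n m≥M n≥M))
      (root-shift n m q p ε ε>0 (ℕP.m⊔n≤o⇒n≤o M (↧ₙ h) hm) (hM n m n≥M m≥M))

------------------------------------------------------------------------
-- The Euclidean plane

ℝ² : Set
ℝ² = ℝ × ℝ

dist : ℝ² → ℝ² → ℝ
dist (a , b) (c , d) = √ ((a -ᴿ c) *ᴿ (a -ᴿ c) +ᴿ (b -ᴿ d) *ᴿ (b -ᴿ d))

------------------------------------------------------------------------
-- Finite simple graphs

record Graph (n : ℕ) : Set₁ where
  infix 4 _~_
  field
    _~_      : Rel (Fin n) 0ℓ
    _~?_     : Decidable _~_
    ~-irrefl : Irreflexive _≡_ _~_
    ~-sym    : Symmetric _~_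

complement : ∀ {n} → Graph n → Graph n
complement G = record
  { _~_      = λ u v → u ≢ v × ¬ u ~ v
  ; _~?_     = λ u v → ¬? (u ≟ᶠ v) ×-dec ¬? (u ~? v)
  ; ~-irrefl = λ u≡v u≁v → proj₁ u≁v u≡v
  ; ~-sym    = λ (u≢v , u≁v) → ≢-sym u≢v , u≁v ∘ ~-sym
  }
  where open Graph G

IsUnitDisk : ∀ {n} → Graph n → Set
IsUnitDisk {n} G =
  ∃ λ (f : Fin n → ℝ²) →
    ∀ u v → u ≢ v → (Graph._~_ G u v ⇔ dist (f u) (f v) ≤ᴿ 1ᴿ)

infix 4 _⊑_

-- H ⊑ G: some induced subgraph of G is isomorphic to H.
_⊑_ : ∀ {m n} → Graph m → Graph n → Set
_⊑_ {m} {n} H G =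
  ∃ λ (φ : Fin m → Fin n) →
    Injective _≡_ _≡_ φ ×
    (∀ u v → Graph._~_ H u v ⇔ Graph._~_ G (φ u) (φ v))

record BipartiteGraph (n : ℕ) : Set₁ where
  field
    graph : Graph n
    U W   : Subset n
  open Graph graph public
  field
    cover         : ∀ v → v ∈ U ⊎ v ∈ W
    disjoint      : ∀ {v} → v ∈ U → v ∉ W
    U-independent : ∀ {u v} → u ∈ U → v ∈ U → ¬ u ~ v
    W-independent : ∀ {u v} → u ∈ W → v ∈ W → ¬ u ~ v

------------------------------------------------------------------------
-- The class 𝒳

-- The simple graph underlying a relation: orientation and loops are dropped.
simple : ∀ {n} (R : Rel (Fin n) 0ℓ) → Decidable R → Graph n
simple R R? = record
  { _~_      = λ u v → u ≢ v × (R u v ⊎ R v u)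
  ; _~?_     = λ u v → ¬? (u ≟ᶠ v) ×-dec (R? u v ⊎-dec R? v u)
  ; ~-irrefl = λ u≡v u~v → proj₁ u~v u≡v
  ; ~-sym    = λ (u≢v , r) → ≢-sym u≢v , swap r
  }

fromEdges : ∀ {n} → List (Fin n × Fin n) → Graph n
fromEdges es = simple (λ u v → (u , v) ∈ˡ es) (λ u v → (u , v) ∈? es)
  where open DecMembership (≡-dec _≟ᶠ_ _≟ᶠ_) using (_∈?_)

-- This is the cycle Cₙ only for n ≥ 3.
cycle : ∀ n → Graph n
cycle n = simple
  (λ i j → suc (toℕ i) ≡ toℕ j ⊎ (suc (toℕ i) ≡ n × toℕ j ≡ 0))
  (λ i j → (suc (toℕ i) ℕP.≟ toℕ j)
    ⊎-dec ((suc (toℕ i) ℕP.≟ n) ×-dec (toℕ j ℕP.≟ 0)))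

S₃₃₃ : Graph 10
S₃₃₃ = fromEdges
  ( (# 0 , # 1) ∷ (# 1 , # 2) ∷ (# 2 , # 3)
  ∷ (# 0 , # 4) ∷ (# 4 , # 5) ∷ (# 5 , # 6)
  ∷ (# 0 , # 7) ∷ (# 7 , # 8) ∷ (# 8 , # 9)
  ∷ [])

-- In the next three graphs the vertices 0, …, 5 form the cycle C₆.
C₆⁺³ᶜ : Graph 9
C₆⁺³ᶜ = fromEdges
  ( (# 0 , # 1) ∷ (# 1 , # 2) ∷ (# 2 , # 3)
  ∷ (# 3 , # 4) ∷ (# 4 , # 5) ∷ (# 5 , # 0)
  ∷ (# 0 , # 6) ∷ (# 1 , # 7) ∷ (# 2 , # 8)
  ∷ [])

C₆⁺³ⁿᶜ : Graph 9
C₆⁺³ⁿᶜ = fromEdges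
  ( (# 0 , # 1) ∷ (# 1 , # 2) ∷ (# 2 , # 3)
  ∷ (# 3 , # 4) ∷ (# 4 , # 5) ∷ (# 5 , # 0)
  ∷ (# 0 , # 6) ∷ (# 2 , # 7) ∷ (# 4 , # 8)
  ∷ [])

C₆⁺²ˡ² : Graph 10
C₆⁺²ˡ² = fromEdges
  ( (# 0 , # 1) ∷ (# 1 , # 2) ∷ (# 2 , # 3)
  ∷ (# 3 , # 4) ∷ (# 4 , # 5) ∷ (# 5 , # 0)
  ∷ (# 0 , # 6) ∷ (# 6 , # 7)
  ∷ (# 1 , # 8) ∷ (# 8 , # 9)
  ∷ [])

record 𝒳 {n} (G : Graph n) : Set where
  field
    cycle-free  : ∀ k → 3 ℕ.≤ k → k ≢ 6 → ¬ cycle k ⊑ G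
    S₃₃₃-free   : ¬ S₃₃₃ ⊑ G
    C₆⁺³ᶜ-free  : ¬ C₆⁺³ᶜ ⊑ G
    C₆⁺³ⁿᶜ-free : ¬ C₆⁺³ⁿᶜ ⊑ G
    C₆⁺²ˡ²-free : ¬ C₆⁺²ˡ² ⊑ G

{-# OPTIONS --safe #-}
module Submission where

-- Points and lines in the plane represent a bipartite graph if a point lies above a line
-- exactly when they are adjacent; in suitable coordinates, u ~ w iff α u + α w + ξ u ξ w > 0.
-- Placing the vertices close to (0 , 0) and (1 , 0), one obtains unit disks for the complement.
--
-- A connected graph in 𝒳 is a chain. Its pieces are hexagons, with further paths of length
-- three parallel between two opposite vertices, and edges; consecutive pieces share a vertex
-- or an edge, and apart from this there are only leaves and stars attached to the chain. A
-- representation is grown along the chain. If ξ p is greatest on the side of p, a leaf v of p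
-- can be placed so far out that ξ v is greatest as well and the value on the edge p v dominates
-- those on the other pairs containing p or v; and at such a dominating edge, the port, there is
-- room for leaves, for a bundle of parallel paths leading to a new port, and for gluing two
-- representations.
--
-- The structure is found by induction on vertex sets S with a root p from which a path of
-- length three leaves S, so that S₃₃₃ admits only one deep branch at p within S, or with an
-- edge on a hexagon outside S, so that C₆⁺²ˡ² admits only leaves at one of its ends unless
-- there is a hexagon through it in S. On every hexagon, C₆⁺³ᶜ and C₆⁺³ⁿᶜ leave two opposite
-- vertices without further neighbours. Without hexagons the graph is cut at a vertex with two
-- deep branches, and otherwise along an edge of a hexagon.

open import Defs
open import Data.Nat.Base using (ℕ)

open import Data.Bool.Base using (Bool; true; false; not; if_then_else_)
open import Data.Bool.Properties using () renaming (_≟_ to _≟ᵇ_)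
open import Data.Empty using (⊥; ⊥-elim)
open import Data.Fin using (#_)
open import Data.Fin.Base using (Fin; zero; suc; toℕ; fromℕ<)
open import Data.Fin.Properties
  using (_≟_; all?; any?; pigeonhole; toℕ-injective; toℕ-fromℕ<; toℕ<n)
open import Data.Fin.Subset using (Subset) renaming (∣_∣ to ∣_∣ₛ; _∈_ to _∈ₛ_)
open import Data.Fin.Subset.Properties using (p⊂q⇒∣p∣<∣q∣) renaming (_∈?_ to _∈ₛ?_)
open import Data.Integer.Base using (+_)
open import Data.List.Base using (List; []; _∷_; allFin)
open import Data.List.Membership.Propositional using (_∈_)
import Data.List.Membership.DecPropositional as DecMembership
open import Data.List.Membership.Propositional.Properties using (∈-allFin)
open import Data.List.Relation.Unary.All as All using (All; []; _∷_)
open import Data.Nat.Base as ℕ using (zero; suc)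
import Data.Nat.Properties as ℕP
open import Data.Product using (∃; _×_; _,_; proj₁; proj₂)
open import Data.Product.Properties using (≡-dec)
open import Data.Rational.Base as ℚ
  using (ℚ; 0ℚ; 1ℚ; ½; _≤_; _<_; _+_; _*_; -_; _/_; _⊔_; _⊓_; ∣_∣; ↧ₙ_)
import Data.Rational.Properties as ℚP
open import Data.Rational.Solver using (module +-*-Solver)
open import Data.Sum using (_⊎_; inj₁; inj₂; [_,_]′)
open import Data.Unit.Base using (⊤; tt)
open import Data.Vec.Base using (Vec; []; _∷_; lookup; tabulate)
open import Data.Vec.Properties using (lookup∘tabulate; []=⇒lookup; lookup⇒[]=)
open import Function using (_∘_; id; mk⇔; Injective)
open import Level using (0ℓ)
open import Relation.Binary using (Rel; Symmetric; tri<; tri≈; tri>)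
open import Relation.Binary.PropositionalEquality
  using (_≡_; _≢_; refl; sym; trans; cong; cong₂; subst; subst₂; ≢-sym)
open import Relation.Nullary using (¬_; Dec; yes; no; does)
open import Relation.Nullary.Decidable
  using (True; toWitness; dec-true; dec-false; decidable-stable; _×-dec_; _⊎-dec_; _→-dec_; ¬?)
open import Relation.Unary using (Pred; _⊆_; Decidable)

-- The form `(α u + α w) + ξ u * ξ w` leaves much freedom. For `u` and `w` on different sides,
-- shifting `ξ u` by `s` and `ξ w` by `t` adds `t * ξ u + s * ξ w + s * t`, which can be subtracted
-- again from the `α` of the two sides; scaling `ξ` on one side and `α` on both only scales the
-- values. Hence an extremal edge can always be brought to one fixed position. From there each
-- extension shifts the old picture by such a map, which keeps all its signs, and puts the new
-- points into the space that opens. For a bundle of parallel paths this is a computation with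
-- absolute constants; the graph enters only through parameters that have to be small or large
-- enough.
--
-- Two pictures with the same extremal edge can be glued because that edge has `ξ = 0` at both ends
-- and all other vertices have `ξ < 0`: after the reflection `ξ` to `- ξ` of one picture, each
-- product between the pictures is negative. This is why an edge, and not only a vertex, is kept in
-- extremal position where hexagons may follow.

open ℚ-lemmas
open +-*-Solver using (solve; _:=_; _:+_; _:*_; :-_; con)

-- Rational inequalities, and sufficiently small or large numbers

infixl 6 _⊕_

_⊕_ : ∀ {p q} → 0ℚ < p → 0ℚ ≤ q → 0ℚ < p + q
_⊕_ = ℚP.+-mono-<-≤

neg≥0 : ∀ {p} → p ≤ 0ℚ → 0ℚ ≤ - p
neg≥0 = ℚP.neg-antimono-≤

neg>0 : ∀ {p} → p < 0ℚ → 0ℚ < - p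
neg>0 = ℚP.neg-antimono-<

gap≥0 : ∀ {p q} → p ≤ q → 0ℚ ≤ q + - p
gap≥0 {p} {q} p≤q = subst (_≤ q + - p) (ℚP.+-inverseʳ p) (ℚP.+-monoˡ-≤ (- p) p≤q)

gap>0 : ∀ {p q} → p < q → 0ℚ < q + - p
gap>0 {p} {q} p<q = subst (_< q + - p) (ℚP.+-inverseʳ p) (ℚP.+-monoˡ-< (- p) p<q)

-- A certificate: `s` is a sum of visibly nonnegative terms with a positive one, and what is left to
-- check is a ring identity for the solver.
neg-by : ∀ {p} s → 0ℚ < s → p + s ≡ 0ℚ → p < 0ℚ
neg-by {p} s s>0 eq = subst₂ _<_ (ℚP.+-identityʳ p) eq (ℚP.+-monoʳ-< p s>0)

nonPos-by : ∀ {p} s → 0ℚ ≤ s → p + s ≡ 0ℚ → p ≤ 0ℚ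
nonPos-by {p} s s≥0 eq = subst₂ _≤_ (ℚP.+-identityʳ p) eq (ℚP.+-monoʳ-≤ p s≥0)

<-drop : ∀ p {k} → 0ℚ < k → p + k < 0ℚ → p < 0ℚ
<-drop p {k} k>0 lt = ℚP.<-trans (subst (_< p + k) (ℚP.+-identityʳ p) (ℚP.+-monoʳ-< p k>0)) lt

square≥0 : ∀ p → 0ℚ ≤ p * p
square≥0 p with ℚP.≤-total 0ℚ p
... | inj₁ p≥0 = *-nonNeg p≥0 p≥0
... | inj₂ p≤0 = subst (0ℚ ≤_) (solve 1 (λ x → :- x :* :- x := x :* x) refl p)
  (*-nonNeg (neg≥0 p≤0) (neg≥0 p≤0))

square>0 : ∀ p → p ≢ 0ℚ → 0ℚ < p * p
square>0 p p≢0 with ℚP.<-cmp 0ℚ p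
... | tri< p>0 _ _ = *-pos p>0 p>0
... | tri≈ _ p≡0 _ = ⊥-elim (p≢0 (sym p≡0))
... | tri> _ _ p<0 = subst (0ℚ <_) (solve 1 (λ x → :- x :* :- x := x :* x) refl p)
  (*-pos (neg>0 p<0) (neg>0 p<0))

-- With `Big`, the filters of right neighbourhoods of 0 and of neighbourhoods of infinity: finitely
-- many conditions on a parameter are combined without writing down thresholds.
Small : (ℚ → Set) → Set
Small P = ∃ λ δ → 0ℚ < δ × (∀ {t} → 0ℚ < t → t ≤ δ → P t)

Big : (ℚ → Set) → Set
Big P = ∃ λ b → ∀ {t} → b ≤ t → P t

⊓>0 : ∀ {p q} → 0ℚ < p → 0ℚ < q → 0ℚ < p ⊓ q
⊓>0 {p} {q} p>0 q>0 with ℚP.⊓-sel p q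
... | inj₁ eq = subst (0ℚ <_) (sym eq) p>0
... | inj₂ eq = subst (0ℚ <_) (sym eq) q>0

small-× : ∀ {P Q : ℚ → Set} → Small P → Small Q → Small (λ t → P t × Q t)
small-× (δ , δ>0 , p) (ε , ε>0 , q) = δ ⊓ ε , ⊓>0 δ>0 ε>0 , λ t>0 t≤ →
  p t>0 (ℚP.≤-trans t≤ (ℚP.p⊓q≤p δ ε)) , q t>0 (ℚP.≤-trans t≤ (ℚP.p⊓q≤q δ ε))

big-× : ∀ {P Q : ℚ → Set} → Big P → Big Q → Big (λ t → P t × Q t)
big-× (b , p) (c , q) = b ⊔ c , λ ≤t →
  p (ℚP.≤-trans (ℚP.p≤p⊔q b c) ≤t) , q (ℚP.≤-trans (ℚP.p≤q⊔p b c) ≤t)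

small-all : ∀ {n} {P : Fin n → ℚ → Set} → (∀ i → Small (P i)) → Small (λ t → ∀ i → P i t)
small-all {zero}  h = 1ℚ , ℚP.positive⁻¹ 1ℚ , λ _ _ ()
small-all {suc n} h with small-× (h zero) (small-all (λ i → h (suc i)))
... | δ , δ>0 , p = δ , δ>0 , λ t>0 t≤ →
  λ { zero → proj₁ (p t>0 t≤) ; (suc i) → proj₂ (p t>0 t≤) i }

big-all : ∀ {n} {P : Fin n → ℚ → Set} → (∀ i → Big (P i)) → Big (λ t → ∀ i → P i t)
big-all {zero}  h = 0ℚ , λ _ ()
big-all {suc n} h with big-× (h zero) (big-all (λ i → h (suc i)))
... | b , p = b , λ ≤t → λ { zero → proj₁ (p ≤t) ; (suc i) → proj₂ (p ≤t) i }

half< : ∀ {p} → 0ℚ < p → ½ * p < p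
half< {p} p>0 = subst₂ _<_ (ℚP.+-identityʳ (½ * p)) (halves p)
  (ℚP.+-monoʳ-< (½ * p) (half>0 p>0))

small-linear : ∀ a {b} → 0ℚ < b → Small (λ t → t * a < b)
small-linear a {b} b>0 with ℚP.<-cmp 0ℚ a
... | tri< a>0 _ _ = let η , η>0 , eq = divide a (½ * b) a>0 (half>0 b>0) in
  η , η>0 , λ {t} _ t≤η → ℚP.≤-<-trans
    (subst (t * a ≤_) (trans (ℚP.*-comm η a) eq)
      (ℚP.*-monoʳ-≤-nonNeg a {{ℚ.nonNegative (ℚP.<⇒≤ a>0)}} t≤η))
    (half< b>0)
... | tri≈ _ a≡0 _ = 1ℚ , ℚP.positive⁻¹ 1ℚ , λ {t} _ _ →
  subst (_< b) (sym (trans (cong (t *_) (sym a≡0)) (ℚP.*-zeroʳ t))) b>0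
... | tri> _ _ a<0 = 1ℚ , ℚP.positive⁻¹ 1ℚ , λ {t} t>0 _ →
  ℚP.<-trans (neg-by (t * - a) (*-pos t>0 (neg>0 a<0))
    (solve 2 (λ x y → x :* y :+ x :* :- y := con 0ℚ) refl t a)) b>0

big-> : ∀ a → Big (a <_)
big-> a = a + 1ℚ , λ ≤t → ℚP.<-≤-trans
  (subst (_< a + 1ℚ) (ℚP.+-identityʳ a) (ℚP.+-monoʳ-< a (ℚP.positive⁻¹ 1ℚ))) ≤t

big-linear : ∀ a {d} → 0ℚ < d → Big (λ t → a < t * d)
big-linear a {d} d>0 =
  let η , η>0 , eq = divide d (1ℚ + ∣ a ∣) d>0 (ℚP.positive⁻¹ 1ℚ ⊕ ℚP.0≤∣p∣ a) in
  η , λ {t} η≤t → ℚP.<-≤-trans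
    (ℚP.≤-<-trans (p≤∣p∣ a)
      (subst (_< 1ℚ + ∣ a ∣) (ℚP.+-identityˡ ∣ a ∣) (ℚP.+-monoˡ-< ∣ a ∣ (ℚP.positive⁻¹ 1ℚ))))
    (subst (_≤ t * d) (trans (ℚP.*-comm η d) eq)
      (ℚP.*-monoʳ-≤-nonNeg d {{ℚ.nonNegative (ℚP.<⇒≤ d>0)}} η≤t))

-- The form `_∙_` and the positions of a bundle of parallel paths

Point : Set
Point = ℚ × ℚ

infix 7 _∙_

_∙_ : Point → Point → ℚ
(α , ξ) ∙ (β , η) = (α + β) + ξ * η

k : ℕ → ℚ
k m = + m / 1

¼ : ℚ
¼ = + 1 / 4

Spread : ∀ n → (Fin n → ℚ) → Set
Spread n φ = (∀ i → 0ℚ ≤ φ i × φ i ≤ ¼) × (∀ i j → φ i ≡ φ j → i ≡ j)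

-- Halving the earlier values keeps them distinct and moves them strictly below the new value `¼`.
spread : ∀ n → ∃ (Spread n)
spread zero = (λ ()) , (λ ()) , λ ()
spread (suc n) = φ , range , inj
  where
  φ′ = proj₁ (spread n)
  range′ = proj₁ (proj₂ (spread n))
  inj′ = proj₂ (proj₂ (spread n))
  φ : Fin (suc n) → ℚ
  φ zero = ¼
  φ (suc i) = ½ * φ′ i
  small : ∀ i → ½ * φ′ i < ¼
  small i = ℚP.≤-<-trans (ℚP.*-monoˡ-≤-nonNeg ½ (proj₂ (range′ i))) (half< {¼} (ℚP.positive⁻¹ ¼))
  range : ∀ i → 0ℚ ≤ φ i × φ i ≤ ¼
  range zero = ℚP.nonNegative⁻¹ ¼ , ℚP.≤-refl
  range (suc i) = *-nonNeg (ℚP.nonNegative⁻¹ ½) (proj₁ (range′ i)) , ℚP.<⇒≤ (small i)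
  inj : ∀ i j → φ i ≡ φ j → i ≡ j
  inj zero zero _ = refl
  inj zero (suc j) eq = ⊥-elim (ℚP.<-irrefl (sym eq) (small j))
  inj (suc i) zero eq = ⊥-elim (ℚP.<-irrefl eq (small i))
  inj (suc i) (suc j) eq = cong suc (inj′ i j (trans (sym (halves (φ′ i)))
    (trans (cong₂ _+_ eq eq) (halves (φ′ j)))))

-- The numbers are one solution of the finitely many sign conditions that follow. Apart from `y∙x`,
-- every certificate keeps a positive constant term; the tightest is the `¼` in `y∙x₂`.
port pt-y₁ pt-x₂ : Point
port  = k 20 , 0ℚ
pt-y₁ = - k 17 , - k 10
pt-x₂ = - k 17 , - k 3

-- Shifting `ξ` by 16 on one side and by 8 on the other is undone by the terms `k 16 * x` and
-- `k 8 * x` of the opposite side and by `48 + 80 = 16 * 8`. Old values stay as they are, while the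
-- old port leaves its place free for the new one.
near far : Point → Point
near (a , x) = a + k 8 * x + - k 48 , x + - k 16
far  (a , x) = a + k 16 * x + - k 80 , x + - k 8

-- For `r = 0` these are points of a parabola and its tangents. Raised by `r`, point and tangent
-- meet exactly for equal parameters as soon as `r + r` is below every squared gap, which realises a
-- matching.
pt-y pt-x : ℚ → ℚ → Point
pt-y r f = r + - k 8 + k 8 * f + - (f * f) , - k 8 + k 2 * f
pt-x r f = r + - k 24 + k 8 * f + - (f * f) , - k 4 + f

near∙far : ∀ P Q → near P ∙ far Q ≡ P ∙ Q
near∙far (a , x) (b , y) = solve 4 (λ a x b y →
  ((a :+ con (k 8) :* x :+ :- con (k 48)) :+ (b :+ con (k 16) :* y :+ :- con (k 80))) :+
  (x :+ :- con (k 16)) :* (y :+ :- con (k 8)) := (a :+ b) :+ x :* y) refl a x b y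

y∙x : ∀ r f g → pt-y r f ∙ pt-x r g ≡ (r + r) + - ((f + - g) * (f + - g))
y∙x = solve 3 (λ r f g →
  ((r :+ :- con (k 8) :+ con (k 8) :* f :+ :- (f :* f)) :+
   (r :+ :- con (k 24) :+ con (k 8) :* g :+ :- (g :* g))) :+
  (:- con (k 8) :+ con (k 2) :* f) :* (:- con (k 4) :+ g)
    := (r :+ r) :+ :- ((f :+ :- g) :* (f :+ :- g))) refl

old∙x₂ : ∀ {a x} → a ≤ 0ℚ → x ≤ 0ℚ →
  near (a , x) ∙ pt-x₂ < 0ℚ
old∙x₂ {a} {x} a≤0 x≤0 =
  neg-by (k 17 + (- a) + k 5 * (- x))
    (ℚP.positive⁻¹ (k 17) ⊕ neg≥0 a≤0 ⊕ *-nonNeg (ℚP.nonNegative⁻¹ (k 5)) x≥)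
    (solve 2 (λ a x →
      (a :+ con (k 8) :* x :+ (:- con (k 48)) :+ (:- con (k 17)) :+ (x :+
        (:- con (k 16))) :* (:- con (k 3))) :+
        (con (k 17) :+ (:- a) :+ con (k 5) :* (:- x)) := con 0ℚ) refl a x)
  where
  x≥ = neg≥0 x≤0

old∙b : ∀ {a x} → a ≤ 0ℚ → x ≤ 0ℚ →
  near (a , x) ∙ port < 0ℚ
old∙b {a} {x} a≤0 x≤0 =
  neg-by (k 28 + (- a) + k 8 * (- x))
    (ℚP.positive⁻¹ (k 28) ⊕ neg≥0 a≤0 ⊕ *-nonNeg (ℚP.nonNegative⁻¹ (k 8)) x≥)
    (solve 2 (λ a x →
      (a :+ con (k 8) :* x :+ (:- con (k 48)) :+ con (k 20) :+ (x :+
        (:- con (k 16))) :* con (k 0)) :+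
        (con (k 28) :+ (:- a) :+ con (k 8) :* (:- x)) := con 0ℚ) refl a x)
  where
  x≥ = neg≥0 x≤0

old∙x : ∀ {a x f r} → a ≤ 0ℚ → x ≤ 0ℚ → 0ℚ ≤ f × f ≤ ¼ → 0ℚ < r × r ≤ ¼ →
  near (a , x) ∙ pt-x r f < 0ℚ
old∙x {a} {x} {f} {r} a≤0 x≤0 (f≥0 , f≤¼) (r>0 , r≤¼) =
  neg-by ((+ 31 / 4) + (¼ + (- r)) + (- a) + (- x) * (k 4 + f) + k 8 * f + f * f)
    (ℚP.positive⁻¹ (+ 31 / 4) ⊕ r≤ ⊕ neg≥0 a≤0 ⊕
      *-nonNeg x≥ (+-nonNeg (ℚP.nonNegative⁻¹ (k 4)) f≥0) ⊕
      *-nonNeg (ℚP.nonNegative⁻¹ (k 8)) f≥0 ⊕ *-nonNeg f≥0 f≥0)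
    (solve 4 (λ a x f r →
      (a :+ con (k 8) :* x :+ (:- con (k 48)) :+ (r :+ (:- con (k 24)) :+ con (k 8) :* f :+
        (:- (f :* f))) :+ (x :+ (:- con (k 16))) :* ((:- con (k 4)) :+ f)) :+
        (con (+ 31 / 4) :+ (con ¼ :+ (:- r)) :+ (:- a) :+ (:- x) :* (con (k 4) :+ f) :+
          con (k 8) :* f :+ f :* f) := con 0ℚ) refl a x f r)
  where
  r≤ = gap≥0 r≤¼
  x≥ = neg≥0 x≤0

a∙x : ∀ {f r} → 0ℚ ≤ f × f ≤ ¼ → 0ℚ < r × r ≤ ¼ →
  0ℚ < near port ∙ pt-x r f
a∙x {f} {r} (f≥0 , f≤¼) (r>0 , r≤¼) =
  subst (0ℚ <_) (solve 2 (λ f r →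
      con (+ 159 / 16) :+ r :+ con (+ 33 / 4) :* (con ¼ :+ (:- f)) :+ f :* (con ¼ :+ (:- f))
        := (:- con (k 28)) :+ (r :+ (:- con (k 24)) :+ con (k 8) :* f :+ (:- (f :* f))) :+
          (:- con (k 16)) :* ((:- con (k 4)) :+ f)) refl f r)
    (ℚP.positive⁻¹ (+ 159 / 16) ⊕ r≥0 ⊕ *-nonNeg (ℚP.nonNegative⁻¹ (+ 33 / 4)) f≤ ⊕
      *-nonNeg f≥0 f≤)
  where
  r≥0 = ℚP.<⇒≤ r>0
  f≤ = gap≥0 f≤¼

y₁∙old : ∀ {a x} → a ≤ 0ℚ → x ≤ 0ℚ →
  pt-y₁ ∙ far (a , x) < 0ℚ
y₁∙old {a} {x} a≤0 x≤0 =
  neg-by (k 17 + (- a) + k 6 * (- x))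
    (ℚP.positive⁻¹ (k 17) ⊕ neg≥0 a≤0 ⊕ *-nonNeg (ℚP.nonNegative⁻¹ (k 6)) x≥)
    (solve 2 (λ a x →
      ((:- con (k 17)) :+ (a :+ con (k 16) :* x :+ (:- con (k 80))) :+
        (:- con (k 10)) :* (x :+ (:- con (k 8)))) :+
        (con (k 17) :+ (:- a) :+ con (k 6) :* (:- x)) := con 0ℚ) refl a x)
  where
  x≥ = neg≥0 x≤0

y₂∙old : ∀ {a x} → a ≤ 0ℚ → x ≤ 0ℚ →
  port ∙ far (a , x) < 0ℚ
y₂∙old {a} {x} a≤0 x≤0 =
  neg-by (k 60 + (- a) + k 16 * (- x))
    (ℚP.positive⁻¹ (k 60) ⊕ neg≥0 a≤0 ⊕ *-nonNeg (ℚP.nonNegative⁻¹ (k 16)) x≥)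
    (solve 2 (λ a x →
      (con (k 20) :+ (a :+ con (k 16) :* x :+ (:- con (k 80))) :+ con (k 0) :* (x :+
        (:- con (k 8)))) :+
        (con (k 60) :+ (:- a) :+ con (k 16) :* (:- x)) := con 0ℚ) refl a x)
  where
  x≥ = neg≥0 x≤0

y∙old : ∀ {a x f r} → a ≤ 0ℚ → x ≤ 0ℚ → 0ℚ ≤ f × f ≤ ¼ → 0ℚ < r × r ≤ ¼ →
  pt-y r f ∙ far (a , x) < 0ℚ
y∙old {a} {x} {f} {r} a≤0 x≤0 (f≥0 , f≤¼) (r>0 , r≤¼) =
  neg-by ((+ 95 / 4) + (¼ + (- r)) + (- a) + (- x) * (k 8 + k 2 * f) + k 8 * f + f * f)
    (ℚP.positive⁻¹ (+ 95 / 4) ⊕ r≤ ⊕ neg≥0 a≤0 ⊕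
      *-nonNeg x≥ (+-nonNeg (ℚP.nonNegative⁻¹ (k 8)) (*-nonNeg (ℚP.nonNegative⁻¹ (k 2)) f≥0)) ⊕
      *-nonNeg (ℚP.nonNegative⁻¹ (k 8)) f≥0 ⊕ *-nonNeg f≥0 f≥0)
    (solve 4 (λ a x f r →
      (r :+ (:- con (k 8)) :+ con (k 8) :* f :+ (:- (f :* f)) :+ (a :+ con (k 16) :* x :+
        (:- con (k 80))) :+ ((:- con (k 8)) :+ con (k 2) :* f) :* (x :+ (:- con (k 8)))) :+
        (con (+ 95 / 4) :+ (con ¼ :+ (:- r)) :+ (:- a) :+ (:- x) :* (con (k 8) :+
          con (k 2) :* f) :+ con (k 8) :* f :+ f :* f) := con 0ℚ) refl a x f r)
  where
  r≤ = gap≥0 r≤¼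
  x≥ = neg≥0 x≤0

y∙x₁ : ∀ {f r} → 0ℚ ≤ f × f ≤ ¼ → 0ℚ < r × r ≤ ¼ →
  pt-y r f ∙ far port < 0ℚ
y∙x₁ {f} {r} (f≥0 , f≤¼) (r>0 , r≤¼) =
  neg-by ((+ 15 / 4) + (¼ + (- r)) + k 8 * f + f * f)
    (ℚP.positive⁻¹ (+ 15 / 4) ⊕ r≤ ⊕ *-nonNeg (ℚP.nonNegative⁻¹ (k 8)) f≥0 ⊕
      *-nonNeg f≥0 f≥0)
    (solve 2 (λ f r →
      (r :+ (:- con (k 8)) :+ con (k 8) :* f :+ (:- (f :* f)) :+ (:- con (k 60)) :+
        ((:- con (k 8)) :+ con (k 2) :* f) :* (:- con (k 8))) :+
        (con (+ 15 / 4) :+ (con ¼ :+ (:- r)) :+ con (k 8) :* f :+ f :* f) := con 0ℚ) refl f r)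
  where
  r≤ = gap≥0 r≤¼

y₁∙x : ∀ {f r} → 0ℚ ≤ f × f ≤ ¼ → 0ℚ < r × r ≤ ¼ →
  pt-y₁ ∙ pt-x r f < 0ℚ
y₁∙x {f} {r} (f≥0 , f≤¼) (r>0 , r≤¼) =
  neg-by ((+ 3 / 4) + (¼ + (- r)) + k 2 * f + f * f)
    (ℚP.positive⁻¹ (+ 3 / 4) ⊕ r≤ ⊕ *-nonNeg (ℚP.nonNegative⁻¹ (k 2)) f≥0 ⊕
      *-nonNeg f≥0 f≥0)
    (solve 2 (λ f r →
      ((:- con (k 17)) :+ (r :+ (:- con (k 24)) :+ con (k 8) :* f :+ (:- (f :* f))) :+
        (:- con (k 10)) :* ((:- con (k 4)) :+ f)) :+
        (con (+ 3 / 4) :+ (con ¼ :+ (:- r)) :+ con (k 2) :* f :+ f :* f) := con 0ℚ) refl f r)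
  where
  r≤ = gap≥0 r≤¼

y₂∙x : ∀ {f r} → 0ℚ ≤ f × f ≤ ¼ → 0ℚ < r × r ≤ ¼ →
  port ∙ pt-x r f < 0ℚ
y₂∙x {f} {r} (f≥0 , f≤¼) (r>0 , r≤¼) =
  neg-by ((+ 7 / 4) + (¼ + (- r)) + k 8 * (¼ + (- f)) + f * f)
    (ℚP.positive⁻¹ (+ 7 / 4) ⊕ r≤ ⊕ *-nonNeg (ℚP.nonNegative⁻¹ (k 8)) f≤ ⊕
      *-nonNeg f≥0 f≥0)
    (solve 2 (λ f r →
      (con (k 20) :+ (r :+ (:- con (k 24)) :+ con (k 8) :* f :+ (:- (f :* f))) :+
        con (k 0) :* ((:- con (k 4)) :+ f)) :+
        (con (+ 7 / 4) :+ (con ¼ :+ (:- r)) :+ con (k 8) :* (con ¼ :+ (:- f)) :+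
          f :* f) := con 0ℚ) refl f r)
  where
  r≤ = gap≥0 r≤¼
  f≤ = gap≥0 f≤¼

y∙x₂ : ∀ {f r} → 0ℚ ≤ f × f ≤ ¼ → 0ℚ < r × r ≤ ¼ →
  pt-y r f ∙ pt-x₂ < 0ℚ
y∙x₂ {f} {r} (f≥0 , f≤¼) (r>0 , r≤¼) =
  neg-by (¼ + (¼ + (- r)) + k 2 * (¼ + (- f)) + f * f)
    (ℚP.positive⁻¹ ¼ ⊕ r≤ ⊕ *-nonNeg (ℚP.nonNegative⁻¹ (k 2)) f≤ ⊕ *-nonNeg f≥0 f≥0)
    (solve 2 (λ f r →
      (r :+ (:- con (k 8)) :+ con (k 8) :* f :+ (:- (f :* f)) :+ (:- con (k 17)) :+
        ((:- con (k 8)) :+ con (k 2) :* f) :* (:- con (k 3))) :+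
        (con ¼ :+ (con ¼ :+ (:- r)) :+ con (k 2) :* (con ¼ :+ (:- f)) :+
          f :* f) := con 0ℚ) refl f r)
  where
  r≤ = gap≥0 r≤¼
  f≤ = gap≥0 f≤¼

y∙b : ∀ {f r} → 0ℚ ≤ f × f ≤ ¼ → 0ℚ < r × r ≤ ¼ →
  0ℚ < pt-y r f ∙ port
y∙b {f} {r} (f≥0 , f≤¼) (r>0 , r≤¼) =
  subst (0ℚ <_) (solve 2 (λ f r →
      con (k 12) :+ r :+ con (+ 31 / 4) :* f :+ f :* (con ¼ :+ (:- f))
        := r :+ (:- con (k 8)) :+ con (k 8) :* f :+ (:- (f :* f)) :+ con (k 20) :+
          ((:- con (k 8)) :+ con (k 2) :* f) :* con (k 0)) refl f r)
    (ℚP.positive⁻¹ (k 12) ⊕ r≥0 ⊕ *-nonNeg (ℚP.nonNegative⁻¹ (+ 31 / 4)) f≥0 ⊕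
      *-nonNeg f≥0 f≤)
  where
  r≥0 = ℚP.<⇒≤ r>0
  f≤ = gap≥0 f≤¼

near-ξ : ∀ {x} → x ≤ 0ℚ →
  x + (- k 16) < 0ℚ
near-ξ {x} x≤0 =
  neg-by (k 16 + (- x))
    (ℚP.positive⁻¹ (k 16) ⊕ x≥)
    (solve 1 (λ x →
      (x :+ (:- con (k 16))) :+
        (con (k 16) :+ (:- x)) := con 0ℚ) refl x)
  where
  x≥ = neg≥0 x≤0

near-α : ∀ {a x} → a ≤ 0ℚ → x ≤ 0ℚ →
  a + k 8 * x + (- k 48) ≤ 0ℚ
near-α {a} {x} a≤0 x≤0 =
  nonPos-by (k 48 + (- a) + k 8 * (- x))
    (ℚP.<⇒≤ (ℚP.positive⁻¹ (k 48) ⊕ neg≥0 a≤0 ⊕ *-nonNeg (ℚP.nonNegative⁻¹ (k 8)) x≥))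
    (solve 2 (λ a x →
      (a :+ con (k 8) :* x :+ (:- con (k 48))) :+
        (con (k 48) :+ (:- a) :+ con (k 8) :* (:- x)) := con 0ℚ) refl a x)
  where
  x≥ = neg≥0 x≤0

far-ξ : ∀ {x} → x ≤ 0ℚ →
  x + (- k 8) < 0ℚ
far-ξ {x} x≤0 =
  neg-by (k 8 + (- x))
    (ℚP.positive⁻¹ (k 8) ⊕ x≥)
    (solve 1 (λ x →
      (x :+ (:- con (k 8))) :+
        (con (k 8) :+ (:- x)) := con 0ℚ) refl x)
  where
  x≥ = neg≥0 x≤0

far-α : ∀ {a x} → a ≤ 0ℚ → x ≤ 0ℚ →
  a + k 16 * x + (- k 80) ≤ 0ℚ
far-α {a} {x} a≤0 x≤0 =
  nonPos-by (k 80 + (- a) + k 16 * (- x))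
    (ℚP.<⇒≤ (ℚP.positive⁻¹ (k 80) ⊕ neg≥0 a≤0 ⊕ *-nonNeg (ℚP.nonNegative⁻¹ (k 16)) x≥))
    (solve 2 (λ a x →
      (a :+ con (k 16) :* x :+ (:- con (k 80))) :+
        (con (k 80) :+ (:- a) :+ con (k 16) :* (:- x)) := con 0ℚ) refl a x)
  where
  x≥ = neg≥0 x≤0

y-ξ : ∀ {f} → 0ℚ ≤ f × f ≤ ¼ →
  proj₂ (pt-y 0ℚ f) < 0ℚ
y-ξ {f} (f≥0 , f≤¼) =
  neg-by ((+ 15 / 2) + k 2 * (¼ + (- f)))
    (ℚP.positive⁻¹ (+ 15 / 2) ⊕ *-nonNeg (ℚP.nonNegative⁻¹ (k 2)) f≤)
    (solve 1 (λ f →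
      ((:- con (k 8)) :+ con (k 2) :* f) :+
        (con (+ 15 / 2) :+ con (k 2) :* (con ¼ :+ (:- f))) := con 0ℚ) refl f)
  where
  f≤ = gap≥0 f≤¼

y-α : ∀ {f r} → 0ℚ ≤ f × f ≤ ¼ → 0ℚ < r × r ≤ ¼ →
  proj₁ (pt-y r f) ≤ 0ℚ
y-α {f} {r} (f≥0 , f≤¼) (r>0 , r≤¼) =
  nonPos-by ((+ 23 / 4) + (¼ + (- r)) + k 8 * (¼ + (- f)) + f * f)
    (ℚP.<⇒≤ (ℚP.positive⁻¹ (+ 23 / 4) ⊕ r≤ ⊕ *-nonNeg (ℚP.nonNegative⁻¹ (k 8)) f≤ ⊕
      *-nonNeg f≥0 f≥0))
    (solve 2 (λ f r →
      (r :+ (:- con (k 8)) :+ con (k 8) :* f :+ (:- (f :* f))) :+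
        (con (+ 23 / 4) :+ (con ¼ :+ (:- r)) :+ con (k 8) :* (con ¼ :+ (:- f)) :+
          f :* f) := con 0ℚ) refl f r)
  where
  r≤ = gap≥0 r≤¼
  f≤ = gap≥0 f≤¼

x-ξ : ∀ {f} → 0ℚ ≤ f × f ≤ ¼ →
  proj₂ (pt-x 0ℚ f) < 0ℚ
x-ξ {f} (f≥0 , f≤¼) =
  neg-by ((+ 15 / 4) + (¼ + (- f)))
    (ℚP.positive⁻¹ (+ 15 / 4) ⊕ f≤)
    (solve 1 (λ f →
      ((:- con (k 4)) :+ f) :+
        (con (+ 15 / 4) :+ (con ¼ :+ (:- f))) := con 0ℚ) refl f)
  where
  f≤ = gap≥0 f≤¼

x-α : ∀ {f r} → 0ℚ ≤ f × f ≤ ¼ → 0ℚ < r × r ≤ ¼ →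
  proj₁ (pt-x r f) ≤ 0ℚ
x-α {f} {r} (f≥0 , f≤¼) (r>0 , r≤¼) =
  nonPos-by ((+ 87 / 4) + (¼ + (- r)) + k 8 * (¼ + (- f)) + f * f)
    (ℚP.<⇒≤ (ℚP.positive⁻¹ (+ 87 / 4) ⊕ r≤ ⊕ *-nonNeg (ℚP.nonNegative⁻¹ (k 8)) f≤ ⊕
      *-nonNeg f≥0 f≥0))
    (solve 2 (λ f r →
      (r :+ (:- con (k 24)) :+ con (k 8) :* f :+ (:- (f :* f))) :+
        (con (+ 87 / 4) :+ (con ¼ :+ (:- r)) :+ con (k 8) :* (con ¼ :+ (:- f)) :+
          f :* f) := con 0ℚ) refl f r)
  where
  r≤ = gap≥0 r≤¼
  f≤ = gap≥0 f≤¼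

Gap : ∀ {n} → (Fin n → ℚ) → ℚ → Set
Gap φ r = ∀ i j → i ≢ j → r + r < (φ i + - φ j) * (φ i + - φ j)

gaps : ∀ {n} (φ : Fin n → ℚ) → Spread n φ → ∃ λ r → (0ℚ < r × r ≤ ¼) × Gap φ r
gaps φ (_ , inj) = r , (r>0 , ℚP.<⇒≤ (subst (_< ¼) (ℚP.*-identityʳ r) (proj₁ r<))) ,
  λ i j i≢j → subst (_< d i j) (solve 1 (λ r → r :* con (k 2) := r :+ r) refl r) (proj₂ r< i j i≢j)
  where
  d : _ → _ → ℚ
  d i j = (φ i + - φ j) * (φ i + - φ j)
  G : _ → _ → ℚ → Set
  G i j t = i ≢ j → t * k 2 < d i j
  gap : ∀ i j → Small (G i j)
  gap i j with i ≟ j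
  ... | yes i≡j = 1ℚ , ℚP.positive⁻¹ 1ℚ , λ _ _ i≢j → ⊥-elim (i≢j i≡j)
  ... | no i≢j = let δ , δ>0 , h = small-linear (k 2) (square>0 (φ i + - φ j) λ eq → i≢j (inj i j
                       (trans (solve 2 (λ x y → x := (x :+ :- y) :+ y) refl (φ i) (φ j))
                         (trans (cong (_+ φ j) eq) (ℚP.+-identityˡ (φ j))))))
                 in δ , δ>0 , λ t>0 t≤ _ → h t>0 t≤
  small : Small (λ t → t * 1ℚ < ¼ × (∀ i j → G i j t))
  small = small-× (small-linear 1ℚ (ℚP.positive⁻¹ ¼)) (small-all λ i → small-all (gap i))
  r = proj₁ small
  r>0 : 0ℚ < r
  r>0 = proj₁ (proj₂ small)
  r< : r * 1ℚ < ¼ × (∀ i j → G i j r)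
  r< = proj₂ (proj₂ small) r>0 ℚP.≤-refl

-- Representations and their extension

module Representation {n : ℕ} (side : Fin n → Bool) (_~_ : Rel (Fin n) 0ℓ)
  (~-sym : Symmetric _~_) (~⇒≢ : ∀ {u v} → u ~ v → side u ≢ side v) where

  V : Set
  V = Fin n

  ∙-comm : ∀ P Q → P ∙ Q ≡ Q ∙ P
  ∙-comm (α , ξ) (β , η) = cong₂ _+_ (ℚP.+-comm α β) (ℚP.*-comm ξ η)

  -- The negative case is strict so that it can absorb the terms of higher order when the points
  -- become disks.
  Sign : ℚ → Set → Set
  Sign x A = (A → 0ℚ < x) × (¬ A → x < 0ℚ)

  sign-pos : ∀ {x A} → A → 0ℚ < x → Sign x A
  sign-pos a x>0 = (λ _ → x>0) , λ ¬a → ⊥-elim (¬a a)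

  sign-neg : ∀ {x A} → ¬ A → x < 0ℚ → Sign x A
  sign-neg ¬a x<0 = (λ a → ⊥-elim (¬a a)) , λ _ → x<0

  sign-sym : ∀ P Q {u v} → Sign (P ∙ Q) (u ~ v) → Sign (Q ∙ P) (v ~ u)
  sign-sym P Q (s , t) =
    (λ a → subst (0ℚ <_) (∙-comm P Q) (s (~-sym a))) ,
    (λ ¬a → subst (_< 0ℚ) (∙-comm P Q) (t (¬a ∘ ~-sym)))

  sign-scale : ∀ {c x A} → 0ℚ < c → Sign x A → Sign (c * x) A
  sign-scale {c} {x} c>0 (s , t) =
    (λ a → *-pos c>0 (s a)) ,
    (λ ¬a → neg-by (c * - x) (*-pos c>0 (neg>0 (t ¬a)))
      (solve 2 (λ c x → c :* x :+ c :* :- x := con 0ℚ) refl c x))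

  record Rep (S : Pred V 0ℓ) : Set where
    field
      pt   : V → Point
      sign : ∀ {u v} → S u → S v → side u ≢ side v → Sign (pt u ∙ pt v) (u ~ v)
    α ξ : V → ℚ
    α = proj₁ ∘ pt
    ξ = proj₂ ∘ pt

  record VRep (S : Pred V 0ℓ) (p : V) : Set where
    field
      rep : Rep S
    open Rep rep public
    field
      last : ∀ {x} → S x → side x ≡ side p → x ≢ p → ξ x < ξ p

  -- A representation in which p and q come last on their sides, and in which the value on
  -- the edge p q is at least twice that on any other pair containing p or q, takes this
  -- form after rescaling and shifting ξ separately on both sides.
  record PortRep (S : Pred V 0ℓ) (p q : V) : Set where
    field
      rep : Rep S
    open Rep rep public
    field
      pt-p : pt p ≡ port
      pt-q : pt q ≡ port
      rest : ∀ {x} → S x → x ≢ p → x ≢ q → α x ≤ 0ℚ × ξ x < 0ℚ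

  Rep-⊆ : ∀ {S T} → T ⊆ S → Rep S → Rep T
  Rep-⊆ T⊆S R = record { pt = pt ; sign = λ u v → sign (T⊆S u) (T⊆S v) }
    where open Rep R

  VRep-⊆ : ∀ {S T p} → T ⊆ S → VRep S p → VRep T p
  VRep-⊆ T⊆S R = record { rep = Rep-⊆ T⊆S rep ; last = last ∘ T⊆S }
    where open VRep R

  PortRep-⊆ : ∀ {S T p q} → T ⊆ S → PortRep S p q → PortRep T p q
  PortRep-⊆ T⊆S R = record { rep = Rep-⊆ T⊆S rep ; pt-p = pt-p ; pt-q = pt-q ; rest = rest ∘ T⊆S }
    where open PortRep R

  PortRep-sym : ∀ {S p q} → PortRep S p q → PortRep S q p
  PortRep-sym R = record
    { rep = rep ; pt-p = pt-q ; pt-q = pt-p ; rest = λ s x≢q x≢p → rest s x≢p x≢q }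
    where open PortRep R

  PortRep⇒VRep : ∀ {S p q} → side p ≢ side q → PortRep S p q → VRep S p
  PortRep⇒VRep {p = p} p≢q R = record
    { rep = rep
    ; last = λ {x} s same x≢p → subst (ξ x <_) (sym (cong proj₂ pt-p))
        (proj₂ (rest s x≢p (λ { refl → p≢q (sym same) })))
    }
    where open PortRep R

  sameSide : ∀ {a b c : Bool} → a ≢ b → b ≢ c → a ≡ c
  sameSide {false} {false} a≢b _ = ⊥-elim (a≢b refl)
  sameSide {false} {true} {false} _ _ = refl
  sameSide {false} {true} {true} _ b≢c = ⊥-elim (b≢c refl)
  sameSide {true} {true} a≢b _ = ⊥-elim (a≢b refl)
  sameSide {true} {false} {true} _ _ = refl
  sameSide {true} {false} {false} _ b≢c = ⊥-elim (b≢c refl)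

  choose : ∀ {A B : Set} → Dec A → B → B → B
  choose d x y = if does d then x else y

  choose-yes : ∀ {A B : Set} (d : Dec A) {x y : B} → A → choose d x y ≡ x
  choose-yes d a rewrite dec-true d a = refl

  choose-no : ∀ {A B : Set} (d : Dec A) {x y : B} → ¬ A → choose d x y ≡ y
  choose-no d ¬a rewrite dec-false d ¬a = refl

  sign-at : ∀ {P P′ Q Q′ : Point} {A} → P ≡ P′ → Q ≡ Q′ → Sign (P′ ∙ Q′) A → Sign (P ∙ Q) A
  sign-at refl refl s = s

  bySide : ∀ {S : Pred V 0ℓ} (p : V) (f : V → Point) →
    (∀ {u w} → S u → S w → side u ≡ side p → side w ≢ side p → Sign (f u ∙ f w) (u ~ w)) →
    ∀ {u v} → S u → S v → side u ≢ side v → Sign (f u ∙ f v) (u ~ v)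
  bySide p f h {u} {v} su sv u≢v with side u ≟ᵇ side p
  ... | yes u≡p = h su sv u≡p (λ v≡p → u≢v (trans u≡p (sym v≡p)))
  ... | no  u≢p = sign-sym (f v) (f u) (h sv su (sameSide (u≢v ∘ sym) u≢p) u≢p)

  insert : (f : V → Point) (v : V) → Point → V → Point
  insert f v P x = choose (x ≟ v) P (f x)

  _∪｛_｝ : Pred V 0ℓ → V → Pred V 0ℓ
  (S ∪｛ v ｝) x = S x ⊎ x ≡ v

  insert-sign : ∀ {S : Pred V 0ℓ} {f v P} → ¬ S v →
    (∀ {x y} → S x → S y → side x ≢ side y → Sign (f x ∙ f y) (x ~ y)) →
    (∀ {x} → S x → side x ≢ side v → Sign (f x ∙ P) (x ~ v)) →
    ∀ {x y} → (S ∪｛ v ｝) x → (S ∪｛ v ｝) y → side x ≢ side y →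
    Sign (insert f v P x ∙ insert f v P y) (x ~ y)
  insert-sign {S} {f} {v} {P} v∉S oo ov = go
    where
    new : insert f v P v ≡ P
    new = choose-yes (v ≟ v) refl
    same : ∀ {x} → S x → insert f v P x ≡ f x
    same {x} s = choose-no (x ≟ v) (λ { refl → v∉S s })
    go : ∀ {x y} → (S ∪｛ v ｝) x → (S ∪｛ v ｝) y → side x ≢ side y →
      Sign (insert f v P x ∙ insert f v P y) (x ~ y)
    go (inj₁ sx) (inj₁ sy) d = sign-at (same sx) (same sy) (oo sx sy d)
    go (inj₁ sx) (inj₂ refl) d = sign-at (same sx) new (ov sx d)
    go {_} {y} (inj₂ refl) (inj₁ sy) d =
      sign-at new (same sy) (sign-sym (f y) P (ov sy (d ∘ sym)))
    go (inj₂ refl) (inj₂ refl) d = ⊥-elim (d refl)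

  insert-old : ∀ (S : Pred V 0ℓ) f v P {x} → ¬ S v → S x → insert f v P x ≡ f x
  insert-old S f v P {x} v∉S s = choose-no (x ≟ v) (λ { refl → v∉S s })

  empty : ∀ {S} → (∀ {x} → ¬ S x) → Rep S
  empty none = record { pt = λ _ → 0ℚ , 0ℚ ; sign = λ s → ⊥-elim (none s) }

  -- First `X` is taken above every `ξ x`, which makes `p` last; then `A` is taken so large that
  -- every value `α x + X * ξ x - A` is negative.
  addIsolated : ∀ {S p} → Rep S → ¬ S p → (∀ {x} → S x → ¬ x ~ p) → VRep (S ∪｛ p ｝) p
  addIsolated {S} {p} R p∉S iso = record
    { rep  = record { pt = insert pt p P ; sign = insert-sign p∉S sign λ {x} s _ →
        sign-neg (iso s) (neg-by (A + - (α x + X * ξ x))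
          (gap>0 (A> x))
          (solve 4 (λ a x A X → ((a :+ :- A) :+ x :* X) :+ (A :+ :- (a :+ X :* x)) := con 0ℚ)
            refl (α x) (ξ x) A X)) }
    ; last = λ { (inj₁ s) _ _ → subst₂ (λ P Q → proj₂ P < proj₂ Q)
                   (sym (insert-old S pt p P p∉S s)) (sym (choose-yes (p ≟ p) refl)) (X> _)
               ; (inj₂ refl) _ x≢p → ⊥-elim (x≢p refl) }
    }
    where
    open Rep R
    X-big : Big (λ t → ∀ x → ξ x < t)
    X-big = big-all (λ x → big-> (ξ x))
    X = proj₁ X-big
    X> : ∀ x → ξ x < X
    X> = proj₂ X-big ℚP.≤-refl
    A-big : Big (λ t → ∀ x → α x + X * ξ x < t)
    A-big = big-all (λ x → big-> (α x + X * ξ x))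
    A = proj₁ A-big
    A> : ∀ x → α x + X * ξ x < A
    A> = proj₂ A-big ℚP.≤-refl
    P : Point
    P = - A , X

  -- A leaf v of p is placed so far out that being last decides its adjacencies.
  addLeaf : ∀ {S p v} → VRep S p → ¬ S v → p ~ v → (∀ {x} → S x → x ~ v → x ≡ p) →
    PortRep (S ∪｛ v ｝) p v
  addLeaf {S} {p} {v} R v∉S p~v leaf = record
    { rep  = record { pt = insert f v port
                    ; sign = insert-sign v∉S (bySide p f near-far) new }
    ; pt-p = trans (choose-no (p ≟ v) p≢v)
        (trans (choose-yes (side p ≟ᵇ side p) refl) near-p)
    ; pt-q = choose-yes (v ≟ v) refl
    ; rest = λ { (inj₁ s) x≢p _ → subst (λ P → proj₁ P ≤ 0ℚ × proj₂ P < 0ℚ)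
                   (sym (insert-old S f v port v∉S s)) (rest-old s x≢p)
               ; (inj₂ refl) _ x≢v → ⊥-elim (x≢v refl) }
    }
    where
    open VRep R
    p≢v : p ≢ v
    p≢v refl = ~⇒≢ p~v refl
    -- Scaling by `c` pushes the values on the pairs containing `p` below 20; this is what gives
    -- `α ≤ 0` on the side opposite to `p`.
    c-small : Small (λ t → ∀ w → t * (pt p ∙ pt w) < k 20)
    c-small = small-all (λ w → small-linear (pt p ∙ pt w) (ℚP.positive⁻¹ (k 20)))
    c = proj₁ c-small
    c>0 : 0ℚ < c
    c>0 = proj₁ (proj₂ c-small)
    c< : ∀ w → c * (pt p ∙ pt w) < k 20
    c< = proj₂ (proj₂ c-small) c>0 ℚP.≤-refl
    -- The shift by `b` lowers `u` in proportion to its distance `ξ p - ξ u` behind `p`. The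
    -- condition says that its new `α` is below `- 20`, hence its value with `v` at `port` is
    -- negative.
    Far : V → ℚ → Set
    Far u t = ξ u < ξ p → c * (α u + - α p) + (k 20 + k 20) < t * (c * (ξ p + - ξ u))
    far-big : ∀ u → Big (Far u)
    far-big u with ξ u ℚP.<? ξ p
    ... | yes lt = let b , h = big-linear (c * (α u + - α p) + (k 20 + k 20))
                                 (*-pos c>0 (gap>0 lt)) in b , λ ≤t _ → h ≤t
    ... | no ≮ = 0ℚ , λ _ lt → ⊥-elim (≮ lt)
    b-big : Big (λ t → (∀ u → Far u t) × (∀ w → ξ w < t))
    b-big = big-× (big-all far-big) (big-all (λ w → big-> (ξ w)))
    b = proj₁ b-big
    b-far : ∀ u → Far u b
    b-far = proj₁ (proj₂ b-big ℚP.≤-refl)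
    b> : ∀ w → ξ w < b
    b> = proj₂ (proj₂ b-big ℚP.≤-refl)
    -- A shift of both sides combined with the scaling by `c`; the constant is chosen to move `p` to
    -- `port` and is taken away again on the other side.
    near′ far′ : Point → Point
    near′ (a , x) = c * (a + b * x) + (k 20 + - (c * (α p + b * ξ p))) , c * (x + - ξ p)
    far′ (a , x) = c * (a + ξ p * x + - (ξ p * b)) + - (k 20 + - (c * (α p + b * ξ p))) , x + - b
    near′∙far′ : ∀ P Q → near′ P ∙ far′ Q ≡ c * (P ∙ Q)
    near′∙far′ (a , x) (a′ , y) = solve 9 (λ c b s t k a x a′ y →
      ((c :* (a :+ b :* x) :+ (k :+ :- (c :* (t :+ b :* s)))) :+
       (c :* (a′ :+ s :* y :+ :- (s :* b)) :+ :- (k :+ :- (c :* (t :+ b :* s))))) :+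
      (c :* (x :+ :- s)) :* (y :+ :- b)
        := c :* ((a :+ a′) :+ x :* y)) refl c b (ξ p) (α p) (k 20) a x a′ y
    near-p : near′ (pt p) ≡ port
    near-p = cong₂ _,_
      (solve 2 (λ k m → m :+ (k :+ :- m) := k) refl (k 20) (c * (α p + b * ξ p)))
      (solve 2 (λ c x → c :* (x :+ :- x) := con 0ℚ) refl c (ξ p))
    f : V → Point
    f x = choose (side x ≟ᵇ side p) (near′ (pt x)) (far′ (pt x))
    near-far : ∀ {u w} → S u → S w → side u ≡ side p → side w ≢ side p → Sign (f u ∙ f w) (u ~ w)
    near-far {u} {w} su sw u≡p w≢p =
      sign-at (choose-yes (side u ≟ᵇ side p) u≡p) (choose-no (side w ≟ᵇ side p) w≢p)
        (subst (λ z → Sign z (u ~ w)) (sym (near′∙far′ (pt u) (pt w)))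
          (sign-scale c>0 (sign su sw (λ eq → w≢p (trans (sym eq) u≡p)))))
    deep : ∀ u → ξ u < ξ p → proj₁ (near′ (pt u)) + k 20 < 0ℚ
    deep u lt = neg-by
      (b * (c * (ξ p + - ξ u)) + - (c * (α u + - α p) + (k 20 + k 20)))
      (gap>0 (b-far u lt))
      (solve 7 (λ c b s t k a x →
        ((c :* (a :+ b :* x) :+ (k :+ :- (c :* (t :+ b :* s)))) :+ k) :+
        (b :* (c :* (s :+ :- x)) :+ :- (c :* (a :+ :- t) :+ (k :+ k))) := con 0ℚ)
        refl c b (ξ p) (α p) (k 20) (α u) (ξ u))
    new : ∀ {x} → S x → side x ≢ side v → Sign (f x ∙ port) (x ~ v)
    new {x} s x≢v with x ≟ p
    ... | yes refl = sign-at (trans (choose-yes (side p ≟ᵇ side p) refl) near-p) refl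
          (sign-pos p~v (ℚP.positive⁻¹ (k 20 + k 20 + 0ℚ * 0ℚ)))
    ... | no x≢p = sign-at (choose-yes (side x ≟ᵇ side p) x≡p) refl
          (sign-neg (x≢p ∘ leaf s)
            (subst (_< 0ℚ) (solve 3 (λ a k x → a :+ k := (a :+ k) :+ x :* con 0ℚ) refl
                (proj₁ (near′ (pt x))) (k 20) (proj₂ (near′ (pt x))))
              (deep x (last s x≡p x≢p))))
      where
      x≡p : side x ≡ side p
      x≡p = sameSide x≢v (~⇒≢ p~v ∘ sym)
    rest-old : ∀ {x} → S x → x ≢ p → proj₁ (f x) ≤ 0ℚ × proj₂ (f x) < 0ℚ
    rest-old {x} s x≢p with side x ≟ᵇ side p
    ... | yes x≡p =
          ℚP.<⇒≤ (<-drop (proj₁ (near′ (pt x))) (ℚP.positive⁻¹ (k 20)) (deep x (last s x≡p x≢p))) ,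
          neg-by (c * (ξ p + - ξ x)) (*-pos c>0 (gap>0 (last s x≡p x≢p)))
            (solve 3 (λ c x s → c :* (x :+ :- s) :+ c :* (s :+ :- x) := con 0ℚ) refl c (ξ x) (ξ p))
    ... | no x≢p = nonPos-by (k 20 + - (c * (pt p ∙ pt x)))
            (ℚP.<⇒≤ (gap>0 (c< x)))
            (solve 7 (λ c b s t k a x →
              (c :* (a :+ s :* x :+ :- (s :* b)) :+ :- (k :+ :- (c :* (t :+ b :* s)))) :+
              (k :+ :- (c :* ((t :+ a) :+ s :* x))) := con 0ℚ)
              refl c b (ξ p) (α p) (k 20) (α x) (ξ x)) ,
          subst (ξ x + - b <_) (ℚP.+-inverseʳ b) (ℚP.+-monoˡ-< (- b) (b> x))

  -- The new leaf lies just behind q, so close that it stays below everything that q is below.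
  addLeafBehind : ∀ {S p q v} → PortRep S p q → p ~ q → S p → S q → ¬ S v →
    p ~ v → (∀ {x} → S x → x ~ v → x ≡ p) → PortRep (S ∪｛ v ｝) p q
  addLeafBehind {S} {p} {q} {v} R p~q p∈S q∈S v∉S p~v leaf = record
    { rep  = record { pt = insert pt v P ; sign = insert-sign v∉S sign new }
    ; pt-p = trans (insert-old S pt v P v∉S p∈S) pt-p
    ; pt-q = trans (insert-old S pt v P v∉S q∈S) pt-q
    ; rest = λ { (inj₁ s) x≢p x≢q → subst (λ P → proj₁ P ≤ 0ℚ × proj₂ P < 0ℚ)
                   (sym (insert-old S pt v P v∉S s)) (rest s x≢p x≢q)
               ; (inj₂ refl) _ _ → subst (λ P → proj₁ P ≤ 0ℚ × proj₂ P < 0ℚ)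
                   (sym (choose-yes (v ≟ v) refl))
                   (ℚP.<⇒≤ (ℚP.negative⁻¹ (- k 10)) , neg-by t t>0 (ℚP.+-inverseˡ t)) }
    }
    where
    open PortRep R
    t-small : Small (λ t → ∀ x → t * (- ξ x) < k 10)
    t-small = small-all (λ x → small-linear (- ξ x) (ℚP.positive⁻¹ (k 10)))
    t = proj₁ t-small
    t>0 : 0ℚ < t
    t>0 = proj₁ (proj₂ t-small)
    t< : ∀ x → t * (- ξ x) < k 10
    t< = proj₂ (proj₂ t-small) t>0 ℚP.≤-refl
    -- With `p` at `port` the value is `20 - 10`; with any other `x` on that side it is at most
    -- `- 10 + t * - ξ x`, which the choice of `t` makes negative.
    P : Point
    P = - k 10 , - t
    new : ∀ {x} → S x → side x ≢ side v → Sign (pt x ∙ P) (x ~ v)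
    new {x} s x≢v with x ≟ p
    ... | yes refl = sign-at pt-p refl (sign-pos p~v
            (subst (0ℚ <_) (solve 1 (λ t → con (k 10) := con (k 10) :+ con 0ℚ :* :- t) refl t)
              (ℚP.positive⁻¹ (k 10))))
    ... | no x≢p = sign-neg (x≢p ∘ leaf s)
            (neg-by ((k 10 + - (t * (- ξ x))) + - α x)
              (gap>0 (t< x) ⊕
                neg≥0 (proj₁ (rest s x≢p (λ { refl → ~⇒≢ p~q (sameSide (~⇒≢ p~v) (x≢v ∘ sym)) }))))
              (solve 3 (λ a x t → ((a :+ :- con (k 10)) :+ x :* :- t) :+
                 ((con (k 10) :+ :- (t :* :- x)) :+ :- a) := con 0ℚ) refl (α x) (ξ x) t))

  mirror : Point → Point
  mirror (α , ξ) = α , - ξ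

  -- The second representation is reflected in the common port.
  glue : ∀ {S T p q} → PortRep S p q → PortRep T p q → Decidable S → S p → S q → T p → T q →
    (∀ {x y} → S x → T y → x ≢ p → x ≢ q → y ≢ p → y ≢ q → ¬ x ~ y) →
    Rep (λ x → S x ⊎ T x)
  glue {S} {T} {p} {q} R R′ S? p∈S q∈S p∈T q∈T apart = record { pt = f ; sign = sgn }
    where
    module R = PortRep R
    module R′ = PortRep R′
    f : V → Point
    f x = choose (S? x) (R.pt x) (mirror (R′.pt x))
    fS : ∀ {x} → S x → f x ≡ R.pt x
    fS {x} = choose-yes (S? x)
    fT : ∀ {x} → ¬ S x → f x ≡ mirror (R′.pt x)
    fT {x} = choose-no (S? x)
    mirror-∙ : ∀ P Q → mirror P ∙ mirror Q ≡ P ∙ Q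
    mirror-∙ (a , x) (b , y) =
      solve 4 (λ a b x y → (a :+ b) :+ (:- x) :* (:- y) := (a :+ b) :+ x :* y) refl a b x y
    sgnT : ∀ {x y} → T x → T y → f x ≡ mirror (R′.pt x) → f y ≡ mirror (R′.pt y) →
      side x ≢ side y → Sign (f x ∙ f y) (x ~ y)
    sgnT {x} {y} tx ty ex ey d = sign-at ex ey
      (subst (λ z → Sign z (x ~ y)) (sym (mirror-∙ (R′.pt x) (R′.pt y))) (R′.sign tx ty d))
    at-port : ∀ {x} → S x → R′.pt x ≡ port → R.pt x ≡ port → f x ≡ mirror (R′.pt x)
    at-port s eq′ eq = trans (fS s) (trans eq (sym (cong mirror eq′)))
    mixed : ∀ {x y} → S x → T y → ¬ S y → side x ≢ side y → Sign (f x ∙ f y) (x ~ y)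
    mixed {x} {y} sx ty ¬sy d with x ≟ p | x ≟ q
    ... | yes refl | _ = sgnT p∈T ty (at-port sx R′.pt-p R.pt-p) (fT ¬sy) d
    ... | no x≢p | yes refl = sgnT q∈T ty (at-port sx R′.pt-q R.pt-q) (fT ¬sy) d
    -- After the reflection the two `ξ` have opposite signs, and neither `α` is positive.
    ... | no x≢p | no x≢q = sign-at (fS sx) (fT ¬sy)
      (sign-neg (apart sx ty x≢p x≢q y≢p y≢q)
        (neg-by (- R.ξ x * - R′.ξ y + - R.α x + - R′.α y)
          (*-pos (neg>0 (proj₂ (R.rest sx x≢p x≢q))) (neg>0 (proj₂ (R′.rest ty y≢p y≢q))) ⊕
            neg≥0 (proj₁ (R.rest sx x≢p x≢q)) ⊕ neg≥0 (proj₁ (R′.rest ty y≢p y≢q)))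
          (solve 4 (λ a x b y → ((a :+ b) :+ x :* :- y) :+
            (((:- x :* :- y) :+ :- a) :+ :- b) := con 0ℚ) refl
            (R.α x) (R.ξ x) (R′.α y) (R′.ξ y))))
      where
      y≢p : y ≢ p
      y≢p refl = ¬sy p∈S
      y≢q : y ≢ q
      y≢q refl = ¬sy q∈S
    inT : ∀ {x} → S x ⊎ T x → ¬ S x → T x
    inT (inj₁ s) ¬s = ⊥-elim (¬s s)
    inT (inj₂ t) _ = t
    sgn′ : ∀ {x y} → Dec (S x) → Dec (S y) → S x ⊎ T x → S y ⊎ T y → side x ≢ side y →
      Sign (f x ∙ f y) (x ~ y)
    sgn′ (yes sx) (yes sy) _ _ d = sign-at (fS sx) (fS sy) (R.sign sx sy d)
    sgn′ (yes sx) (no ¬sy) _ hy d = mixed sx (inT hy ¬sy) ¬sy d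
    sgn′ {x} {y} (no ¬sx) (yes sy) hx _ d =
      sign-sym (f y) (f x) (mixed sy (inT hx ¬sx) ¬sx (d ∘ sym))
    sgn′ (no ¬sx) (no ¬sy) hx hy d = sgnT (inT hx ¬sx) (inT hy ¬sy) (fT ¬sx) (fT ¬sy) d
    sgn : ∀ {x y} → S x ⊎ T x → S y ⊎ T y → side x ≢ side y → Sign (f x ∙ f y) (x ~ y)
    sgn {x} {y} = sgn′ (S? x) (S? y)

  sign-atˡ : ∀ {P P′ Q : Point} {A} → P ≡ P′ → Sign (P′ ∙ Q) A → Sign (P ∙ Q) A
  sign-atˡ refl s = s

  sign-atʳ : ∀ (P : Point) {Q Q′ : Point} {A} → Q ≡ Q′ → Sign (P ∙ Q′) A → Sign (P ∙ Q) A
  sign-atʳ P refl s = s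

  -- The roles of the vertices added to a port (a , x₁): parallel paths a x y b, the path
  -- a x₁ y₁ b, and the path a x₂ y₂ b whose edge (b , y₂) is the new port.
  data Kind : Set where
    kold ky₁ ky₂ ky kx₂ kb kx : Kind

  -- To be read for `u` on the side of `a` and `w` on the other. The default `⊤` covers old pairs,
  -- whose signs come from the representation of `S`, and combinations that `near-side` and
  -- `far-side` exclude.
  Meets : V → V → (V → V) → Kind → V → Kind → V → Set
  Meets a v₁ idx kold u kx₂ w = (u ≡ a → u ~ w) × (u ~ w → u ≡ a)
  Meets a v₁ idx kold u kx  w = (u ≡ a → u ~ w) × (u ~ w → u ≡ a)
  Meets a v₁ idx kold u kb  w = ¬ u ~ w
  Meets a v₁ idx ky₁ u kold w = (w ≡ v₁ → u ~ w) × (u ~ w → w ≡ v₁)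
  Meets a v₁ idx ky₂ u kold w = ¬ u ~ w
  Meets a v₁ idx ky  u kold w = ¬ u ~ w
  Meets a v₁ idx ky₁ u kx₂ w = ¬ u ~ w
  Meets a v₁ idx ky₁ u kb  w = u ~ w
  Meets a v₁ idx ky₁ u kx  w = ¬ u ~ w
  Meets a v₁ idx ky₂ u kx₂ w = u ~ w
  Meets a v₁ idx ky₂ u kb  w = u ~ w
  Meets a v₁ idx ky₂ u kx  w = ¬ u ~ w
  Meets a v₁ idx ky  u kx₂ w = ¬ u ~ w
  Meets a v₁ idx ky  u kb  w = u ~ w
  Meets a v₁ idx ky  u kx  w = (idx u ≡ idx w → u ~ w) × (u ~ w → idx u ≡ idx w)
  Meets a v₁ idx _  u _  w = ⊤

  Near Far : Kind → Set
  Near k = (k ≡ ky₁ ⊎ k ≡ ky₂) ⊎ k ≡ ky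
  Far  k = (k ≡ kx₂ ⊎ k ≡ kb) ⊎ k ≡ kx

  -- The two inner vertices of a parallel path get the same label under `idx`; it becomes their
  -- common parameter on the parabola.
  record Parallel (S T : Pred V 0ℓ) (a v₁ p q : V) : Set where
    field
      kind : V → Kind
      idx  : V → V
      keep : ∀ {v} → T v → kind v ≡ kold → S v
      near-side : ∀ {v} → T v → Near (kind v) → side v ≡ side a
      far-side  : ∀ {v} → T v → Far (kind v) → side v ≢ side a
      meets : ∀ {u w} → T u → T w → side u ≡ side a → side w ≢ side a →
        Meets a v₁ idx (kind u) u (kind w) w
      kind-p : kind p ≡ kb
      kind-q : kind q ≡ ky₂
      only-p : ∀ {v} → T v → kind v ≡ kb → v ≡ p
      only-q : ∀ {v} → T v → kind v ≡ ky₂ → v ≡ q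

  module AddParallel {S T : Pred V 0ℓ} {a v₁ p q : V} (a~v₁ : a ~ v₁) (R : PortRep S a v₁)
    (H : Parallel S T a v₁ p q) (φ : V → ℚ) (φ-ok : ∀ i → 0ℚ ≤ φ i × φ i ≤ ¼)
    (r : ℚ) (r-ok : 0ℚ < r × r ≤ ¼) (gap : Gap φ r) where

    open PortRep R
    open Parallel H

    place : Kind → V → Point
    place kold v = choose (side v ≟ᵇ side a) (near (pt v)) (far (pt v))
    place ky₁ v = pt-y₁
    place ky₂ v = port
    place ky  v = pt-y r (φ (idx v))
    place kx₂ v = pt-x₂
    place kb  v = port
    place kx  v = pt-x r (φ (idx v))
    f : V → Point
    f v = place (kind v) v
    near-at : ∀ {v} → side v ≡ side a → place kold v ≡ near (pt v)
    near-at {v} = choose-yes (side v ≟ᵇ side a)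
    far-at : ∀ {v} → side v ≢ side a → place kold v ≡ far (pt v)
    far-at {v} = choose-no (side v ≟ᵇ side a)
    near-rest : ∀ {v} → S v → side v ≡ side a → v ≢ a → α v ≤ 0ℚ × ξ v ≤ 0ℚ
    near-rest s same v≢a = 
      let α≤ , ξ< = rest s v≢a (λ { refl → ~⇒≢ a~v₁ (sym same) }) in α≤ , ℚP.<⇒≤ ξ<
    far-rest : ∀ {v} → S v → side v ≢ side a → v ≢ v₁ → α v ≤ 0ℚ × ξ v ≤ 0ℚ
    far-rest s opp v≢v₁ = let α≤ , ξ< = rest s (λ { refl → opp refl }) v≢v₁ in α≤ , ℚP.<⇒≤ ξ<
    pair : ∀ {u w} → T u → T w → side u ≡ side a → side w ≢ side a →
      ∀ k l → kind u ≡ k → kind w ≡ l → Meets a v₁ idx k u l w → Sign (place k u ∙ place l w) (u ~ w)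
    pair {u} {w} tu tw u≡a w≢a kold kold eu ew _ = sign-at (near-at u≡a) (far-at w≢a)
      (subst (λ z → Sign z (u ~ w)) (sym (near∙far (pt u) (pt w)))
        (sign (keep tu eu) (keep tw ew) (λ eq → w≢a (trans (sym eq) u≡a))))
    pair {u} tu tw u≡a w≢a kold kx₂ eu ew (to , from) with u ≟ a
    ... | yes refl = sign-atˡ (trans (near-at refl) (cong near pt-p))
      (sign-pos (to refl) (ℚP.positive⁻¹ (near port ∙ pt-x₂)))
    ... | no u≢a = let α≤ , ξ≤ = near-rest (keep tu eu) u≡a u≢a in
      sign-atˡ (near-at u≡a) (sign-neg (u≢a ∘ from) (old∙x₂ α≤ ξ≤))
    pair {u} tu tw u≡a w≢a kold kb eu ew ¬~ with u ≟ a
    ... | yes refl = sign-atˡ (trans (near-at refl) (cong near pt-p))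
      (sign-neg ¬~ (ℚP.negative⁻¹ (near port ∙ port)))
    ... | no u≢a = let α≤ , ξ≤ = near-rest (keep tu eu) u≡a u≢a in
      sign-atˡ (near-at u≡a) (sign-neg ¬~ (old∙b α≤ ξ≤))
    pair {u} {w} tu tw u≡a w≢a kold kx eu ew (to , from) with u ≟ a
    ... | yes refl = sign-atˡ (trans (near-at refl) (cong near pt-p))
      (sign-pos (to refl) (a∙x (φ-ok (idx w)) r-ok))
    ... | no u≢a = let α≤ , ξ≤ = near-rest (keep tu eu) u≡a u≢a in
      sign-atˡ (near-at u≡a) (sign-neg (u≢a ∘ from) (old∙x α≤ ξ≤ (φ-ok (idx w)) r-ok))
    pair {u} {w} tu tw u≡a w≢a ky₁ kold eu ew (to , from) with w ≟ v₁
    ... | yes refl = sign-atʳ pt-y₁ (trans (far-at w≢a) (cong far pt-q))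
      (sign-pos (to refl) (ℚP.positive⁻¹ (pt-y₁ ∙ far port)))
    ... | no w≢ = let α≤ , ξ≤ = far-rest (keep tw ew) w≢a w≢ in
      sign-atʳ pt-y₁ (far-at w≢a) (sign-neg (w≢ ∘ from) (y₁∙old α≤ ξ≤))
    pair {u} {w} tu tw u≡a w≢a ky₂ kold eu ew ¬~ with w ≟ v₁
    ... | yes refl = sign-atʳ port (trans (far-at w≢a) (cong far pt-q))
      (sign-neg ¬~ (ℚP.negative⁻¹ (port ∙ far port)))
    ... | no w≢ = let α≤ , ξ≤ = far-rest (keep tw ew) w≢a w≢ in
      sign-atʳ port (far-at w≢a) (sign-neg ¬~ (y₂∙old α≤ ξ≤))
    pair {u} {w} tu tw u≡a w≢a ky kold eu ew ¬~ with w ≟ v₁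
    ... | yes refl = sign-atʳ (pt-y r (φ (idx u))) (trans (far-at w≢a) (cong far pt-q))
      (sign-neg ¬~ (y∙x₁ (φ-ok (idx u)) r-ok))
    ... | no w≢ = let α≤ , ξ≤ = far-rest (keep tw ew) w≢a w≢ in
      sign-atʳ (pt-y r (φ (idx u))) (far-at w≢a) (sign-neg ¬~ (y∙old α≤ ξ≤ (φ-ok (idx u)) r-ok))
    pair tu tw u≡a w≢a ky₁ kx₂ eu ew ¬~ = sign-neg ¬~ (ℚP.negative⁻¹ (pt-y₁ ∙ pt-x₂))
    pair tu tw u≡a w≢a ky₁ kb eu ew u~w = sign-pos u~w (ℚP.positive⁻¹ (pt-y₁ ∙ port))
    pair {u} {w} tu tw u≡a w≢a ky₁ kx eu ew ¬~ = sign-neg ¬~ (y₁∙x (φ-ok (idx w)) r-ok)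
    pair tu tw u≡a w≢a ky₂ kx₂ eu ew u~w = sign-pos u~w (ℚP.positive⁻¹ (port ∙ pt-x₂))
    pair tu tw u≡a w≢a ky₂ kb eu ew u~w = sign-pos u~w (ℚP.positive⁻¹ (port ∙ port))
    pair {u} {w} tu tw u≡a w≢a ky₂ kx eu ew ¬~ = sign-neg ¬~ (y₂∙x (φ-ok (idx w)) r-ok)
    pair {u} {w} tu tw u≡a w≢a ky kx₂ eu ew ¬~ = sign-neg ¬~ (y∙x₂ (φ-ok (idx u)) r-ok)
    pair {u} {w} tu tw u≡a w≢a ky kb eu ew u~w = sign-pos u~w (y∙b (φ-ok (idx u)) r-ok)
    pair {u} {w} tu tw u≡a w≢a ky kx eu ew (to , from) = subst (λ z → Sign z (u ~ w))
      (sym (y∙x r (φ (idx u)) (φ (idx w)))) matching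
      where
      d : ℚ
      d = (φ (idx u) + - φ (idx w)) * (φ (idx u) + - φ (idx w))
      matching : Sign ((r + r) + - d) (u ~ w)
      matching with idx u ≟ idx w
      ... | yes eq = sign-pos (to eq) (subst (0ℚ <_)
        (trans (solve 2 (λ r f → r :+ r := (r :+ r) :+ :- ((f :+ :- f) :* (f :+ :- f))) refl r (φ (idx u)))
          (cong (λ j → (r + r) + - ((φ (idx u) + - φ j) * (φ (idx u) + - φ j))) eq))
        (proj₁ r-ok ⊕ ℚP.<⇒≤ (proj₁ r-ok)))
      ... | no neq = sign-neg (neq ∘ from)
        (subst ((r + r) + - d <_) (ℚP.+-inverseʳ d) (ℚP.+-monoˡ-< (- d) (gap (idx u) (idx w) neq)))
    pair tu tw u≡a w≢a kx₂ _ eu ew _ = ⊥-elim (far-side tu (inj₁ (inj₁ eu)) u≡a)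
    pair tu tw u≡a w≢a kb  _ eu ew _ = ⊥-elim (far-side tu (inj₁ (inj₂ eu)) u≡a)
    pair tu tw u≡a w≢a kx  _ eu ew _ = ⊥-elim (far-side tu (inj₂ eu) u≡a)
    pair tu tw u≡a w≢a _ ky₁ eu ew _ = ⊥-elim (w≢a (near-side tw (inj₁ (inj₁ ew))))
    pair tu tw u≡a w≢a _ ky₂ eu ew _ = ⊥-elim (w≢a (near-side tw (inj₁ (inj₂ ew))))
    pair tu tw u≡a w≢a _ ky  eu ew _ = ⊥-elim (w≢a (near-side tw (inj₂ ew)))
    near-far : ∀ {u w} → T u → T w → side u ≡ side a → side w ≢ side a → Sign (f u ∙ f w) (u ~ w)
    near-far {u} {w} tu tw u≡a w≢a =
      pair tu tw u≡a w≢a (kind u) (kind w) refl refl (meets tu tw u≡a w≢a)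
    rest′ : ∀ {v} → T v → v ≢ p → v ≢ q → ∀ k → kind v ≡ k → 
      proj₁ (place k v) ≤ 0ℚ × proj₂ (place k v) < 0ℚ
    rest′ {v} t v≢p v≢q kold e with side v ≟ᵇ side a | v ≟ a | v ≟ v₁
    ... | yes _ | yes refl | _ = subst (λ P → proj₁ (near P) ≤ 0ℚ × proj₂ (near P) < 0ℚ) (sym pt-p)
          (ℚP.nonPositive⁻¹ (proj₁ (near port)) , ℚP.negative⁻¹ (proj₂ (near port)))
    ... | yes s | no v≢a | _ = let α≤ , ξ≤ = near-rest (keep t e) s v≢a in near-α α≤ ξ≤ , near-ξ ξ≤
    ... | no _ | _ | yes refl = subst (λ P → proj₁ (far P) ≤ 0ℚ × proj₂ (far P) < 0ℚ) (sym pt-q)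
          (ℚP.nonPositive⁻¹ (proj₁ (far port)) , ℚP.negative⁻¹ (proj₂ (far port)))
    ... | no s | _ | no v≢ = let α≤ , ξ≤ = far-rest (keep t e) s v≢ in far-α α≤ ξ≤ , far-ξ ξ≤
    rest′ t v≢p v≢q ky₁ e = ℚP.nonPositive⁻¹ (proj₁ pt-y₁) , ℚP.negative⁻¹ (proj₂ pt-y₁)
    rest′ t v≢p v≢q ky₂ e = ⊥-elim (v≢q (only-q t e))
    rest′ {v} t v≢p v≢q ky e = y-α (φ-ok (idx v)) r-ok , y-ξ (φ-ok (idx v))
    rest′ t v≢p v≢q kx₂ e = ℚP.nonPositive⁻¹ (proj₁ pt-x₂) , ℚP.negative⁻¹ (proj₂ pt-x₂)
    rest′ t v≢p v≢q kb e = ⊥-elim (v≢p (only-p t e))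
    rest′ {v} t v≢p v≢q kx e = x-α (φ-ok (idx v)) r-ok , x-ξ (φ-ok (idx v))

    addParallel′ : PortRep T p q
    addParallel′ = record
      { rep  = record { pt = f ; sign = bySide a f near-far }
      ; pt-p = cong (λ k → place k p) kind-p
      ; pt-q = cong (λ k → place k q) kind-q
      ; rest = λ {v} t v≢p v≢q → rest′ t v≢p v≢q (kind v) refl
      }

  addParallel : ∀ {S T a v₁ p q} → a ~ v₁ → PortRep S a v₁ → Parallel S T a v₁ p q → PortRep T p q
  addParallel a~v₁ R H =
    let φ , φ-spread = spread n
        r , r-ok , gap = gaps φ φ-spread
    in AddParallel.addParallel′ a~v₁ R H φ (proj₁ φ-spread) r r-ok gap

-- From representations to unit disks

root≤1 : ∀ n {q} → q ≤ 1ℚ → root n q ≤ 1ℚ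
root≤1 n {q} q≤1 with root n q ℚP.≤? 1ℚ
... | yes r≤1 = r≤1
... | no r≰1 = ⊥-elim (ℚP.<-irrefl refl (ℚP.<-≤-trans (ℚP.≰⇒> r≰1)
  (ℚP.≤-trans (subst (_≤ r * r) (ℚP.*-identityˡ r)
      (ℚP.*-monoʳ-≤-nonNeg r {{ℚ.nonNegative (root≥0 n q)}} (ℚP.<⇒≤ (ℚP.≰⇒> r≰1))))
    (ℚP.≤-trans (root²≤ n q) (ℚP.⊔-lub q≤1 (ℚP.nonNegative⁻¹ 1ℚ))))))
  where r = root n q

√-≤1 : ∀ {x q} → (∀ n → seq x n ≡ q) → q ≤ 1ℚ → √ x ≤ᴿ 1ᴿ
√-≤1 {q = q} const q≤1 ε ε>0 = 0 , λ n _ → ℚP.≤-trans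
  (subst (λ p → root n p ≤ 1ℚ) (sym (const n)) (root≤1 n q≤1)) (≤-+ 1ℚ (ℚP.<⇒≤ ε>0))

-- If approximate root and mesh are at most `1 + ε` and `ε`, then `q` is less than `(1 + 2ε)²`,
-- hence less than `1 + 8ε` as `ε < 1`; but `ε` is chosen with `8ε < q - 1`.
√-≰1 : ∀ {x q} → (∀ n → seq x n ≡ q) → 1ℚ < q → ¬ √ x ≤ᴿ 1ᴿ
√-≰1 {x} {q} const q>1 h = ℚP.<-irrefl refl (ℚP.<-trans above below)
  where
  small : Small (λ t → t * k 8 < q + - 1ℚ × t * 1ℚ < 1ℚ)
  small = small-× (small-linear (k 8) (gap>0 q>1)) (small-linear 1ℚ (ℚP.positive⁻¹ 1ℚ))
  ε = proj₁ small
  ε>0 : 0ℚ < ε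
  ε>0 = proj₁ (proj₂ small)
  ε-ok : ε * k 8 < q + - 1ℚ × ε * 1ℚ < 1ℚ
  ε-ok = proj₂ (proj₂ small) ε>0 ℚP.≤-refl
  n = proj₁ (h ε ε>0) ℕ.⊔ ↧ₙ ε
  r≤ : root n q ≤ 1ℚ + ε
  r≤ = subst (λ p → root n p ≤ 1ℚ + ε) (const n) (proj₂ (h ε ε>0) n (ℕP.m≤m⊔n _ _))
  above : q < (1ℚ + ε + ε) * (1ℚ + ε + ε)
  above = ℚP.≤-<-trans (ℚP.p≤p⊔q q 0ℚ) (ℚP.<-≤-trans (<root+mesh² n q)
    (square-mono (+-nonNeg (root≥0 n q) (mesh≥0 n))
      (ℚP.+-mono-≤ r≤ (mesh≤ ε ε>0 n (ℕP.m≤n⊔m _ _)))))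
  below : (1ℚ + ε + ε) * (1ℚ + ε + ε) < q
  below = subst₂ _<_
    (solve 1 (λ e → con 1ℚ :+ (e :* con (k 8) :+ :- (con (k 4) :* (e :* (con 1ℚ :+ :- e)))) :=
       (con 1ℚ :+ e :+ e) :* (con 1ℚ :+ e :+ e)) refl ε)
    (solve 1 (λ q → con 1ℚ :+ (q :+ :- con 1ℚ) := q) refl q)
    (ℚP.+-monoʳ-< 1ℚ (ℚP.≤-<-trans
      (subst (ε * k 8 + - s ≤_) (ℚP.+-identityʳ (ε * k 8))
        (ℚP.+-monoʳ-≤ (ε * k 8) (ℚP.neg-antimono-≤ s≥0)))
      (proj₁ ε-ok)))
    where
    s : ℚ
    s = k 4 * (ε * (1ℚ + - ε))
    s≥0 : 0ℚ ≤ s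
    s≥0 = *-nonNeg (ℚP.nonNegative⁻¹ (k 4)) (*-nonNeg (ℚP.<⇒≤ ε>0)
      (gap≥0 (ℚP.<⇒≤ (subst (_< 1ℚ) (ℚP.*-identityʳ ε) (proj₂ ε-ok)))))

module Realisation {n : ℕ} (G : BipartiteGraph n) where
  open BipartiteGraph G

  side : Fin n → Bool
  side v = does (v ∈ₛ? U)

  ~⇒≢ : ∀ {u v} → u ~ v → side u ≢ side v
  ~⇒≢ {u} {v} u~v eq with cover u | cover v
  ... | inj₁ u∈U | inj₁ v∈U = U-independent u∈U v∈U u~v
  ... | inj₂ u∈W | inj₂ v∈W = W-independent u∈W v∈W u~v
  ... | inj₁ u∈U | inj₂ v∈W = true≢false (trans (sym (dec-true (u ∈ₛ? U) u∈U))
          (trans eq (dec-false (v ∈ₛ? U) (λ v∈U → disjoint v∈U v∈W))))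
    where
    true≢false : true ≢ false
    true≢false ()
  ... | inj₂ u∈W | inj₁ v∈U = true≢false (trans (sym (dec-true (v ∈ₛ? U) v∈U))
          (trans (sym eq) (dec-false (u ∈ₛ? U) (λ u∈U → disjoint u∈U u∈W))))
    where
    true≢false : true ≢ false
    true≢false ()

  open Representation side _~_ ~-sym ~⇒≢

  module _ (R : Rep (λ _ → ⊤)) where
   open Rep R

   -- The vertical distance contributes `(ξ u + ξ v)²`. Subtracting half of each square here leaves
   -- the product `2 * ξ u * ξ v` of the form.
   h : V → ℚ
   h v = α v + - (½ * (ξ v * ξ v))

   g s e : V → V → ℚ
   g u v = (h u + h v) * (h u + h v)
   s u v = (h u + - h v) * (h u + - h v) + (ξ u + - ξ v) * (ξ u + - ξ v)
   e u v = pt u ∙ pt v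

   Fine : ℚ → Set
   Fine t = t * 1ℚ < 1ℚ × (∀ u v → e u v < 0ℚ → t * g u v < - e u v + - e u v) ×
     (∀ u v → t * s u v < 1ℚ)

   fine : Small Fine
   fine = small-× (small-linear 1ℚ (ℚP.positive⁻¹ 1ℚ)) (small-×
     (small-all λ u → small-all (cross u))
     (small-all λ u → small-all λ v → small-linear (s u v) (ℚP.positive⁻¹ 1ℚ)))
     where
     cross : ∀ u v → Small (λ t → e u v < 0ℚ → t * g u v < - e u v + - e u v)
     cross u v with e u v ℚP.<? 0ℚ
     ... | yes lt = let δ , δ>0 , p = small-linear (g u v) (ℚP.+-mono-< (neg>0 lt) (neg>0 lt)) in
             δ , δ>0 , λ t>0 t≤ _ → p t>0 t≤
     ... | no ≮ = 1ℚ , ℚP.positive⁻¹ 1ℚ , λ _ _ lt → ⊥-elim (≮ lt)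

   -- Points close to (0 , 0) and (1 , 0): the squared distance of points of different sides
   -- is 1 + 2 t² (P ∙ Q) up to a term of order t⁴.
   module _ (t : ℚ) (t>0 : 0ℚ < t) (t-ok : Fine t) where
    shrink : ∀ {p} → 0ℚ ≤ p → t * p ≤ p
    shrink {p} p≥0 = subst (t * p ≤_) (ℚP.*-identityˡ p)
      (ℚP.*-monoʳ-≤-nonNeg p {{ℚ.nonNegative p≥0}}
        (ℚP.<⇒≤ (subst (_< 1ℚ) (ℚP.*-identityʳ t) (proj₁ t-ok))))
    t≥0 : 0ℚ ≤ t
    t≥0 = ℚP.<⇒≤ t>0
    -- Opposite signs on the two sides turn the coordinate differences across the sides into sums.
    sgn off : Bool → ℚ
    sgn true = - 1ℚ
    sgn false = 1ℚ
    off true = 0ℚ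
    off false = 1ℚ
    fx fy : V → ℚ
    fx v = off (side v) + sgn (side v) * (t * t * h v)
    fy v = sgn (side v) * (t * ξ v)
    f : V → ℝ²
    f v = fromℚ (fx v) , fromℚ (fy v)
    D : V → V → ℝ
    D u v = (fromℚ (fx u) -ᴿ fromℚ (fx v)) *ᴿ (fromℚ (fx u) -ᴿ fromℚ (fx v)) +ᴿ
            (fromℚ (fy u) -ᴿ fromℚ (fy v)) *ᴿ (fromℚ (fy u) -ᴿ fromℚ (fy v))
    d : V → V → ℚ
    d u v = (fx u + - fx v) * (fx u + - fx v) + (fy u + - fy v) * (fy u + - fy v)
    across : ∀ u v → side u ≢ side v → d u v ≡ 1ℚ + t * t * (e u v + e u v + t * t * g u v)
    across u v u≢v with side u | side v
    ... | true  | true  = ⊥-elim (u≢v refl)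
    ... | false | false = ⊥-elim (u≢v refl)
    ... | true  | false = solve 5 (λ t a x b y →
        let i = con 1ℚ ; z = con 0ℚ ; o = :- con 1ℚ
            H = λ a x → a :+ :- (con ½ :* (x :* x))
            X = (z :+ o :* (t :* t :* H a x)) :+ :- (i :+ i :* (t :* t :* H b y))
            Y = (o :* (t :* x)) :+ :- (i :* (t :* y))
            E = a :+ b :+ x :* y
            F = H a x :+ H b y
        in X :* X :+ Y :* Y := i :+ t :* t :* (E :+ E :+ t :* t :* (F :* F)))
        refl t (α u) (ξ u) (α v) (ξ v)
    ... | false | true  = solve 5 (λ t a x b y →
        let i = con 1ℚ ; z = con 0ℚ ; o = :- con 1ℚ
            H = λ a x → a :+ :- (con ½ :* (x :* x))
            X = (i :+ i :* (t :* t :* H a x)) :+ :- (z :+ o :* (t :* t :* H b y))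
            Y = (i :* (t :* x)) :+ :- (o :* (t :* y))
            E = a :+ b :+ x :* y
            F = H a x :+ H b y
        in X :* X :+ Y :* Y := i :+ t :* t :* (E :+ E :+ t :* t :* (F :* F)))
        refl t (α u) (ξ u) (α v) (ξ v)
    along : ∀ u v → side u ≡ side v →
      d u v ≡ t * t * (t * t * ((h u + - h v) * (h u + - h v)) + (ξ u + - ξ v) * (ξ u + - ξ v))
    along u v u≡v with side u | side v
    along u v refl | true  | .true = solve 5 (λ t a x b y →
        let z = con 0ℚ ; o = :- con 1ℚ
            X = (z :+ o :* (t :* t :* a)) :+ :- (z :+ o :* (t :* t :* b))
            Y = (o :* (t :* x)) :+ :- (o :* (t :* y))
            A = a :+ :- b
            B = x :+ :- y
        in X :* X :+ Y :* Y := t :* t :* (t :* t :* (A :* A) :+ B :* B))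
        refl t (h u) (ξ u) (h v) (ξ v)
    along u v refl | false | .false = solve 5 (λ t a x b y →
        let i = con 1ℚ
            X = (i :+ i :* (t :* t :* a)) :+ :- (i :+ i :* (t :* t :* b))
            Y = (i :* (t :* x)) :+ :- (i :* (t :* y))
            A = a :+ :- b
            B = x :+ :- y
        in X :* X :+ Y :* Y := t :* t :* (t :* t :* (A :* A) :+ B :* B))
        refl t (h u) (ξ u) (h v) (ξ v)
    distant : ∀ u v → u ~ v → 1ℚ < d u v
    distant u v u~v = subst (1ℚ <_) (sym (across u v (~⇒≢ u~v)))
      (subst (_< 1ℚ + t * t * (e u v + e u v + t * t * g u v)) (ℚP.+-identityʳ 1ℚ)
        (ℚP.+-monoʳ-< 1ℚ (*-pos (*-pos t>0 t>0)
          (ℚP.+-mono-< e>0 e>0 ⊕ *-nonNeg (*-nonNeg t≥0 t≥0) (square≥0 (h u + h v))))))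
      where
      e>0 : 0ℚ < e u v
      e>0 = proj₁ (sign tt tt (~⇒≢ u~v)) u~v
    close : ∀ u v → ¬ u ~ v → d u v ≤ 1ℚ
    close u v u≁v with side u ≟ᵇ side v
    ... | no u≢v = subst (_≤ 1ℚ) (sym (across u v u≢v))
      (subst (1ℚ + t * t * z ≤_) (ℚP.+-identityʳ 1ℚ) (ℚP.+-monoʳ-≤ 1ℚ
        (nonPos-by {t * t * z} (t * t * - z) (*-nonNeg (*-nonNeg t≥0 t≥0) (neg≥0 (ℚP.<⇒≤ z<0)))
          (solve 2 (λ t z → t :* t :* z :+ t :* t :* :- z := con 0ℚ) refl t z))))
      where
      z : ℚ
      z = e u v + e u v + t * t * g u v
      tt-g : t * t * g u v < - e u v + - e u v
      tt-g = ℚP.≤-<-trans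
        (subst (_≤ t * g u v) (sym (ℚP.*-assoc t t (g u v)))
          (shrink (*-nonNeg t≥0 (square≥0 (h u + h v)))))
        (proj₁ (proj₂ t-ok) u v (proj₂ (sign tt tt u≢v) u≁v))
      z<0 : z < 0ℚ
      z<0 = subst (z <_) (solve 1 (λ e → e :+ e :+ (:- e :+ :- e) := con 0ℚ) refl (e u v))
        (ℚP.+-monoʳ-< (e u v + e u v) tt-g)
    ... | yes u≡v = subst (_≤ 1ℚ) (sym (along u v u≡v))
      (ℚP.≤-trans (subst (_≤ t * z) (sym (ℚP.*-assoc t t z)) (shrink (*-nonNeg t≥0 z≥0)))
        (ℚP.≤-trans (ℚP.*-monoˡ-≤-nonNeg t {{ℚ.nonNegative t≥0}}
          (ℚP.+-monoˡ-≤ y (subst (_≤ x) (sym (ℚP.*-assoc t t x))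
            (ℚP.≤-trans (shrink (*-nonNeg t≥0 x≥0)) (shrink x≥0)))))
          (ℚP.<⇒≤ (proj₂ (proj₂ t-ok) u v))))
      where
      x y z : ℚ
      x = (h u + - h v) * (h u + - h v)
      y = (ξ u + - ξ v) * (ξ u + - ξ v)
      z = t * t * x + y
      x≥0 : 0ℚ ≤ x
      x≥0 = square≥0 (h u + - h v)
      z≥0 : 0ℚ ≤ z
      z≥0 = +-nonNeg (*-nonNeg (*-nonNeg t≥0 t≥0) x≥0) (square≥0 (ξ u + - ξ v))

    placement : IsUnitDisk (complement graph)
    placement = f , λ u v u≢v → mk⇔
      (λ (_ , u≁v) → √-≤1 {x = D u v} (λ _ → refl) (close u v u≁v))
      (λ h → u≢v , λ u~v → √-≰1 {x = D u v} (λ _ → refl) (distant u v u~v) h)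

  unitDisk : Rep (λ _ → ⊤) → IsUnitDisk (complement graph)
  unitDisk R = let t , t>0 , ok = fine R in placement R t t>0 (ok t>0 ℚP.≤-refl)

-- Recognising forbidden induced subgraphs

module _ {m : ℕ} where
  open DecMembership (≡-dec (_≟_ {m}) (_≟_ {m})) using (_∈?_)

  Pairs : Set
  Pairs = List (Fin m × Fin m)

  -- The pairs of vertices of H of different colours are listed in es and ns; vertices not
  -- distinguished by a neighbour are listed in ds.
  module _ (H : Graph m) (colour : Vec Bool m) (es ns ds : Pairs) where
    open Graph H

    Listed : Pairs → Fin m → Fin m → Set
    Listed ps i j = (i , j) ∈ ps ⊎ (j , i) ∈ ps

    Table : Fin m → Fin m → Set
    Table i j = (lookup colour i ≡ lookup colour j × ¬ i ~ j) ⊎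
      (i ~ j × Listed es i j) ⊎ (¬ i ~ j × Listed ns i j)

    Split : Fin m → Fin m → Set
    Split i j = i ≡ j ⊎ (∃ λ k → (i ~ k × ¬ j ~ k) ⊎ (j ~ k × ¬ i ~ k)) ⊎ Listed ds i j

    listed? : ∀ ps i j → Dec (Listed ps i j)
    listed? ps i j = ((i , j) ∈? ps) ⊎-dec ((j , i) ∈? ps)

    described? : Dec (∀ i j → Table i j × Split i j)
    described? = all? λ i → all? λ j →
      ((((lookup colour i ≟ᵇ lookup colour j) ×-dec ¬? (i ~? j)) ⊎-dec
        (((i ~? j) ×-dec listed? es i j) ⊎-dec (¬? (i ~? j) ×-dec listed? ns i j))) ×-dec
       ((i ≟ j) ⊎-dec (any? (λ k → ((i ~? k) ×-dec ¬? (j ~? k)) ⊎-dec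
                                   ((j ~? k) ×-dec ¬? (i ~? k))) ⊎-dec listed? ds i j)))

module Forbidden {n : ℕ} (G : BipartiteGraph n) (G∈𝒳 : 𝒳 (BipartiteGraph.graph G)) where
  open BipartiteGraph G
  open 𝒳 G∈𝒳

  open Realisation G using (side; ~⇒≢)
  open Representation side _~_ ~-sym ~⇒≢

  -- Vertices of one colour land on one side and are thus non-adjacent, and two vertices told apart
  -- by a third have distinct images since adjacency is preserved and reflected. That the lists
  -- cover all remaining pairs is checked by evaluation.
  embed : ∀ {m} (H : Graph m) (colour : Vec Bool m) (es ns ds : Pairs)
    {_ : True (described? H colour es ns ds)} (φ : Vec V m) (s : Bool) →
    All (λ i → side (lookup φ i) ≡ (if lookup colour i then s else not s)) (allFin m) →
    All (λ (i , j) → lookup φ i ~ lookup φ j) es →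
    All (λ (i , j) → ¬ lookup φ i ~ lookup φ j) ns →
    All (λ (i , j) → lookup φ i ≢ lookup φ j) ds → H ⊑ graph
  embed H colour es ns ds {ok} φ s sides edges nonedges distinct =
    lookup φ , inj , λ i j → mk⇔ (preserve i j) (reflect i j)
    where
    module H = Graph H
    described : ∀ i j → Table H colour es ns ds i j × Split H colour es ns ds i j
    described = toWitness ok
    preserve : ∀ i j → i H.~ j → lookup φ i ~ lookup φ j
    preserve i j i~j with proj₁ (described i j)
    ... | inj₁ (_ , i≁j) = ⊥-elim (i≁j i~j)
    ... | inj₂ (inj₁ (_ , inj₁ p)) = All.lookup edges p
    ... | inj₂ (inj₁ (_ , inj₂ p)) = ~-sym (All.lookup edges p)
    ... | inj₂ (inj₂ (i≁j , _)) = ⊥-elim (i≁j i~j)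
    reflect : ∀ i j → lookup φ i ~ lookup φ j → i H.~ j
    reflect i j φi~φj with proj₁ (described i j)
    ... | inj₁ (eq , _) = ⊥-elim (~⇒≢ φi~φj
            (trans (All.lookup sides (∈-allFin i))
              (trans (cong (λ c → if c then s else not s) eq) (sym (All.lookup sides (∈-allFin j))))))
    ... | inj₂ (inj₁ (i~j , _)) = i~j
    ... | inj₂ (inj₂ (_ , inj₁ p)) = ⊥-elim (All.lookup nonedges p φi~φj)
    ... | inj₂ (inj₂ (_ , inj₂ p)) = ⊥-elim (All.lookup nonedges p (~-sym φi~φj))
    inj : Injective _≡_ _≡_ (lookup φ)
    inj {i} {j} eq with proj₂ (described i j)
    ... | inj₁ i≡j = i≡j
    ... | inj₂ (inj₁ (k , inj₁ (i~k , j≁k))) =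
            ⊥-elim (j≁k (reflect j k (subst (_~ lookup φ k) eq (preserve i k i~k))))
    ... | inj₂ (inj₁ (k , inj₂ (j~k , i≁k))) =
            ⊥-elim (i≁k (reflect i k (subst (_~ lookup φ k) (sym eq) (preserve j k j~k))))
    ... | inj₂ (inj₂ (inj₁ p)) = ⊥-elim (All.lookup distinct p eq)
    ... | inj₂ (inj₂ (inj₂ p)) = ⊥-elim (All.lookup distinct p (sym eq))

  flip-side : ∀ c s {u v} → side u ≡ (if c then s else not s) → u ~ v →
    side v ≡ (if not c then s else not s)
  flip-side c s eq u~v = go c s _ eq (~⇒≢ u~v)
    where
    go : ∀ c (s x : Bool) {y} → y ≡ (if c then s else not s) → y ≢ x → x ≡ (if not c then s else not s)
    go true  true  true  refl d = ⊥-elim (d refl)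
    go true  true  false refl d = refl
    go true  false true  refl d = refl
    go true  false false refl d = ⊥-elim (d refl)
    go false true  true  refl d = refl
    go false true  false refl d = ⊥-elim (d refl)
    go false false true  refl d = ⊥-elim (d refl)
    go false false false refl d = refl

  noC₄ : ∀ {a b c d} → a ~ b → b ~ c → c ~ d → d ~ a → a ≢ c → b ≢ d → ⊥
  noC₄ {a} {b} {c} {d} ab bc cd da a≢c b≢d = cycle-free 4 (ℕP.m≤m+n 3 1) (λ ())
    (embed (cycle 4) (true ∷ false ∷ true ∷ false ∷ [])
      ((# 0 , # 1) ∷ (# 1 , # 2) ∷ (# 2 , # 3) ∷ (# 3 , # 0) ∷ []) []
      ((# 0 , # 2) ∷ (# 1 , # 3) ∷ [])
      (a ∷ b ∷ c ∷ d ∷ []) (side a)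
      (refl ∷ s₁ ∷ s₂ ∷ flip-side true (side a) s₂ cd ∷ [])
      (ab ∷ bc ∷ cd ∷ da ∷ []) [] (a≢c ∷ b≢d ∷ []))
    where
    s₁ = flip-side true (side a) refl ab
    s₂ = flip-side false (side a) s₁ bc

  -- A chord between different sides joins vertices at distance three on the cycle and so closes a
  -- 4-cycle.
  noC₈ : ∀ {a b c d e f g h} → a ~ b → b ~ c → c ~ d → d ~ e → e ~ f → f ~ g → g ~ h → h ~ a →
    a ≢ c → b ≢ d → c ≢ e → d ≢ f → e ≢ g → f ≢ h → g ≢ a → h ≢ b → ⊥
  noC₈ {a} {b} {c} {d} {e} {f} {g} {h} ab bc cd de ef fg gh ha ac bd ce df eg fh ga hb =
    cycle-free 8 (ℕP.m≤m+n 3 5) (λ ())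
    (embed (cycle 8) (true ∷ false ∷ true ∷ false ∷ true ∷ false ∷ true ∷ false ∷ [])
      ((# 0 , # 1) ∷ (# 1 , # 2) ∷ (# 2 , # 3) ∷ (# 3 , # 4) ∷
       (# 4 , # 5) ∷ (# 5 , # 6) ∷ (# 6 , # 7) ∷ (# 7 , # 0) ∷ [])
      ((# 3 , # 0) ∷ (# 4 , # 1) ∷ (# 5 , # 2) ∷ (# 6 , # 3) ∷
       (# 7 , # 4) ∷ (# 0 , # 5) ∷ (# 1 , # 6) ∷ (# 2 , # 7) ∷ []) []
      (a ∷ b ∷ c ∷ d ∷ e ∷ f ∷ g ∷ h ∷ []) (side a)
      (refl ∷ s₁ ∷ s₂ ∷ s₃ ∷ s₄ ∷ s₅ ∷ s₆ ∷ flip-side true (side a) s₆ gh ∷ [])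
      (ab ∷ bc ∷ cd ∷ de ∷ ef ∷ fg ∷ gh ∷ ha ∷ [])
      ((λ q → noC₄ ab bc cd q ac bd) ∷ (λ q → noC₄ bc cd de q bd ce) ∷
       (λ q → noC₄ cd de ef q ce df) ∷ (λ q → noC₄ de ef fg q df eg) ∷
       (λ q → noC₄ ef fg gh q eg fh) ∷ (λ q → noC₄ fg gh ha q fh ga) ∷
       (λ q → noC₄ gh ha ab q ga hb) ∷ (λ q → noC₄ ha ab bc q hb ac) ∷ []) [])
    where
    s₁ = flip-side true (side a) refl ab
    s₂ = flip-side false (side a) s₁ bc
    s₃ = flip-side true (side a) s₂ cd
    s₄ = flip-side false (side a) s₃ de
    s₅ = flip-side true (side a) s₄ ef
    s₆ = flip-side false (side a) s₅ fg

  record Arm (c v u t : V) : Set where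
    constructor arm
    field
      cv : c ~ v
      vu : v ~ u
      ut : u ~ t
      u≢c : u ≢ c
      t≢v : t ≢ v

  -- The only extra edges that do not close a 4-cycle run from the middle of one arm to the end of
  -- another; these are the ones excluded by hypothesis.
  noS₃₃₃ : ∀ {c v₁ u₁ t₁ v₂ u₂ t₂ v₃ u₃ t₃} →
    Arm c v₁ u₁ t₁ → Arm c v₂ u₂ t₂ → Arm c v₃ u₃ t₃ → v₁ ≢ v₂ → v₁ ≢ v₃ → v₂ ≢ v₃ →
    ¬ u₁ ~ t₂ → ¬ u₁ ~ t₃ → ¬ u₂ ~ t₁ → ¬ u₂ ~ t₃ → ¬ u₃ ~ t₁ → ¬ u₃ ~ t₂ → ⊥
  noS₃₃₃ {c} {v₁} {u₁} {t₁} {v₂} {u₂} {t₂} {v₃} {u₃} {t₃}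
    A₁@(arm cv₁ vu₁ ut₁ u≢c₁ t≢v₁) A₂@(arm cv₂ vu₂ ut₂ u≢c₂ t≢v₂) A₃@(arm cv₃ vu₃ ut₃ u≢c₃ t≢v₃)
    v₁≢v₂ v₁≢v₃ v₂≢v₃ u₁≁t₂ u₁≁t₃ u₂≁t₁ u₂≁t₃ u₃≁t₁ u₃≁t₂ = S₃₃₃-free
    (embed S₃₃₃ (true ∷ false ∷ true ∷ false ∷ false ∷ true ∷ false ∷ false ∷ true ∷ false ∷ [])
      ((# 0 , # 1) ∷ (# 1 , # 2) ∷ (# 2 , # 3) ∷ (# 0 , # 4) ∷ (# 4 , # 5) ∷ (# 5 , # 6) ∷
       (# 0 , # 7) ∷ (# 7 , # 8) ∷ (# 8 , # 9) ∷ [])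
      ((# 3 , # 0) ∷ (# 6 , # 0) ∷ (# 9 , # 0) ∷
       (# 2 , # 4) ∷ (# 2 , # 7) ∷ (# 5 , # 1) ∷ (# 5 , # 7) ∷ (# 8 , # 1) ∷ (# 8 , # 4) ∷
       (# 2 , # 6) ∷ (# 2 , # 9) ∷ (# 5 , # 3) ∷ (# 5 , # 9) ∷ (# 8 , # 3) ∷ (# 8 , # 6) ∷ []) []
      (c ∷ v₁ ∷ u₁ ∷ t₁ ∷ v₂ ∷ u₂ ∷ t₂ ∷ v₃ ∷ u₃ ∷ t₃ ∷ []) (side c)
      (refl ∷ σ₁ A₁ ∷ σ₂ A₁ ∷ σ₃ A₁ ∷ σ₁ A₂ ∷ σ₂ A₂ ∷ σ₃ A₂ ∷ σ₁ A₃ ∷ σ₂ A₃ ∷ σ₃ A₃ ∷ [])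
      (cv₁ ∷ vu₁ ∷ ut₁ ∷ cv₂ ∷ vu₂ ∷ ut₂ ∷ cv₃ ∷ vu₃ ∷ ut₃ ∷ [])
      ((λ q → noC₄ cv₁ vu₁ ut₁ q (≢-sym u≢c₁) (≢-sym t≢v₁)) ∷
       (λ q → noC₄ cv₂ vu₂ ut₂ q (≢-sym u≢c₂) (≢-sym t≢v₂)) ∷
       (λ q → noC₄ cv₃ vu₃ ut₃ q (≢-sym u≢c₃) (≢-sym t≢v₃)) ∷
       (λ q → noC₄ cv₁ vu₁ q (~-sym cv₂) (≢-sym u≢c₁) v₁≢v₂) ∷
       (λ q → noC₄ cv₁ vu₁ q (~-sym cv₃) (≢-sym u≢c₁) v₁≢v₃) ∷
       (λ q → noC₄ cv₂ vu₂ q (~-sym cv₁) (≢-sym u≢c₂) (≢-sym v₁≢v₂)) ∷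
       (λ q → noC₄ cv₂ vu₂ q (~-sym cv₃) (≢-sym u≢c₂) v₂≢v₃) ∷
       (λ q → noC₄ cv₃ vu₃ q (~-sym cv₁) (≢-sym u≢c₃) (≢-sym v₁≢v₃)) ∷
       (λ q → noC₄ cv₃ vu₃ q (~-sym cv₂) (≢-sym u≢c₃) (≢-sym v₂≢v₃)) ∷
       u₁≁t₂ ∷ u₁≁t₃ ∷ u₂≁t₁ ∷ u₂≁t₃ ∷ u₃≁t₁ ∷ u₃≁t₂ ∷ []) [])
    where
    σ₁ : ∀ {v u t} → Arm c v u t → side v ≡ not (side c)
    σ₁ A = flip-side true (side c) refl (Arm.cv A)
    σ₂ : ∀ {v u t} → Arm c v u t → side u ≡ side c
    σ₂ A = flip-side false (side c) (σ₁ A) (Arm.vu A)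
    σ₃ : ∀ {v u t} → Arm c v u t → side t ≡ not (side c)
    σ₃ A = flip-side true (side c) (σ₂ A) (Arm.ut A)

  record Hex (c₀ c₁ c₂ c₃ c₄ c₅ : V) : Set where
    constructor hex
    field
      e₀ : c₀ ~ c₁
      e₁ : c₁ ~ c₂
      e₂ : c₂ ~ c₃
      e₃ : c₃ ~ c₄
      e₄ : c₄ ~ c₅
      e₅ : c₅ ~ c₀
      ≢₀ : c₀ ≢ c₂
      ≢₁ : c₁ ≢ c₃
      ≢₂ : c₂ ≢ c₄
      ≢₃ : c₃ ≢ c₅
      ≢₄ : c₄ ≢ c₀
      ≢₅ : c₅ ≢ c₁

  rotate : ∀ {c₀ c₁ c₂ c₃ c₄ c₅} → Hex c₀ c₁ c₂ c₃ c₄ c₅ → Hex c₁ c₂ c₃ c₄ c₅ c₀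
  rotate (hex e₀ e₁ e₂ e₃ e₄ e₅ n₀ n₁ n₂ n₃ n₄ n₅) =
    hex e₁ e₂ e₃ e₄ e₅ e₀ n₁ n₂ n₃ n₄ n₅ n₀

  unrotate : ∀ {c₀ c₁ c₂ c₃ c₄ c₅} → Hex c₀ c₁ c₂ c₃ c₄ c₅ → Hex c₅ c₀ c₁ c₂ c₃ c₄
  unrotate (hex e₀ e₁ e₂ e₃ e₄ e₅ n₀ n₁ n₂ n₃ n₄ n₅) =
    hex e₅ e₀ e₁ e₂ e₃ e₄ n₅ n₀ n₁ n₂ n₃ n₄

  swap : ∀ {c₀ c₁ c₂ c₃ c₄ c₅} → Hex c₀ c₁ c₂ c₃ c₄ c₅ → Hex c₁ c₀ c₅ c₄ c₃ c₂
  swap (hex e₀ e₁ e₂ e₃ e₄ e₅ n₀ n₁ n₂ n₃ n₄ n₅) =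
    hex (~-sym e₀) (~-sym e₅) (~-sym e₄) (~-sym e₃) (~-sym e₂) (~-sym e₁)
      (≢-sym n₅) (≢-sym n₄) (≢-sym n₃) (≢-sym n₂) (≢-sym n₁) (≢-sym n₀)

  module _ {c₀ c₁ c₂ c₃ c₄ c₅ : V} (C : Hex c₀ c₁ c₂ c₃ c₄ c₅) where
    open Hex C

    private
      s₁ = flip-side true (side c₀) refl e₀
      s₂ = flip-side false (side c₀) s₁ e₁
      s₃ = flip-side true (side c₀) s₂ e₂
      s₄ = flip-side false (side c₀) s₃ e₃
      s₅ = flip-side true (side c₀) s₄ e₄

    no-chord₀ : ¬ c₃ ~ c₀
    no-chord₀ q = noC₄ e₀ e₁ e₂ q ≢₀ ≢₁
    no-chord₁ : ¬ c₄ ~ c₁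
    no-chord₁ q = noC₄ e₁ e₂ e₃ q ≢₁ ≢₂
    no-chord₂ : ¬ c₅ ~ c₂
    no-chord₂ q = noC₄ e₂ e₃ e₄ q ≢₂ ≢₃

    no3c : ∀ {x y z} → x ~ c₀ → x ≢ c₁ → x ≢ c₅ → y ~ c₁ → y ≢ c₀ → y ≢ c₂ →
      z ~ c₂ → z ≢ c₁ → z ≢ c₃ → ⊥
    no3c {x} {y} {z} x0 x≢1 x≢5 y1 y≢0 y≢2 z2 z≢1 z≢3 = C₆⁺³ᶜ-free
      (embed C₆⁺³ᶜ (true ∷ false ∷ true ∷ false ∷ true ∷ false ∷ false ∷ true ∷ false ∷ [])
        ((# 0 , # 1) ∷ (# 1 , # 2) ∷ (# 2 , # 3) ∷ (# 3 , # 4) ∷ (# 4 , # 5) ∷ (# 5 , # 0) ∷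
         (# 6 , # 0) ∷ (# 7 , # 1) ∷ (# 8 , # 2) ∷ [])
        ((# 3 , # 0) ∷ (# 4 , # 1) ∷ (# 5 , # 2) ∷
         (# 6 , # 2) ∷ (# 6 , # 4) ∷ (# 8 , # 0) ∷ (# 8 , # 4) ∷ (# 7 , # 3) ∷ (# 7 , # 5) ∷
         (# 6 , # 7) ∷ (# 8 , # 7) ∷ []) []
        (c₀ ∷ c₁ ∷ c₂ ∷ c₃ ∷ c₄ ∷ c₅ ∷ x ∷ y ∷ z ∷ []) (side c₀)
        (refl ∷ s₁ ∷ s₂ ∷ s₃ ∷ s₄ ∷ s₅ ∷ flip-side true (side c₀) refl (~-sym x0) ∷
         flip-side false (side c₀) s₁ (~-sym y1) ∷ flip-side true (side c₀) s₂ (~-sym z2) ∷ [])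
        (e₀ ∷ e₁ ∷ e₂ ∷ e₃ ∷ e₄ ∷ e₅ ∷ x0 ∷ y1 ∷ z2 ∷ [])
        (no-chord₀ ∷ no-chord₁ ∷ no-chord₂ ∷
         (λ q → noC₄ (~-sym x0) q (~-sym e₁) (~-sym e₀) ≢₀ x≢1) ∷
         (λ q → noC₄ (~-sym x0) q e₄ e₅ (≢-sym ≢₄) x≢5) ∷
         (λ q → noC₄ (~-sym z2) q e₀ e₁ (≢-sym ≢₀) z≢1) ∷
         (λ q → noC₄ (~-sym z2) q (~-sym e₃) (~-sym e₂) ≢₂ z≢3) ∷
         (λ q → noC₄ (~-sym y1) q (~-sym e₂) (~-sym e₁) ≢₁ y≢2) ∷
         (λ q → noC₄ (~-sym y1) q e₅ e₀ (≢-sym ≢₅) y≢0) ∷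
         (λ q → noC₄ (~-sym x0) q y1 (~-sym e₀) (≢-sym y≢0) x≢1) ∷
         (λ q → noC₄ (~-sym z2) q y1 e₁ (≢-sym y≢2) z≢1) ∷ []) [])

    no3nc : ∀ {x y z} → x ~ c₀ → x ≢ c₁ → x ≢ c₅ → y ~ c₂ → y ≢ c₁ → y ≢ c₃ →
      z ~ c₄ → z ≢ c₃ → z ≢ c₅ → ⊥
    no3nc {x} {y} {z} x0 x≢1 x≢5 y2 y≢1 y≢3 z4 z≢3 z≢5 = C₆⁺³ⁿᶜ-free
      (embed C₆⁺³ⁿᶜ (true ∷ false ∷ true ∷ false ∷ true ∷ false ∷ false ∷ false ∷ false ∷ [])
        ((# 0 , # 1) ∷ (# 1 , # 2) ∷ (# 2 , # 3) ∷ (# 3 , # 4) ∷ (# 4 , # 5) ∷ (# 5 , # 0) ∷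
         (# 6 , # 0) ∷ (# 7 , # 2) ∷ (# 8 , # 4) ∷ [])
        ((# 3 , # 0) ∷ (# 4 , # 1) ∷ (# 5 , # 2) ∷
         (# 6 , # 2) ∷ (# 6 , # 4) ∷ (# 7 , # 0) ∷ (# 7 , # 4) ∷ (# 8 , # 0) ∷ (# 8 , # 2) ∷ []) []
        (c₀ ∷ c₁ ∷ c₂ ∷ c₃ ∷ c₄ ∷ c₅ ∷ x ∷ y ∷ z ∷ []) (side c₀)
        (refl ∷ s₁ ∷ s₂ ∷ s₃ ∷ s₄ ∷ s₅ ∷ flip-side true (side c₀) refl (~-sym x0) ∷
         flip-side true (side c₀) s₂ (~-sym y2) ∷ flip-side true (side c₀) s₄ (~-sym z4) ∷ [])
        (e₀ ∷ e₁ ∷ e₂ ∷ e₃ ∷ e₄ ∷ e₅ ∷ x0 ∷ y2 ∷ z4 ∷ [])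
        (no-chord₀ ∷ no-chord₁ ∷ no-chord₂ ∷
         (λ q → noC₄ (~-sym x0) q (~-sym e₁) (~-sym e₀) ≢₀ x≢1) ∷
         (λ q → noC₄ (~-sym x0) q e₄ e₅ (≢-sym ≢₄) x≢5) ∷
         (λ q → noC₄ (~-sym y2) q e₀ e₁ (≢-sym ≢₀) y≢1) ∷
         (λ q → noC₄ (~-sym y2) q (~-sym e₃) (~-sym e₂) ≢₂ y≢3) ∷
         (λ q → noC₄ (~-sym z4) q (~-sym e₅) (~-sym e₄) ≢₄ z≢5) ∷
         (λ q → noC₄ (~-sym z4) q e₂ e₃ (≢-sym ≢₂) z≢3) ∷ []) [])

    -- All extra edges close a 4-cycle except the three excluded at the end, each of which would
    -- close another hexagon through `c₀` and `c₁`.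
    no2l2 : ∀ {x x′ y y′} → x ~ c₀ → x ≢ c₁ → x ≢ c₅ → x′ ~ x → x′ ≢ c₀ →
      y ~ c₁ → y ≢ c₀ → y ≢ c₂ → y′ ~ y → y′ ≢ c₁ →
      ¬ x′ ~ c₃ → ¬ y′ ~ c₄ → ¬ x′ ~ y′ → ⊥
    no2l2 {x} {x′} {y} {y′} x0 x≢1 x≢5 x′x x′≢0 y1 y≢0 y≢2 y′y y′≢1 x′≁3 y′≁4 x′≁y′ = C₆⁺²ˡ²-free
      (embed C₆⁺²ˡ² (true ∷ false ∷ true ∷ false ∷ true ∷ false ∷ false ∷ true ∷ true ∷ false ∷ [])
        ((# 0 , # 1) ∷ (# 1 , # 2) ∷ (# 2 , # 3) ∷ (# 3 , # 4) ∷ (# 4 , # 5) ∷ (# 5 , # 0) ∷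
         (# 6 , # 0) ∷ (# 7 , # 6) ∷ (# 8 , # 1) ∷ (# 9 , # 8) ∷ [])
        ((# 3 , # 0) ∷ (# 4 , # 1) ∷ (# 5 , # 2) ∷
         (# 6 , # 2) ∷ (# 6 , # 4) ∷ (# 8 , # 3) ∷ (# 8 , # 5) ∷ (# 6 , # 8) ∷
         (# 7 , # 1) ∷ (# 7 , # 5) ∷ (# 9 , # 0) ∷ (# 9 , # 2) ∷
         (# 7 , # 3) ∷ (# 9 , # 4) ∷ (# 7 , # 9) ∷ []) []
        (c₀ ∷ c₁ ∷ c₂ ∷ c₃ ∷ c₄ ∷ c₅ ∷ x ∷ x′ ∷ y ∷ y′ ∷ []) (side c₀)
        (refl ∷ s₁ ∷ s₂ ∷ s₃ ∷ s₄ ∷ s₅ ∷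
         sx ∷ flip-side false (side c₀) sx (~-sym x′x) ∷ sy ∷ flip-side true (side c₀) sy (~-sym y′y) ∷ [])
        (e₀ ∷ e₁ ∷ e₂ ∷ e₃ ∷ e₄ ∷ e₅ ∷ x0 ∷ x′x ∷ y1 ∷ y′y ∷ [])
        (no-chord₀ ∷ no-chord₁ ∷ no-chord₂ ∷
         (λ q → noC₄ (~-sym x0) q (~-sym e₁) (~-sym e₀) ≢₀ x≢1) ∷
         (λ q → noC₄ (~-sym x0) q e₄ e₅ (≢-sym ≢₄) x≢5) ∷
         (λ q → noC₄ (~-sym y1) q (~-sym e₂) (~-sym e₁) ≢₁ y≢2) ∷
         (λ q → noC₄ (~-sym y1) q e₅ e₀ (≢-sym ≢₅) y≢0) ∷
         (λ q → noC₄ (~-sym x0) q y1 (~-sym e₀) (≢-sym y≢0) x≢1) ∷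
         (λ q → noC₄ x′x x0 e₀ (~-sym q) x′≢0 x≢1) ∷
         (λ q → noC₄ x′x x0 (~-sym e₅) (~-sym q) x′≢0 x≢5) ∷
         (λ q → noC₄ y′y y1 (~-sym e₀) (~-sym q) y′≢1 y≢0) ∷
         (λ q → noC₄ y′y y1 e₁ (~-sym q) y′≢1 y≢2) ∷
         x′≁3 ∷ y′≁4 ∷ x′≁y′ ∷ []) [])
      where
      sx = flip-side true (side c₀) refl (~-sym x0)
      sy = flip-side false (side c₀) s₁ (~-sym y1)

  noC₃ : ∀ {a b c} → a ~ b → b ~ c → ¬ a ~ c
  noC₃ ab bc ac = ~⇒≢ ac (sameSide (~⇒≢ ab) (~⇒≢ bc))

  noC₅ : ∀ {a b c d e} → a ~ b → b ~ c → c ~ d → d ~ e → ¬ a ~ e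
  noC₅ ab bc cd de ae = ~⇒≢ ae (trans (sameSide (~⇒≢ ab) (~⇒≢ bc)) (sameSide (~⇒≢ cd) (~⇒≢ de)))

  ~-≢ : ∀ {a b} → a ~ b → a ≢ b
  ~-≢ ab refl = ~-irrefl refl ab

  oneOf : ∀ {z a b : V} → (z ≢ a → z ≢ b → ⊥) → z ≡ a ⊎ z ≡ b
  oneOf {z} {a} {b} h with z ≟ a | z ≟ b
  ... | yes eq | _ = inj₁ eq
  ... | no _ | yes eq = inj₂ eq
  ... | no z≢a | no z≢b = ⊥-elim (h z≢a z≢b)

  unique : ∀ {a b c d} → a ~ b → b ~ c → c ~ d → d ~ a → a ≢ c → b ≡ d
  unique {b = b} {d = d} ab bc cd da a≢c = decidable-stable (b ≟ d) (noC₄ ab bc cd da a≢c)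

  -- Adding families of leaves and stars

  Before : (S P : Pred V 0ℓ) → (V → Pred V 0ℓ) → ℕ → Pred V 0ℓ
  Before S P A k x = S x ⊎ ∃ λ v → toℕ v ℕ.< k × P v × A v x

  module _ (Q : Pred V 0ℓ → Set) (anti : ∀ {S T} → T ⊆ S → Q S → Q T)
    {S P : Pred V 0ℓ} (P? : Decidable P) (A : V → Pred V 0ℓ) where

    -- Vertices are treated in the order of `toℕ`, so each step knows what is already there. As `Q`
    -- passes to subsets, inclusions of predicates take the place of equalities.
    fill : Q S → (∀ v → P v → Q (Before S P A (toℕ v)) → Q (λ x → Before S P A (toℕ v) x ⊎ A v x)) →
      Q (λ x → S x ⊎ ∃ λ v → P v × A v x)
    fill q step = anti (λ { (inj₁ s) → inj₁ s ; (inj₂ (v , p , a)) → inj₂ (v , toℕ<n v , p , a) })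
        (upTo n ℕP.≤-refl)
      where
      upTo : ∀ k → k ℕ.≤ n → Q (Before S P A k)
      upTo zero k≤n = anti (λ { (inj₁ s) → s }) q
      upTo (suc k) k<n with P? (fromℕ< k<n)
      ... | yes p = anti within (step v p (subst (Q ∘ Before S P A) (sym k≡) (upTo k (ℕP.<⇒≤ k<n))))
        where
        v = fromℕ< k<n
        k≡ : toℕ v ≡ k
        k≡ = toℕ-fromℕ< k<n
        within : Before S P A (suc k) ⊆ (λ x → Before S P A (toℕ v) x ⊎ A v x)
        within (inj₁ s) = inj₁ (inj₁ s)
        within (inj₂ (w , ℕ.s≤s w≤k , pw , a)) with ℕP.m≤n⇒m<n∨m≡n w≤k
        ... | inj₁ w<k = inj₁ (inj₂ (w , subst (toℕ w ℕ.<_) (sym k≡) w<k , pw , a))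
        ... | inj₂ w≡k with toℕ-injective {i = w} {j = v} (trans w≡k (sym k≡))
        ... | refl = inj₂ a
      ... | no ¬p = anti within (upTo k (ℕP.<⇒≤ k<n))
        where
        within : Before S P A (suc k) ⊆ Before S P A k
        within (inj₁ s) = inj₁ s
        within (inj₂ (w , ℕ.s≤s w≤k , pw , a)) with ℕP.m≤n⇒m<n∨m≡n w≤k
        ... | inj₁ w<k = inj₂ (w , w<k , pw , a)
        ... | inj₂ w≡k with toℕ-injective {i = w} (trans w≡k (sym (toℕ-fromℕ< k<n)))
        ... | refl = ⊥-elim (¬p pw)

  addLeaves : ∀ {S L : Pred V 0ℓ} {p q} → PortRep S p q → p ~ q → S p → S q → Decidable L →
    (∀ {u} → L u → ¬ S u) → (∀ {u} → L u → p ~ u) → (∀ {u x} → L u → S x → x ~ u → x ≡ p) →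
    PortRep (λ x → S x ⊎ L x) p q
  addLeaves {S} {L} {p} {q} R p~q p∈S q∈S L? new p~ only = PortRep-⊆
    (λ { (inj₁ s) → inj₁ s ; {x} (inj₂ l) → inj₂ (x , l , refl) })
    (fill (λ T → PortRep T p q) PortRep-⊆ L? (λ v x → x ≡ v) R step)
    where
    step : ∀ v → L v → _ → _
    step v l R′ = addLeafBehind R′ p~q (inj₁ p∈S) (inj₁ q∈S) v-new (p~ l) v-only
      where
      v-new : ¬ Before S L (λ v x → x ≡ v) (toℕ v) v
      v-new (inj₁ s) = new l s
      v-new (inj₂ (w , w<v , _ , refl)) = ℕP.<-irrefl refl w<v
      v-only : ∀ {x} → Before S L (λ v x → x ≡ v) (toℕ v) x →
        x ~ v → x ≡ p
      v-only (inj₁ s) x~v = only l s x~v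
      v-only (inj₂ (w , _ , lw , refl)) x~v = ⊥-elim (noC₃ (~-sym (p~ lw)) (p~ l) x~v)

  Shallow : Pred V 0ℓ → V → V → Set
  Shallow S p v = ∀ {u t} → S u → v ~ u → u ≢ p → S t → u ~ t → t ≡ v

  Star : V → V → Pred V 0ℓ
  Star p v x = x ≡ v ⊎ (v ~ x × x ≢ p)

  -- The centre `v` is added as a leaf of `p`, which makes `p v` a port; the leaves of `v` then go
  -- behind `p`. Afterwards `p` is still last on its side, ready for the next star.
  addStars : ∀ {S T P : Pred V 0ℓ} {p} → VRep T p → Decidable S → T p → S p → Decidable P →
    (∀ {v} → P v → S v) → (∀ {v} → P v → p ~ v) → (∀ {v} → P v → ¬ T v) →
    (∀ {v x} → P v → T x → x ~ v → x ≡ p) → (∀ {v} → P v → Shallow S p v) → T ⊆ S →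
    VRep (λ x → T x ⊎ ∃ λ v → P v × (S x × Star p v x)) p
  addStars {S} {T} {P} {p} R S? p∈T p∈S P? P⊆S p~ new only shallow T⊆S =
    fill (λ U → VRep U p) VRep-⊆ P? A R step
    where
    A : V → Pred V 0ℓ
    A v x = S x × Star p v x
    B : ℕ → Pred V 0ℓ
    B = Before T P A
    B⊆S : ∀ {k} → B k ⊆ S
    B⊆S (inj₁ t) = T⊆S t
    B⊆S (inj₂ (_ , _ , _ , s , _)) = s
    step : ∀ v → P v → VRep (B (toℕ v)) p → VRep (λ x → B (toℕ v) x ⊎ A v x) p
    step v pv R′ = VRep-⊆ within (PortRep⇒VRep (~⇒≢ (p~ pv)) (PortRep-sym
        (addLeaves (PortRep-sym (addLeaf R′ v-new (p~ pv) v-only)) (~-sym (p~ pv))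
          (inj₂ refl) (inj₁ (inj₁ p∈T)) leaf? leaf-new (proj₁ ∘ proj₂) leaf-only)))
      where
      v-new : ¬ B (toℕ v) v
      v-new (inj₁ t) = new pv t
      v-new (inj₂ (w , w<v , pw , _ , inj₁ refl)) = ℕP.<-irrefl refl w<v
      v-new (inj₂ (w , w<v , pw , _ , inj₂ (w~v , _))) = noC₃ (~-sym (p~ pw)) (p~ pv) w~v
      v-only : ∀ {x} → B (toℕ v) x → x ~ v → x ≡ p
      v-only (inj₁ t) x~v = only pv t x~v
      v-only (inj₂ (w , w<v , pw , _ , inj₁ refl)) x~v = ⊥-elim (noC₃ (~-sym (p~ pw)) (p~ pv) x~v)
      -- A leaf of `w` that is adjacent to `v` forces `v ≡ w` by shallowness.
      v-only (inj₂ (w , w<v , pw , sx , inj₂ (w~x , x≢p))) x~v =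
        ⊥-elim (ℕP.<-irrefl (cong toℕ (sym (shallow pw sx w~x x≢p (P⊆S pv) x~v))) w<v)
      Leaf : Pred V 0ℓ
      Leaf u = S u × v ~ u × u ≢ p
      leaf? : Decidable Leaf
      leaf? u = S? u ×-dec ((v ~? u) ×-dec ¬? (u ≟ p))
      leaf-only : ∀ {u x} → Leaf u → B (toℕ v) x ⊎ x ≡ v → x ~ u → x ≡ v
      leaf-only (su , v~u , u≢p) (inj₁ b) x~u = shallow pv su v~u u≢p (B⊆S b) (~-sym x~u)
      leaf-only _ (inj₂ refl) _ = refl
      leaf-new : ∀ {u} → Leaf u → ¬ (B (toℕ v) u ⊎ u ≡ v)
      leaf-new (su , v~u , u≢p) (inj₁ b) = u≢p (v-only b (~-sym v~u))
      leaf-new (su , v~u , u≢p) (inj₂ refl) = ~-irrefl refl v~u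
      within : (λ x → B (toℕ v) x ⊎ A v x) ⊆ (λ x → (B (toℕ v) x ⊎ x ≡ v) ⊎ Leaf x)
      within (inj₁ b) = inj₁ (inj₁ b)
      within (inj₂ (s , inj₁ x≡v)) = inj₁ (inj₂ x≡v)
      within (inj₂ (s , inj₂ (v~x , x≢p))) = inj₂ (s , v~x , x≢p)

  -- Deep branches, anchors and the statement of the induction

  Deep : Pred V 0ℓ → V → Pred V 0ℓ
  Deep S p v = S v × p ~ v × ∃ λ u → S u × v ~ u × u ≢ p × ∃ λ t → S t × u ~ t × t ≢ v

  deep? : ∀ {S} → Decidable S → ∀ p → Decidable (Deep S p)
  deep? S? p v = S? v ×-dec ((p ~? v) ×-dec any? λ u → S? u ×-dec ((v ~? u) ×-dec
    (¬? (u ≟ p) ×-dec any? λ t → S? t ×-dec ((u ~? t) ×-dec ¬? (t ≟ v)))))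

  ¬deep⇒shallow : ∀ {S p v} → S v → p ~ v → ¬ Deep S p v → Shallow S p v
  ¬deep⇒shallow {v = v} sv p~v ¬deep {u} {t} su v~u u≢p st u~t =
    decidable-stable (t ≟ v) (λ t≢v → ¬deep (sv , p~v , u , su , v~u , u≢p , t , st , u~t , t≢v))

  -- `outer` provides the third arm of an `S₃₃₃`. `single` starts the argument where nothing outside
  -- `S` is at hand: with neither hexagons nor branching, the bound on deep neighbours holds
  -- outright.
  data Anchor (S : Pred V 0ℓ) (p : V) : Set where
    outer : ∀ {o₁ o₂ o₃} → Arm p o₁ o₂ o₃ → ¬ S o₁ → ¬ S o₂ → ¬ S o₃ →
      (∀ {x} → S x → x ~ o₁ → x ≡ p) → (∀ {x} → S x → ¬ x ~ o₂) → (∀ {x} → S x → ¬ x ~ o₃) →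
      Anchor S p
    single : (∀ {c v w} → S c → Deep S c v → Deep S c w → v ≡ w) → Anchor S p

  record Outside (S : Pred V 0ℓ) (p q o₂ o₃ o₄ o₅ : V) : Set where
    field
      hexagon : Hex p q o₂ o₃ o₄ o₅
      ∉₂ : ¬ S o₂
      ∉₃ : ¬ S o₃
      ∉₄ : ¬ S o₄
      ∉₅ : ¬ S o₅
      ~₂ : ∀ {x} → S x → x ~ o₂ → x ≡ q
      ~₃ : ∀ {x} → S x → ¬ x ~ o₃
      ~₄ : ∀ {x} → S x → ¬ x ~ o₄
      ~₅ : ∀ {x} → S x → x ~ o₅ → x ≡ p

  -- The cases lead to one another on smaller sets: a root on a hexagon leads to a ported edge at
  -- the far end of the bundle, a ported edge with only leaves at one end leads to a root, and a
  -- root without deep branches leaves an unrestricted remainder for `plain`.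
  record Goal (S : Pred V 0ℓ) : Set where
    field
      plain : Rep S
      rooted : ∀ {p} → S p → Anchor S p → VRep S p
      ported : ∀ {p q o₂ o₃ o₄ o₅} → S p → S q → Outside S p q o₂ o₃ o₄ o₅ → PortRep S p q

  Below : Pred V 0ℓ → Set₁
  Below S = ∀ {T} → Decidable T → T ⊆ S → (∃ λ x → S x × ¬ T x) → Goal T

  -- A bundle of parallel paths between `h₀` and `h₃`

  module Block {S : Pred V 0ℓ} (S? : Decidable S) (below : Below S) {h₀ h₁ h₂ h₃ : V}
    (s₀ : S h₀) (s₁ : S h₁) (s₂ : S h₂) (s₃ : S h₃)
    (h₀₁ : h₀ ~ h₁) (h₁₂ : h₁ ~ h₂) (h₂₃ : h₂ ~ h₃) (h₀≢h₂ : h₀ ≢ h₂) (h₁≢h₃ : h₁ ≢ h₃)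
    (deg₂ : ∀ {z} → S z → z ~ h₂ → z ≡ h₁ ⊎ z ≡ h₃)
    where

    Path : V → V → Set
    Path x y = S x × x ~ h₀ × x ≢ h₁ × S y × y ~ x × y ~ h₃

    path? : ∀ x y → Dec (Path x y)
    path? x y = S? x ×-dec ((x ~? h₀) ×-dec (¬? (x ≟ h₁) ×-dec
      (S? y ×-dec ((y ~? x) ×-dec (y ~? h₃)))))

    Outer₀ Outer₁ : Pred V 0ℓ
    Outer₀ v = S v × h₀ ~ v × v ≢ h₁ × ¬ ∃ (Path v)
    Outer₁ v = S v × h₁ ~ v × v ≢ h₀ × v ≢ h₂

    outer₀? : Decidable Outer₀
    outer₀? v = S? v ×-dec ((h₀ ~? v) ×-dec (¬? (v ≟ h₁) ×-dec ¬? (any? (path? v))))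

    outer₁? : Decidable Outer₁
    outer₁? v = S? v ×-dec ((h₁ ~? v) ×-dec (¬? (v ≟ h₀) ×-dec ¬? (v ≟ h₂)))

    star? : ∀ p v → Decidable (Star p v)
    star? p v x = (x ≟ v) ⊎-dec ((v ~? x) ×-dec ¬? (x ≟ p))

    -- What hangs on `h₀` and `h₁` apart from the bundle is cut off here and put back by `Finish`,
    -- whose `Trim` unfolds to `Core` at these vertices.
    Far₀ Far₁ Core : Pred V 0ℓ
    Far₀ x = ∃ λ v → Outer₀ v × Star h₀ v x
    Far₁ x = ∃ λ v → Outer₁ v × Star h₁ v x
    Core x = S x × ¬ Far₀ x × ¬ Far₁ x

    far₀? : Decidable Far₀
    far₀? x = any? λ v → outer₀? v ×-dec star? h₀ v x

    far₁? : Decidable Far₁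
    far₁? x = any? λ v → outer₁? v ×-dec star? h₁ v x

    h₃≁h₀ : ¬ h₃ ~ h₀
    h₃≁h₀ q = noC₄ h₀₁ h₁₂ h₂₃ q h₀≢h₂ h₁≢h₃

    module _ {x y : V} (xy : Path x y) where
      private
        x~h₀ = proj₁ (proj₂ xy)
        x≢h₁ = proj₁ (proj₂ (proj₂ xy))
        y~x = proj₁ (proj₂ (proj₂ (proj₂ (proj₂ xy))))
        y~h₃ = proj₂ (proj₂ (proj₂ (proj₂ (proj₂ xy))))

      x≢h₃ : x ≢ h₃
      x≢h₃ refl = h₃≁h₀ x~h₀

      y≢h₀ : y ≢ h₀
      y≢h₀ refl = h₃≁h₀ (~-sym y~h₃)

      y≢h₂ : y ≢ h₂
      y≢h₂ refl with deg₂ (proj₁ xy) (~-sym y~x)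
      ... | inj₁ eq = x≢h₁ eq
      ... | inj₂ eq = x≢h₃ eq

      y≁h₁ : ¬ y ~ h₁
      y≁h₁ q = noC₄ q h₁₂ h₂₃ (~-sym y~h₃) y≢h₂ h₁≢h₃

      hexOf : Hex h₀ h₁ h₂ h₃ y x
      hexOf = hex h₀₁ h₁₂ h₂₃ (~-sym y~h₃) y~x x~h₀ h₀≢h₂ h₁≢h₃ (≢-sym y≢h₂) (≢-sym x≢h₃) y≢h₀ x≢h₁

    -- Two paths whose vertices next to h₃ have further neighbours would form a hexagon with
    -- three consecutive vertices that have neighbours off it.
    Special : V → V → Set
    Special x y = Path x y × (∀ {x′ y′ z} → Path x′ y′ → y′ ≢ y → S z → z ~ y′ → z ≡ h₃ ⊎ z ~ h₀)

    special : (∃ λ x → ∃ (Path x)) → ∃ λ x → ∃ (Special x)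
    special (x₀ , y₀ , p₀) with any? (λ x → any? λ y → path? x y ×-dec
        any? λ z → S? z ×-dec ((z ~? y) ×-dec (¬? (z ≟ h₃) ×-dec ¬? (z ~? h₀))))
    ... | no none = x₀ , y₀ , p₀ , λ {x′} {y′} {z} p _ sz z~y′ → decide x′ y′ z p sz z~y′
      where
      decide : ∀ x′ y′ z → Path x′ y′ → S z → z ~ y′ → z ≡ h₃ ⊎ z ~ h₀
      decide x′ y′ z p sz z~y′ with z ≟ h₃ | z ~? h₀
      ... | yes eq | _ = inj₁ eq
      ... | no _ | yes q = inj₂ q
      ... | no z≢ | no z≁ = ⊥-elim (none (x′ , y′ , p , z , sz , z~y′ , z≢ , z≁))
    ... | yes (x , y , xy , w , sw , w~y , w≢h₃ , w≁h₀) = x , y , xy ,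
        λ {x′} {y′} {z} p ne sz z~y′ → decide x′ y′ z p ne sz z~y′
      where
      decide : ∀ x′ y′ z → Path x′ y′ → y′ ≢ y → S z → z ~ y′ → z ≡ h₃ ⊎ z ~ h₀
      decide x′ y′ z p′@(_ , x′~h₀ , _ , _ , y′~x′ , y′~h₃) y′≢y sz z~y′ with z ≟ h₃ | z ~? h₀
      ... | yes eq | _ = inj₁ eq
      ... | no _ | yes q = inj₂ q
      ... | no z≢h₃ | no z≁h₀ = ⊥-elim (no3c around z~y′ z≢h₃ (λ { refl → z≁h₀ x′~h₀ })
          h₂₃ (≢-sym (y≢h₂ p′)) (≢-sym (y≢h₂ xy)) w~y w≢h₃ (λ { refl → w≁h₀ (proj₁ (proj₂ xy)) }))
        where
        y~x = proj₁ (proj₂ (proj₂ (proj₂ (proj₂ xy))))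
        y~h₃ = proj₂ (proj₂ (proj₂ (proj₂ (proj₂ xy))))
        x′≢x : x′ ≢ x
        x′≢x refl = noC₄ y′~x′ (~-sym y~x) y~h₃ (~-sym y′~h₃) y′≢y (x≢h₃ p′)
        around : Hex y′ h₃ y x h₀ x′
        around = hex y′~h₃ (~-sym y~h₃) y~x (proj₁ (proj₂ xy)) (~-sym x′~h₀) (~-sym y′~x′)
          y′≢y (≢-sym (x≢h₃ xy)) (y≢h₀ xy) (≢-sym x′≢x) (≢-sym (y≢h₀ p′)) (x≢h₃ p′)

    module _ (plain : ∀ {x y z} → Path x y → S z → z ~ x → z ≡ h₀ ⊎ z ~ h₃)
      {x* y* : V} (sp : Special x* y*) where

      private
        xy* : Path x* y*
        xy* = proj₁ sp
        x*~h₀ = proj₁ (proj₂ xy*)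
        x*≢h₁ = proj₁ (proj₂ (proj₂ xy*))
        y*~x* = proj₁ (proj₂ (proj₂ (proj₂ (proj₂ xy*))))
        y*~h₃ = proj₂ (proj₂ (proj₂ (proj₂ (proj₂ xy*))))

      -- By the choice of `x* y*`, no `y` of another path has neighbours beyond the bundle. So the
      -- edge `h₃ y*` can serve as the port of the part beyond it, and only the remaining paths
      -- count as inner.
      Inner : V → V → Set
      Inner x y = Path x y × y ≢ y*

      inner? : ∀ x y → Dec (Inner x y)
      inner? x y = path? x y ×-dec ¬? (y ≟ y*)

      Rest : Pred V 0ℓ
      Rest x = Core x × x ≢ h₀ × x ≢ h₁ × x ≢ h₂ × ¬ ∃ (Path x) × ¬ (∃ λ z → Inner z x)

      rest? : Decidable Rest
      rest? x = (S? x ×-dec (¬? (far₀? x) ×-dec ¬? (far₁? x))) ×-dec (¬? (x ≟ h₀) ×-dec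
        (¬? (x ≟ h₁) ×-dec (¬? (x ≟ h₂) ×-dec
        (¬? (any? (path? x)) ×-dec ¬? (any? λ z → inner? z x)))))

      ~h₀⇒path : ∀ {x} → Core x → x ≢ h₁ → x ~ h₀ → ∃ (Path x)
      ~h₀⇒path {x} (sx , ¬f₀ , _) x≢h₁ x~h₀ = decidable-stable (any? (path? x))
        (λ ¬path → ¬f₀ (x , (sx , ~-sym x~h₀ , x≢h₁ , ¬path) , inj₁ refl))

      ≁h₁ : ∀ {x} → Core x → x ≢ h₀ → x ≢ h₂ → ¬ x ~ h₁
      ≁h₁ {x} (sx , _ , ¬f₁) x≢h₀ x≢h₂ x~h₁ = ¬f₁ (x , (sx , ~-sym x~h₁ , x≢h₀ , x≢h₂) , inj₁ refl)

      ~x*⇒y* : ∀ {x} → S x → x ≢ h₀ → x ~ x* → x ≡ y*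
      ~x*⇒y* {x} sx x≢h₀ x~x* with plain xy* sx x~x*
      ... | inj₁ eq = ⊥-elim (x≢h₀ eq)
      ... | inj₂ x~h₃ = unique (~-sym x~x*) x~h₃ (~-sym y*~h₃) y*~x* (x≢h₃ xy*)

      h₃∈ : Rest h₃
      h₃∈ = (s₃ ,
          (λ { (v , (_ , h₀~v , _) , inj₁ refl) → h₃≁h₀ (~-sym h₀~v)
             ; (v , (_ , h₀~v , _) , inj₂ (v~h₃ , _)) → noC₅ h₀₁ h₁₂ h₂₃ (~-sym v~h₃) h₀~v }) ,
          (λ { (v , (_ , h₁~v , _) , inj₁ refl) → noC₃ h₁₂ h₂₃ h₁~v
             ; (v , (_ , h₁~v , _ , v≢h₂) , inj₂ (v~h₃ , _)) →
                 noC₄ h₁~v v~h₃ (~-sym h₂₃) (~-sym h₁₂) h₁≢h₃ v≢h₂ })) ,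
        (λ { refl → noC₃ h₀₁ h₁₂ (~-sym h₂₃) }) , ≢-sym h₁≢h₃ , ≢-sym (~-≢ h₂₃) ,
        (λ (_ , _ , q , _) → h₃≁h₀ q) ,
        (λ (_ , (_ , _ , _ , _ , _ , q) , _) → ~-irrefl refl q)

      y*∈ : Rest y*
      y*∈ = (proj₁ (proj₂ (proj₂ (proj₂ xy*))) ,
          (λ { (v , (_ , h₀~v , _) , inj₁ refl) → noC₃ y*~x* x*~h₀ (~-sym h₀~v)
             ; (v , (sv , h₀~v , v≢h₁ , ¬path) , inj₂ (v~y* , _)) → ¬path
                 (y* , sv , ~-sym h₀~v , v≢h₁ , proj₁ (proj₂ (proj₂ (proj₂ xy*))) , ~-sym v~y* , y*~h₃) }) ,
          (λ { (v , (_ , h₁~v , _) , inj₁ refl) → y≁h₁ xy* (~-sym h₁~v)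
             ; (v , (_ , h₁~v , _) , inj₂ (v~y* , _)) →
                 noC₅ h₁₂ h₂₃ (~-sym y*~h₃) (~-sym v~y*) h₁~v })) ,
        y≢h₀ xy* , (λ { refl → noC₃ y*~x* x*~h₀ (~-sym h₀₁) }) , y≢h₂ xy* ,
        (λ (_ , _ , q , _) → noC₃ y*~x* x*~h₀ q) ,
        (λ (_ , _ , ne) → ne refl)
      outside : Outside Rest h₃ y* x* h₀ h₁ h₂
      outside = record
        { hexagon = rotate (rotate (rotate (hexOf xy*)))
        ; ∉₂ = λ (_ , _ , _ , _ , ¬path , _) → ¬path (y* , xy*)
        ; ∉₃ = λ (_ , ≢h₀ , _) → ≢h₀ refl
        ; ∉₄ = λ (_ , _ , ≢h₁ , _) → ≢h₁ refl
        ; ∉₅ = λ (_ , _ , _ , ≢h₂ , _) → ≢h₂ refl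
        ; ~₂ = λ ((sx , _) , x≢h₀ , _) → ~x*⇒y* sx x≢h₀
        ; ~₃ = λ (core , _ , x≢h₁ , _ , ¬path , _) q → ¬path (~h₀⇒path core x≢h₁ q)
        ; ~₄ = λ (core , x≢h₀ , _ , x≢h₂ , _) → ≁h₁ core x≢h₀ x≢h₂
        ; ~₅ = λ ((sx , _) , _ , x≢h₁ , _) q → [ ⊥-elim ∘ x≢h₁ , id ]′ (deg₂ sx q)
        }

      -- The kinds are named along paths `a x y b` with `h₃` as `a` and `h₀` as `b`, which exchanges
      -- the letters of `Path`: a vertex next to `h₀` other than `x*` has kind `ky`. The path
      -- through `y*` and `x*` is `a x₁ y₁ b`, and the one through `h₂` and `h₁` is `a x₂ y₂ b`.
      data Role (v : V) : Set where
        rb  : v ≡ h₀ → Role v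
        ry₂ : v ≡ h₁ → Role v
        rx₂ : v ≡ h₂ → Role v
        ry₁ : v ≡ x* → Role v
        ry  : ∃ (Path v) → v ≢ x* → Role v
        rx  : ∀ x → Inner x v → Role v
        rest : v ≢ h₀ → v ≢ h₁ → v ≢ h₂ → ¬ ∃ (Path v) → ¬ (∃ λ z → Inner z v) → Role v

      kindOf : ∀ {v} → Role v → Kind
      kindOf (rb _) = kb
      kindOf (ry₂ _) = ky₂
      kindOf (rx₂ _) = kx₂
      kindOf (ry₁ _) = ky₁
      kindOf (ry _ _) = ky
      kindOf (rx _ _) = kx
      kindOf (rest _ _ _ _ _) = kold

      idxOf : ∀ {v} → Role v → V
      idxOf (rx x _) = x
      idxOf {v} _ = v

      role : ∀ v → Role v
      role v with v ≟ h₀ | v ≟ h₁ | v ≟ h₂ | v ≟ x* | any? (path? v) | any? (λ z → inner? z v)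
      ... | yes e | _ | _ | _ | _ | _ = rb e
      ... | no _ | yes e | _ | _ | _ | _ = ry₂ e
      ... | no _ | no _ | yes e | _ | _ | _ = rx₂ e
      ... | no _ | no _ | no _ | yes e | _ | _ = ry₁ e
      ... | no _ | no _ | no _ | no ne | yes p | _ = ry p ne
      ... | no _ | no _ | no _ | no _ | no _ | yes (x , i) = rx x i
      ... | no n₀ | no n₁ | no n₂ | no _ | no ¬p | no ¬i = rest n₀ n₁ n₂ ¬p ¬i

      role₀ : (r : Role h₀) → kindOf r ≡ kb
      role₀ (rb _) = refl
      role₀ (ry₂ e) = ⊥-elim (~-≢ h₀₁ e)
      role₀ (rx₂ e) = ⊥-elim (h₀≢h₂ e)
      role₀ (ry₁ e) = ⊥-elim (~-≢ x*~h₀ (sym e))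
      role₀ (ry (_ , _ , q , _) _) = ⊥-elim (~-irrefl refl q)
      role₀ (rx _ (p , _)) = ⊥-elim (y≢h₀ p refl)
      role₀ (rest ne _ _ _ _) = ⊥-elim (ne refl)

      role₁ : (r : Role h₁) → kindOf r ≡ ky₂
      role₁ (rb e) = ⊥-elim (~-≢ h₀₁ (sym e))
      role₁ (ry₂ _) = refl
      role₁ (rx₂ e) = ⊥-elim (~-≢ h₁₂ e)
      role₁ (ry₁ e) = ⊥-elim (x*≢h₁ (sym e))
      role₁ (ry (_ , _ , _ , ne , _) _) = ⊥-elim (ne refl)
      role₁ (rx _ ((_ , _ , _ , _ , _ , q) , _)) = ⊥-elim (noC₃ h₁₂ h₂₃ q)
      role₁ (rest _ ne _ _ _) = ⊥-elim (ne refl)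

      side₁₃ : side h₁ ≡ side h₃
      side₁₃ = sameSide (~⇒≢ h₁₂) (~⇒≢ h₂₃)

      ~h₀⇒side : ∀ {v} → v ~ h₀ → side v ≡ side h₃
      ~h₀⇒side q = trans (sameSide (~⇒≢ q) (~⇒≢ h₀₁)) side₁₃

      near-role : ∀ {v} (r : Role v) → Near (kindOf r) → side v ≡ side h₃
      near-role (ry₂ refl) _ = side₁₃
      near-role (ry₁ refl) _ = ~h₀⇒side x*~h₀
      near-role (ry (_ , _ , q , _) _) _ = ~h₀⇒side q
      near-role (rb _) (inj₁ (inj₁ ()))
      near-role (rb _) (inj₁ (inj₂ ()))
      near-role (rb _) (inj₂ ())
      near-role (rx₂ _) (inj₁ (inj₁ ()))
      near-role (rx₂ _) (inj₁ (inj₂ ()))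
      near-role (rx₂ _) (inj₂ ())
      near-role (rx _ _) (inj₁ (inj₁ ()))
      near-role (rx _ _) (inj₁ (inj₂ ()))
      near-role (rx _ _) (inj₂ ())
      near-role (rest _ _ _ _ _) (inj₁ (inj₁ ()))
      near-role (rest _ _ _ _ _) (inj₁ (inj₂ ()))
      near-role (rest _ _ _ _ _) (inj₂ ())

      far-role : ∀ {v} (r : Role v) → Far (kindOf r) → side v ≢ side h₃
      far-role (rb refl) _ eq = ~⇒≢ h₀₁ (trans eq (sym side₁₃))
      far-role (rx₂ refl) _ = ~⇒≢ h₂₃
      far-role (rx _ ((_ , _ , _ , _ , _ , q) , _)) _ = ~⇒≢ q
      far-role (ry₂ _) (inj₁ (inj₁ ()))
      far-role (ry₂ _) (inj₁ (inj₂ ()))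
      far-role (ry₂ _) (inj₂ ())
      far-role (ry₁ _) (inj₁ (inj₁ ()))
      far-role (ry₁ _) (inj₁ (inj₂ ()))
      far-role (ry₁ _) (inj₂ ())
      far-role (ry _ _) (inj₁ (inj₁ ()))
      far-role (ry _ _) (inj₁ (inj₂ ()))
      far-role (ry _ _) (inj₂ ())
      far-role (rest _ _ _ _ _) (inj₁ (inj₁ ()))
      far-role (rest _ _ _ _ _) (inj₁ (inj₂ ()))
      far-role (rest _ _ _ _ _) (inj₂ ())

      ≁h₂ : ∀ {v} → S v → v ≢ h₁ → v ≢ h₃ → ¬ v ~ h₂
      ≁h₂ s v≢h₁ v≢h₃ q = [ v≢h₁ , v≢h₃ ]′ (deg₂ s q)

      meets : ∀ {u w} → Core u → Core w → side u ≡ side h₃ → side w ≢ side h₃ →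
        (r : Role u) (r′ : Role w) → ∀ {idx : V → V} → idx u ≡ idxOf r → idx w ≡ idxOf r′ →
        Meets h₃ y* idx (kindOf r) u (kindOf r′) w
      meets cu cw su sw (rest _ u≢h₁ _ _ _) (rx₂ refl) _ _ =
        (λ { refl → ~-sym h₂₃ }) , λ q → [ ⊥-elim ∘ u≢h₁ , id ]′ (deg₂ (proj₁ cu) q)
      meets cu cw su sw (rest _ u≢h₁ _ ¬path _) (rx x (p@(_ , x~h₀ , _ , _ , y~x , y~h₃) , w≢y*)) _ _ =
        (λ { refl → ~-sym y~h₃ }) ,
        λ q → [ id , (λ u~h₀ → ⊥-elim (¬path (~h₀⇒path cu u≢h₁ u~h₀))) ]′ (proj₂ sp p w≢y* (proj₁ cu) q)
      meets cu cw su sw (rest _ u≢h₁ _ ¬path _) (rb refl) _ _ q = ¬path (~h₀⇒path cu u≢h₁ q)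
      meets cu cw su sw (ry₁ refl) (rest w≢h₀ _ _ _ _) _ _ =
        (λ { refl → ~-sym y*~x* }) , λ q → ~x*⇒y* (proj₁ cw) w≢h₀ (~-sym q)
      meets cu cw su sw (ry₂ refl) (rest w≢h₀ _ w≢h₂ _ _) _ _ q = ≁h₁ cw w≢h₀ w≢h₂ (~-sym q)
      meets {u} {w} cu cw su sw (ry (y , p@(xs , x~h₀ , x≢h₁ , _)) u≢x*) (rest w≢h₀ _ _ _ ¬inner) _ _ q
        with plain p (proj₁ cw) (~-sym q)
      ... | inj₁ eq = w≢h₀ eq
      ... | inj₂ w~h₃ with w ≟ y*
      ... | yes refl = noC₄ q y*~x* x*~h₀ (~-sym x~h₀) u≢x* (y≢h₀ xy*)
      ... | no w≢y* = ¬inner (u , (xs , x~h₀ , x≢h₁ , proj₁ cw , ~-sym q , w~h₃) , w≢y*)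
      meets cu cw su sw (ry₁ refl) (rx₂ refl) _ _ = ≁h₂ (proj₁ cu) x*≢h₁ (x≢h₃ xy*)
      meets cu cw su sw (ry₁ refl) (rb refl) _ _ = x*~h₀
      meets cu cw su sw (ry₁ refl) (rx x (p , w≢y*)) _ _ q = w≢y* (~x*⇒y* (proj₁ cw) (y≢h₀ p) (~-sym q))
      meets cu cw su sw (ry₂ refl) (rx₂ refl) _ _ = h₁₂
      meets cu cw su sw (ry₂ refl) (rb refl) _ _ = ~-sym h₀₁
      meets cu cw su sw (ry₂ refl) (rx x (p , _)) _ _ q = y≁h₁ p (~-sym q)
      meets cu cw su sw (ry (y , p@(_ , _ , x≢h₁ , _)) _) (rx₂ refl) _ _ = ≁h₂ (proj₁ cu) x≢h₁ (x≢h₃ p)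
      meets cu cw su sw (ry (_ , _ , x~h₀ , _) _) (rb refl) _ _ = x~h₀
      meets {u} {w} cu cw su sw (ry (_ , _ , u~h₀ , _) _) (rx x (p@(_ , x~h₀ , _ , _ , y~x , _) , _)) eu ew =
        (λ eq → ~-sym (subst (w ~_) (trans (sym ew) (trans (sym eq) eu)) y~x)) ,
        λ q → trans eu (trans (unique (~-sym u~h₀) q y~x x~h₀ (≢-sym (y≢h₀ p))) (sym ew))
      meets cu cw su sw r@(rx₂ _) r′ _ _ = ⊥-elim (far-role r (inj₁ (inj₁ refl)) su)
      meets cu cw su sw r@(rb _) r′ _ _ = ⊥-elim (far-role r (inj₁ (inj₂ refl)) su)
      meets cu cw su sw r@(rx _ _) r′ _ _ = ⊥-elim (far-role r (inj₂ refl) su)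
      meets cu cw su sw r r′@(ry₁ _) _ _ = ⊥-elim (sw (near-role r′ (inj₁ (inj₁ refl))))
      meets cu cw su sw r r′@(ry₂ _) _ _ = ⊥-elim (sw (near-role r′ (inj₁ (inj₂ refl))))
      meets cu cw su sw r r′@(ry _ _) _ _ = ⊥-elim (sw (near-role r′ (inj₂ refl)))
      meets cu cw su sw (rest _ _ _ _ _) (rest _ _ _ _ _) _ _ = tt

      parallel : Parallel Rest Core h₃ y* h₀ h₁
      parallel = record
        { kind = λ v → kindOf (role v)
        ; idx = λ v → idxOf (role v)
        ; keep = λ {v} c eq → keep c (role v) eq
        ; near-side = λ {v} _ → near-role (role v)
        ; far-side = λ {v} _ → far-role (role v)
        ; meets = λ {u} {w} cu cw su sw → meets cu cw su sw (role u) (role w) refl refl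
        ; kind-p = role₀ (role h₀)
        ; kind-q = role₁ (role h₁)
        ; only-p = λ {v} _ → isB (role v)
        ; only-q = λ {v} _ → isY₂ (role v)
        }
        where
        keep : ∀ {v} → Core v → (r : Role v) → kindOf r ≡ kold → Rest v
        keep c (rest n₀ n₁ n₂ ¬p ¬i) _ = c , n₀ , n₁ , n₂ , ¬p , ¬i
        keep c (rb _) ()
        keep c (ry₂ _) ()
        keep c (rx₂ _) ()
        keep c (ry₁ _) ()
        keep c (ry _ _) ()
        keep c (rx _ _) ()
        isB : ∀ {v} (r : Role v) → kindOf r ≡ kb → v ≡ h₀
        isB (rb e) _ = e
        isB (ry₂ _) ()
        isB (rx₂ _) ()
        isB (ry₁ _) ()
        isB (ry _ _) ()
        isB (rx _ _) ()
        isB (rest _ _ _ _ _) ()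
        isY₂ : ∀ {v} (r : Role v) → kindOf r ≡ ky₂ → v ≡ h₁
        isY₂ (ry₂ e) _ = e
        isY₂ (rb _) ()
        isY₂ (rx₂ _) ()
        isY₂ (ry₁ _) ()
        isY₂ (ry _ _) ()
        isY₂ (rx _ _) ()
        isY₂ (rest _ _ _ _ _) ()

      -- The hexagon through `x*`, `h₀`, `h₁`, `h₂` lies outside `Rest` except for the edge `h₃ y*`,
      -- so the induction hypothesis gives a port there; the bundle carries it over to `h₀ h₁`.
      core : PortRep Core h₀ h₁
      core = addParallel (~-sym y*~h₃)
        (Goal.ported (below rest? (λ ((s , _) , _) → s) (h₀ , s₀ , λ (_ , ≢h₀ , _) → ≢h₀ refl))
          h₃∈ y*∈ outside)
        parallel

    corePort : (∀ {x y z} → Path x y → S z → z ~ x → z ≡ h₀ ⊎ z ~ h₃) → (∃ λ x → ∃ (Path x)) →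
      PortRep Core h₀ h₁
    corePort plain e = core plain (proj₂ (proj₂ (special e)))

  Trim : Pred V 0ℓ → V → V → Pred V 0ℓ → Pred V 0ℓ → Pred V 0ℓ
  Trim S p q P Q x = S x × ¬ (∃ λ v → P v × Star p v x) × ¬ (∃ λ v → Q v × Star q v x)

  trim-swap : ∀ {S : Pred V 0ℓ} {p q P Q} → Trim S p q P Q ⊆ Trim S q p Q P
  trim-swap (s , ¬p , ¬q) = s , ¬q , ¬p

  -- The leaves at `q` return first and keep the port. After that either stars return at `p`, for
  -- which it suffices that `p` is last, or only leaves, and then the port survives.
  module Finish {S P Q : Pred V 0ℓ} (S? : Decidable S) (P? : Decidable P) (Q? : Decidable Q)
    {p q : V} (p~q : p ~ q) (p∈S : S p) (q∈S : S q)
    (atP : ∀ {v} → P v → S v × p ~ v × v ≢ q) (atQ : ∀ {v} → Q v → S v × q ~ v × v ≢ p)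
    (R : PortRep (Trim S p q P Q) p q)
    (leaf : ∀ {v u} → Q v → S u → u ~ v → u ≡ q) where

    private
      p∈ : Trim S p q P Q p
      p∈ = p∈S ,
        (λ { (v , pv , inj₁ refl) → ~-irrefl refl (proj₁ (proj₂ (atP pv)))
           ; (v , pv , inj₂ (_ , ne)) → ne refl }) ,
        (λ { (v , qv , inj₁ refl) → proj₂ (proj₂ (atQ qv)) refl
           ; (v , qv , inj₂ (v~p , _)) → noC₃ (proj₁ (proj₂ (atQ qv))) v~p (~-sym p~q) })

      q∈ : Trim S p q P Q q
      q∈ = q∈S ,
        (λ { (v , pv , inj₁ refl) → proj₂ (proj₂ (atP pv)) refl
           ; (v , pv , inj₂ (v~q , _)) → noC₃ (proj₁ (proj₂ (atP pv))) v~q p~q }) ,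
        (λ { (v , qv , inj₁ refl) → ~-irrefl refl (proj₁ (proj₂ (atQ qv)))
           ; (v , qv , inj₂ (_ , ne)) → ne refl })

      withQ : PortRep (λ x → Trim S p q P Q x ⊎ Q x) q p
      withQ = addLeaves (PortRep-sym R) (~-sym p~q) q∈ p∈ Q?
        (λ qu (_ , _ , ¬q) → ¬q (_ , qu , inj₁ refl))
        (λ qu → proj₁ (proj₂ (atQ qu)))
        (λ qu (s , _) x~u → leaf qu s x~u)

      trimmed : ∀ {x} → S x → (∃ λ v → P v × Star p v x) ⊎ (Trim S p q P Q x ⊎ Q x)
      trimmed {x} s with any? (λ v → P? v ×-dec ((x ≟ v) ⊎-dec ((v ~? x) ×-dec ¬? (x ≟ p))))
                       | any? (λ v → Q? v ×-dec ((x ≟ v) ⊎-dec ((v ~? x) ×-dec ¬? (x ≟ q))))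
      ... | yes i | _ = inj₁ i
      ... | no ¬p | no ¬q = inj₂ (inj₁ (s , ¬p , ¬q))
      ... | no _ | yes (v , qv , inj₁ refl) = inj₂ (inj₂ qv)
      ... | no _ | yes (v , qv , inj₂ (v~x , x≢q)) = ⊥-elim (x≢q (leaf qv s (~-sym v~x)))

    finishV : (∀ {v} → P v → Shallow S p v) → VRep S p
    finishV shallow = VRep-⊆ (λ s → within s (trimmed s))
      (addStars (PortRep⇒VRep (~⇒≢ p~q) (PortRep-sym withQ)) S? (inj₁ p∈) p∈S P?
        (proj₁ ∘ atP) (λ pv → proj₁ (proj₂ (atP pv)))
        (λ { pv (inj₁ (_ , ¬p , _)) → ¬p (_ , pv , inj₁ refl)
           ; pv (inj₂ qv) → noC₃ (proj₁ (proj₂ (atQ qv))) (~-sym (proj₁ (proj₂ (atP pv)))) (~-sym p~q) })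
        only shallow
        (λ { (inj₁ (s , _)) → s ; (inj₂ qv) → proj₁ (atQ qv) }))
      where
      only : ∀ {v x} → P v → Trim S p q P Q x ⊎ Q x → x ~ v → x ≡ p
      only {v} {x} pv (inj₁ (_ , ¬p , _)) x~v =
        decidable-stable (x ≟ p) (λ x≢p → ¬p (v , pv , inj₂ (~-sym x~v , x≢p)))
      only pv (inj₂ qx) x~v =
        ⊥-elim (proj₂ (proj₂ (atP pv)) (leaf qx (proj₁ (atP pv)) (~-sym x~v)))
      within : ∀ {x} → S x → (∃ λ v → P v × Star p v x) ⊎ (Trim S p q P Q x ⊎ Q x) →
        (Trim S p q P Q x ⊎ Q x) ⊎ ∃ λ v → P v × (S x × Star p v x)
      within s (inj₁ (v , pv , star)) = inj₂ (v , pv , s , star)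
      within s (inj₂ t) = inj₁ t

    finishE : (∀ {v u} → P v → S u → u ~ v → u ≡ p) → PortRep S p q
    finishE leafP = PortRep-⊆ (λ s → within s (trimmed s))
      (addLeaves (PortRep-sym withQ) p~q (inj₁ p∈) (inj₁ q∈) P?
        (λ { pv (inj₁ (_ , ¬p , _)) → ¬p (_ , pv , inj₁ refl)
           ; pv (inj₂ qv) → noC₃ (proj₁ (proj₂ (atQ qv))) (~-sym (proj₁ (proj₂ (atP pv)))) (~-sym p~q) })
        (λ pv → proj₁ (proj₂ (atP pv)))
        (λ { pv (inj₁ (s , _)) x~u → leafP pv s x~u ; pv (inj₂ qv) x~u → leafP pv (proj₁ (atQ qv)) x~u }))
      where
      within : ∀ {x} → S x → (∃ λ v → P v × Star p v x) ⊎ (Trim S p q P Q x ⊎ Q x) →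
        (Trim S p q P Q x ⊎ Q x) ⊎ P x
      within s (inj₁ (v , pv , inj₁ refl)) = inj₂ pv
      within s (inj₁ (v , pv , inj₂ (v~x , x≢p))) = ⊥-elim (x≢p (leafP pv s (~-sym v~x)))
      within s (inj₂ t) = inj₁ t

  -- Hexagons with two opposite vertices of degree two

  record InHex (S : Pred V 0ℓ) (c₀ c₁ c₂ c₃ c₄ c₅ : V) : Set where
    field
      hexagon : Hex c₀ c₁ c₂ c₃ c₄ c₅
      ∈₀ : S c₀
      ∈₁ : S c₁
      ∈₂ : S c₂
      ∈₃ : S c₃
      ∈₄ : S c₄
      ∈₅ : S c₅

  rotateIn : ∀ {S c₀ c₁ c₂ c₃ c₄ c₅} → InHex S c₀ c₁ c₂ c₃ c₄ c₅ → InHex S c₁ c₂ c₃ c₄ c₅ c₀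
  rotateIn C = record { hexagon = rotate hexagon
    ; ∈₀ = ∈₁ ; ∈₁ = ∈₂ ; ∈₂ = ∈₃ ; ∈₃ = ∈₄ ; ∈₄ = ∈₅ ; ∈₅ = ∈₀ }
    where open InHex C

  swapIn : ∀ {S c₀ c₁ c₂ c₃ c₄ c₅} → InHex S c₀ c₁ c₂ c₃ c₄ c₅ → InHex S c₁ c₀ c₅ c₄ c₃ c₂
  swapIn C = record { hexagon = swap hexagon
    ; ∈₀ = ∈₁ ; ∈₁ = ∈₀ ; ∈₂ = ∈₅ ; ∈₃ = ∈₄ ; ∈₄ = ∈₃ ; ∈₅ = ∈₂ }
    where open InHex C

  record Slim (S : Pred V 0ℓ) (c₀ c₁ c₂ c₃ c₄ c₅ : V) : Set where
    field
      inHex : InHex S c₀ c₁ c₂ c₃ c₄ c₅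
      deg₂ : ∀ {z} → S z → z ~ c₂ → z ≡ c₁ ⊎ z ≡ c₃
      deg₅ : ∀ {z} → S z → z ~ c₅ → z ≡ c₀ ⊎ z ≡ c₄
    open InHex inHex public
    open Hex hexagon public

  swapSlim : ∀ {S c₀ c₁ c₂ c₃ c₄ c₅} → Slim S c₀ c₁ c₂ c₃ c₄ c₅ → Slim S c₁ c₀ c₅ c₄ c₃ c₂
  swapSlim C = record { inHex = swapIn inHex ; deg₂ = deg₅ ; deg₅ = deg₂ }
    where open Slim C

  module SlimBlock {S : Pred V 0ℓ} (S? : Decidable S) (below : Below S) {c₀ c₁ c₂ c₃ c₄ c₅ : V}
    (C : Slim S c₀ c₁ c₂ c₃ c₄ c₅) where
    open Slim C
    open Block S? below ∈₀ ∈₁ ∈₂ ∈₃ e₀ e₁ e₂ ≢₀ ≢₁ deg₂ public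

    c₅-path : Path c₅ c₄
    c₅-path = ∈₅ , e₅ , ≢₅ , ∈₄ , e₄ , ~-sym e₃

    path-c₄ : ∀ {x} → Path x c₄ → x ≡ c₅
    path-c₄ (_ , x~c₀ , _ , _ , c₄~x , _) = unique (~-sym x~c₀) (~-sym c₄~x) e₄ e₅ (≢-sym ≢₄)

  module _ {S : Pred V 0ℓ} (S? : Decidable S) (below : Below S) {c₀ c₁ c₂ c₃ c₄ c₅ : V}
    (C : Slim S c₀ c₁ c₂ c₃ c₄ c₅) where
    private
      module B = SlimBlock S? below C
      module B′ = SlimBlock S? below (swapSlim C)
    open Slim C

    -- A further parallel path between `c₁` and `c₄`, the wrong pair for the block at `c₀`. By
    -- `¬both`, a slim hexagon or its reflection `swapSlim` has none.
    Crossing : Set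
    Crossing = ∃ λ z → (∃ λ w → B′.Path z w) × z ≢ c₂

    crossing? : Dec Crossing
    crossing? = any? λ z → any? (λ w → B′.path? z w) ×-dec ¬? (z ≟ c₂)

    -- Two such paths would close up, with the edges c₀ c₁ and c₃ c₄, to an induced C₈.
    ¬both : ∀ {x y} → B.Path x y → x ≢ c₅ → ¬ Crossing
    ¬both {x} {y} p@(_ , x~c₀ , x≢c₁ , _ , y~x , y~c₃) x≢c₅
      (z , (w , q@(_ , z~c₁ , z≢c₀ , _ , w~z , w~c₄)) , z≢c₂) =
      noC₈ (~-sym x~c₀) (~-sym y~x) y~c₃ e₃ (~-sym w~c₄) w~z z~c₁ (~-sym e₀)
        (≢-sym (B.y≢h₀ p)) (B.x≢h₃ p) (λ { refl → x≢c₅ (B.path-c₄ p) })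
        (λ { refl → z≢c₂ (B′.path-c₄ q) }) (≢-sym (B′.x≢h₃ q)) (B′.y≢h₀ q) z≢c₀ (≢-sym x≢c₁)

    ¬crossing⇒ : ¬ Crossing → ∀ {z w} → S z → z ~ c₁ → z ≢ c₀ → z ≢ c₂ → S w → w ~ z → ¬ w ~ c₄
    ¬crossing⇒ ¬x {z} {w} sz z~c₁ z≢c₀ z≢c₂ sw w~z w~c₄ =
      ¬x (z , (w , sz , z~c₁ , z≢c₀ , sw , w~z , w~c₄) , z≢c₂)

  -- An edge that lies on a hexagon outside

  swapOutside : ∀ {S p q o₂ o₃ o₄ o₅} → Outside S p q o₂ o₃ o₄ o₅ → Outside S q p o₅ o₄ o₃ o₂
  swapOutside O = record { hexagon = swap hexagon ; ∉₂ = ∉₅ ; ∉₃ = ∉₄ ; ∉₄ = ∉₃ ; ∉₅ = ∉₂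
    ; ~₂ = ~₅ ; ~₃ = ~₄ ; ~₄ = ~₃ ; ~₅ = ~₂ }
    where open Outside O

  ≢-by : ∀ {S : Pred V 0ℓ} {x y} → S x → ¬ S y → x ≢ y
  ≢-by s ¬s refl = ¬s s

  module _ {S : Pred V 0ℓ} (S? : Decidable S) (below : Below S) where

    -- The neighbours `o₅` of `p` and `o₂` of `q` are off the hexagons in `S`, so `C₆⁺³ᶜ` makes the
    -- paths plain. On the outside hexagon, a branch of length two at one end of `p q` would form
    -- `C₆⁺²ˡ²` with `q c₂ c₃` or `p c₅ c₄` at the other end, so only leaves are left.
    portedUncrossed : ∀ {p q o₂ o₃ o₄ o₅ c₂ c₃ c₄ c₅} → Outside S p q o₂ o₃ o₄ o₅ →
      (C : Slim S p q c₂ c₃ c₄ c₅) → ¬ Crossing S? below C → PortRep S p q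
    portedUncrossed {p} {q} {o₂} {o₃} {o₄} {o₅} {c₂} {c₃} {c₄} {c₅} O C ¬crossing =
      Finish.finishE S? B.outer₀? B.outer₁? e₀ ∈₀ ∈₁
        (λ (s , p~v , v≢q , _) → s , p~v , v≢q) (λ (s , q~v , v≢p , _) → s , q~v , v≢p)
        (B.corePort plain (c₅ , c₄ , B.c₅-path)) leaf₁ leaf₀
      where
      open Slim C
      module O = Outside O
      module OH = Hex O.hexagon
      module B = SlimBlock S? below C
      plain : ∀ {x y z} → B.Path x y → S z → z ~ x → z ≡ p ⊎ z ~ c₃
      plain {x} {y} {z} xy sz z~x with z ≟ p | z ~? c₃
      ... | yes eq | _ = inj₁ eq
      ... | no _ | yes z~c₃ = inj₂ z~c₃
      ... | no z≢p | no z≁c₃ = ⊥-elim (no3c (unrotate (B.hexOf xy))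
        z~x z≢p (λ { refl → z≁c₃ (proj₂ (proj₂ (proj₂ (proj₂ (proj₂ xy))))) })
        OH.e₅ (≢-sym (≢-by (proj₁ xy) O.∉₅)) (≢-sym (≢-by ∈₁ O.∉₅))
        (~-sym OH.e₁) (≢-sym (≢-by ∈₀ O.∉₂)) (≢-sym (≢-by ∈₂ O.∉₂)))
      leaf₀ : ∀ {v u} → B.Outer₀ v → S u → u ~ v → u ≡ p
      leaf₀ {v} {u} (sv , p~v , v≢q , ¬path) su u~v = decidable-stable (u ≟ p) λ u≢p →
        no2l2 O.hexagon (~-sym p~v) v≢q (≢-by sv O.∉₅) u~v u≢p
          (~-sym e₁) (≢-sym ≢₀) (≢-by ∈₂ O.∉₂) (~-sym e₂) (≢-sym ≢₁)
          (O.~₃ su) (O.~₄ ∈₃)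
          (λ u~c₃ → ¬path (u , sv , ~-sym p~v , v≢q , su , u~v , u~c₃))
      leaf₁ : ∀ {v u} → B.Outer₁ v → S u → u ~ v → u ≡ q
      leaf₁ {v} {u} (sv , q~v , v≢p , v≢c₂) su u~v = decidable-stable (u ≟ q) λ u≢q →
        no2l2 O.hexagon e₅ ≢₅ (≢-by ∈₅ O.∉₅) e₄ ≢₄
          (~-sym q~v) v≢p (≢-by sv O.∉₂) u~v u≢q
          (O.~₃ ∈₄) (O.~₄ su)
          (λ c₄~u → ¬crossing⇒ S? below C ¬crossing sv (~-sym q~v) v≢p v≢c₂ su u~v (~-sym c₄~u))

    portedHex : ∀ {p q o₂ o₃ o₄ o₅ c₂ c₃ c₄ c₅} → Outside S p q o₂ o₃ o₄ o₅ →
      Slim S p q c₂ c₃ c₄ c₅ → PortRep S p q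
    portedHex {c₅ = c₅} O C with crossing? S? below C
    ... | no ¬crossing = portedUncrossed O C ¬crossing
    ... | yes crossing = PortRep-sym (portedUncrossed (swapOutside O) (swapSlim C)
      (λ (z , (w , path) , z≢c₅) → ¬both S? below C path z≢c₅ crossing))

    TwoPath : V → V → V → V → Set
    TwoPath p q v u = S v × v ~ p × v ≢ q × S u × u ~ v × u ≢ p

    twoPath? : ∀ p q v u → Dec (TwoPath p q v u)
    twoPath? p q v u = S? v ×-dec ((v ~? p) ×-dec (¬? (v ≟ q) ×-dec
      (S? u ×-dec ((u ~? v) ×-dec ¬? (u ≟ p)))))

    -- With `q` and its leaves removed, `p` is a root. Then `q` returns as a leaf of `p`, which
    -- creates the port, and the leaves of `q` go behind `p`.
    portedLeaves : ∀ {p q} → p ~ q → S p → S q → (∀ {v u} → ¬ TwoPath q p v u) →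
      (∀ {T} → T ⊆ S → ¬ T q → (∀ {x} → T x → x ~ q → x ≡ p) → Anchor T p) → PortRep S p q
    portedLeaves {p} {q} p~q p∈S q∈S none anchor = PortRep-⊆ within
      (PortRep-sym (addLeaves (PortRep-sym (addLeaf R q∉T p~q only)) (~-sym p~q) (inj₂ refl) (inj₁ p∈T)
        leaf? (λ { (_ , q~u , u≢p) (inj₁ (_ , _ , h)) → u≢p (h (~-sym q~u))
                 ; (_ , q~u , _) (inj₂ refl) → ~-irrefl refl q~u })
        (λ (_ , q~u , _) → q~u)
        (λ { {u} {x} (su , q~u , u≢p) (inj₁ (sx , x≢q , _)) x~u → decidable-stable (x ≟ q) λ x≢q →
               none (su , ~-sym q~u , u≢p , sx , x~u , x≢q)
           ; _ (inj₂ refl) _ → refl })))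
      where
      T : Pred V 0ℓ
      T x = S x × x ≢ q × (x ~ q → x ≡ p)
      T? : Decidable T
      T? x = S? x ×-dec (¬? (x ≟ q) ×-dec ((x ~? q) →-dec (x ≟ p)))
      q∉T : ¬ T q
      q∉T (_ , ne , _) = ne refl
      p∈T : T p
      p∈T = p∈S , ~-≢ p~q , λ _ → refl
      only : ∀ {x} → T x → x ~ q → x ≡ p
      only (_ , _ , h) = h
      R : VRep T p
      R = Goal.rooted (below T? proj₁ (q , q∈S , q∉T)) p∈T (anchor proj₁ q∉T only)
      Leaf : Pred V 0ℓ
      Leaf u = S u × q ~ u × u ≢ p
      leaf? : Decidable Leaf
      leaf? u = S? u ×-dec ((q ~? u) ×-dec ¬? (u ≟ p))
      within : S ⊆ (λ x → (T x ⊎ x ≡ q) ⊎ Leaf x)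
      within {x} s with x ≟ q | x ~? q | x ≟ p
      ... | yes eq | _ | _ = inj₁ (inj₂ eq)
      ... | no x≢q | no x≁q | _ = inj₁ (inj₁ (s , x≢q , ⊥-elim ∘ x≁q))
      ... | no x≢q | yes x~q | yes eq = inj₁ (inj₁ (s , x≢q , λ _ → eq))
      ... | no x≢q | yes x~q | no x≢p = inj₂ (s , ~-sym x~q , x≢p)

    outsideAnchor : ∀ {p q o₂ o₃ o₄ o₅} → Outside S p q o₂ o₃ o₄ o₅ →
      ∀ {T} → T ⊆ S → ¬ T q → (∀ {x} → T x → x ~ q → x ≡ p) → Anchor T p
    outsideAnchor O T⊆S q∉T only = outer
      (arm (~-sym e₅) (~-sym e₄) (~-sym e₃) ≢₄ (≢₃)) (∉₅ ∘ T⊆S) (∉₄ ∘ T⊆S) (∉₃ ∘ T⊆S)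
      (~₅ ∘ T⊆S) (~₄ ∘ T⊆S) (~₃ ∘ T⊆S)
      where
      open Outside O
      open Hex hexagon

    -- If both ends have branches of length two, `C₆⁺²ˡ²` on the outside hexagon makes the ends of
    -- the branches adjacent. This closes a hexagon in `S`, and it is slim by `C₆⁺³ᶜ`, as `p` and
    -- `q` have neighbours off it.
    solvePorted : ∀ {p q o₂ o₃ o₄ o₅} → S p → S q → Outside S p q o₂ o₃ o₄ o₅ → PortRep S p q
    solvePorted {p} {q} {o₂} {o₃} {o₄} {o₅} p∈S q∈S O
      with any? (λ v → any? (twoPath? p q v)) | any? (λ v → any? (twoPath? q p v))
    ... | _ | no none = portedLeaves e₀ p∈S q∈S (λ t → none (_ , _ , t)) (outsideAnchor O)
      where open Hex (Outside.hexagon O)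
    ... | no none | yes _ = PortRep-sym (portedLeaves (~-sym e₀) q∈S p∈S (λ t → none (_ , _ , t))
        (outsideAnchor (swapOutside O)))
      where open Hex (Outside.hexagon O)
    ... | yes (v , u , sv , v~p , v≢q , su , u~v , u≢p) | yes (w , t , sw , w~q , w≢p , st , t~w , t≢q) =
      portedHex O (record
        { inHex = record { hexagon = C ; ∈₀ = p∈S ; ∈₁ = q∈S ; ∈₂ = sw ; ∈₃ = st ; ∈₄ = su ; ∈₅ = sv }
        ; deg₂ = λ sz z~w → oneOf λ z≢q z≢t → no3c C
            e₅ (≢-sym (≢-by q∈S ∉₅)) (≢-sym (≢-by sv ∉₅)) (~-sym e₁) (≢-sym (≢-by p∈S ∉₂)) (≢-sym (≢-by sw ∉₂))
            z~w z≢q z≢t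
        ; deg₅ = λ sz z~v → oneOf λ z≢p z≢u → no3c (swap C)
            (~-sym e₁) (≢-sym (≢-by p∈S ∉₂)) (≢-sym (≢-by sw ∉₂)) e₅ (≢-sym (≢-by q∈S ∉₅)) (≢-sym (≢-by sv ∉₅))
            z~v z≢p z≢u
        })
      where
      open Outside O
      open Hex hexagon
      u~t : u ~ t
      u~t = decidable-stable (u ~? t) λ u≁t → no2l2 hexagon v~p v≢q (≢-by sv ∉₅) u~v u≢p
        w~q w≢p (≢-by sw ∉₂) t~w t≢q (~₃ su) (~₄ st) u≁t
      v≁w : ¬ v ~ w
      v≁w v~w = noC₄ v~w w~q (~-sym e₀) (~-sym v~p) v≢q w≢p
      C : Hex p q w t u v
      C = hex e₀ (~-sym w~q) (~-sym t~w) (~-sym u~t) u~v v~p (≢-sym w≢p) (≢-sym t≢q)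
        (λ { refl → v≁w (~-sym u~v) }) (λ { refl → v≁w t~w }) u≢p v≢q

  -- A root that lies on a hexagon

  hex? : ∀ a b c d e f → Dec (Hex a b c d e f)
  hex? a b c d e f with (a ~? b) ×-dec ((b ~? c) ×-dec ((c ~? d) ×-dec ((d ~? e) ×-dec
    ((e ~? f) ×-dec ((f ~? a) ×-dec (¬? (a ≟ c) ×-dec (¬? (b ≟ d) ×-dec (¬? (c ≟ e) ×-dec
    (¬? (d ≟ f) ×-dec (¬? (e ≟ a) ×-dec ¬? (f ≟ b)))))))))))
  ... | yes (e₀ , e₁ , e₂ , e₃ , e₄ , e₅ , n₀ , n₁ , n₂ , n₃ , n₄ , n₅) =
    yes (hex e₀ e₁ e₂ e₃ e₄ e₅ n₀ n₁ n₂ n₃ n₄ n₅)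
  ... | no ¬h = no λ (hex e₀ e₁ e₂ e₃ e₄ e₅ n₀ n₁ n₂ n₃ n₄ n₅) →
    ¬h (e₀ , e₁ , e₂ , e₃ , e₄ , e₅ , n₀ , n₁ , n₂ , n₃ , n₄ , n₅)

  inHex? : ∀ {S} → Decidable S → ∀ a b c d e f → Dec (InHex S a b c d e f)
  inHex? S? a b c d e f with hex? a b c d e f ×-dec (S? a ×-dec (S? b ×-dec (S? c ×-dec
    (S? d ×-dec (S? e ×-dec S? f)))))
  ... | yes (h , ∈₀ , ∈₁ , ∈₂ , ∈₃ , ∈₄ , ∈₅) = yes (record { hexagon = h
    ; ∈₀ = ∈₀ ; ∈₁ = ∈₁ ; ∈₂ = ∈₂ ; ∈₃ = ∈₃ ; ∈₄ = ∈₄ ; ∈₅ = ∈₅ })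
  ... | no ¬h = no λ C → let open InHex C in ¬h (hexagon , ∈₀ , ∈₁ , ∈₂ , ∈₃ , ∈₄ , ∈₅)

  reflectIn : ∀ {S c₀ c₁ c₂ c₃ c₄ c₅} → InHex S c₀ c₁ c₂ c₃ c₄ c₅ → InHex S c₀ c₅ c₄ c₃ c₂ c₁
  reflectIn C = rotateIn (swapIn C)

  Off : Pred V 0ℓ → V → V → V → Pred V 0ℓ
  Off S c a b z = S z × z ~ c × z ≢ a × z ≢ b

  off? : ∀ {S} → Decidable S → ∀ c a b → Decidable (Off S c a b)
  off? S? c a b z = S? z ×-dec ((z ~? c) ×-dec (¬? (z ≟ a) ×-dec ¬? (z ≟ b)))

  ¬off⇒ : ∀ {S c a b} → ¬ ∃ (Off S c a b) → ∀ {z} → S z → z ~ c → z ≡ a ⊎ z ≡ b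
  ¬off⇒ none sz z~c = oneOf λ z≢a z≢b → none (_ , sz , z~c , z≢a , z≢b)

  module Rooted {S : Pred V 0ℓ} (S? : Decidable S) (below : Below S) {p : V} (p∈S : S p)
    {o₁ o₂ o₃ : V} (O : Arm p o₁ o₂ o₃) (∉₁ : ¬ S o₁) (∉₂ : ¬ S o₂) (∉₃ : ¬ S o₃)
    (~₁ : ∀ {x} → S x → x ~ o₁ → x ≡ p) (~₂ : ∀ {x} → S x → ¬ x ~ o₂) (~₃ : ∀ {x} → S x → ¬ x ~ o₃)
    where

    private
      module O = Arm O
      o₁~p : o₁ ~ p
      o₁~p = ~-sym O.cv
      o₁≢ : ∀ {x} → S x → o₁ ≢ x
      o₁≢ s refl = ∉₁ s

    -- The arm leaving `S`, the arm `p c₁ c₂ c₃` and a deep branch at `v` would form `S₃₃₃`.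
    shallowBut : ∀ {c₁ c₂ c₃ c₄ c₅ v} → Slim S p c₁ c₂ c₃ c₄ c₅ → S v → p ~ v → v ≢ c₁ →
      (∀ {u} → S u → u ~ v → ¬ u ~ c₃) → Shallow S p v
    shallowBut {c₁} {c₂} {c₃} {v = v} C sv p~v v≢c₁ ≁c₃ {u} {t} su v~u u≢p st u~t =
      decidable-stable (t ≟ v) λ t≢v →
        noS₃₃₃ O (arm p~v v~u u~t u≢p t≢v) (arm C.e₀ C.e₁ C.e₂ (≢-sym C.≢₀) (≢-sym C.≢₁))
          (o₁≢ sv) (o₁≢ C.∈₁) v≢c₁
          (λ q → ~₂ st (~-sym q)) (λ q → ~₂ C.∈₃ (~-sym q)) (~₃ su) (≁c₃ su (~-sym v~u))
          (~₃ C.∈₂) (λ q → c₂≁t q (C.deg₂ st (~-sym q)))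
      where
      module C = Slim C
      c₂≁t : c₂ ~ t → t ≡ c₁ ⊎ t ≡ c₃ → ⊥
      c₂≁t _ (inj₁ refl) = noC₄ p~v v~u u~t (~-sym C.e₀) (≢-sym u≢p) v≢c₁
      c₂≁t _ (inj₂ refl) = ≁c₃ su (~-sym v~u) u~t

    -- The path `p o₁ o₂` and a path of length two at `c₁` would extend the hexagon to `C₆⁺²ˡ²`.
    leafBut : ∀ {c₁ c₂ c₃ c₄ c₅ v u} → Slim S p c₁ c₂ c₃ c₄ c₅ → S v → c₁ ~ v → v ≢ p → v ≢ c₂ →
      (∀ {u} → S u → u ~ v → ¬ u ~ c₄) → S u → u ~ v → u ≡ c₁
    leafBut {c₁} {v = v} {u = u} C sv c₁~v v≢p v≢c₂ ≁c₄ su u~v = decidable-stable (u ≟ c₁) λ u≢c₁ →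
      no2l2 C.hexagon o₁~p (o₁≢ C.∈₁) (o₁≢ C.∈₅) (~-sym O.vu) O.u≢c
        (~-sym c₁~v) v≢p v≢c₂ u~v u≢c₁ (λ q → ~₂ C.∈₃ (~-sym q)) (≁c₄ su u~v) (λ q → ~₂ su (~-sym q))
      where module C = Slim C

    -- A crossing means that the bundle joins `c₁` and `c₄`. The block is then built from `c₁` and
    -- its port turned round, so that the stars still hang on `p` and only leaves on `c₁`.
    rootedSlim : ∀ {c₁ c₂ c₃ c₄ c₅} (C : Slim S p c₁ c₂ c₃ c₄ c₅) →
      (∀ {x y z} → SlimBlock.Path S? below C x y → S z → z ~ x → z ≢ p → z ~ c₃) → VRep S p
    rootedSlim {c₁} {c₂} {c₃} {c₄} {c₅} C plain with crossing? S? below C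
    ... | no ¬crossing = Finish.finishV S? B.outer₀? B.outer₁? e₀ ∈₀ ∈₁
        (λ (s , p~v , v≢q , _) → s , p~v , v≢q) (λ (s , q~v , v≢p , _) → s , q~v , v≢p)
        (B.corePort plain′ (c₅ , c₄ , B.c₅-path))
        (λ (sv , c₁~v , v≢p , v≢c₂) → leafBut C sv c₁~v v≢p v≢c₂
          (¬crossing⇒ S? below C ¬crossing sv (~-sym c₁~v) v≢p v≢c₂))
        (λ (sv , p~v , v≢c₁ , ¬path) → shallowBut C sv p~v v≢c₁
          λ su u~v u~c₃ → ¬path (_ , sv , ~-sym p~v , v≢c₁ , su , u~v , u~c₃))
      where
      open Slim C
      module B = SlimBlock S? below C
      plain′ : ∀ {x y z} → B.Path x y → S z → z ~ x → z ≡ p ⊎ z ~ c₃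
      plain′ {z = z} xy sz z~x with z ≟ p
      ... | yes eq = inj₁ eq
      ... | no z≢p = inj₂ (plain xy sz z~x z≢p)
    ... | yes crossing@(z₀ , (w₀ , path₀) , z₀≢c₂) = Finish.finishV S? B.outer₁? B.outer₀? e₀ ∈₀ ∈₁
        (λ (s , p~v , v≢q , _) → s , p~v , v≢q) (λ (s , q~v , v≢p , _) → s , q~v , v≢p)
        (PortRep-⊆ (trim-swap {S = S} {P = B.Outer₁} {Q = B.Outer₀})
          (PortRep-sym (B.corePort plain′ (c₂ , c₃ , B.c₅-path))))
        (λ (sv , c₁~v , v≢p , ¬path) → leafBut C sv c₁~v v≢p
          (λ { refl → ¬path (c₃ , B.c₅-path) })
          (λ su u~v u~c₄ → ¬path (_ , sv , ~-sym c₁~v , v≢p , su , u~v , u~c₄)))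
        (λ (sv , p~v , v≢c₁ , v≢c₅) → shallowBut C sv p~v v≢c₁
          λ su u~v u~c₃ → ¬both S? below C (sv , ~-sym p~v , v≢c₁ , su , u~v , u~c₃) v≢c₅ crossing)
      where
      open Slim C
      module B = SlimBlock S? below (swapSlim C)
      plain′ : ∀ {x y z} → B.Path x y → S z → z ~ x → z ≡ c₁ ⊎ z ~ c₄
      -- Otherwise the consecutive vertices `x`, `c₁`, `p` have the neighbours `z`, `c₂`, `o₁` off
      -- the hexagon through `x` and `y`; for `x ≡ c₂` the crossing supplies `z₀` in place of `c₂`.
      plain′ {x} {y} {z} xy sz z~x with z ≟ c₁ | z ~? c₄ | x ≟ c₂
      ... | yes eq | _ | _ = inj₁ eq
      ... | no _ | yes q | _ = inj₂ q
      ... | no z≢c₁ | no z≁c₄ | yes refl = ⊥-elim (no3c around z~x z≢c₁ z≢y (proj₁ (proj₂ path₀))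
              z₀≢c₂ (proj₁ (proj₂ (proj₂ path₀))) o₁~p (o₁≢ ∈₁) (o₁≢ ∈₅))
        where
        around = unrotate (B.hexOf xy)
        z≢y : z ≢ y
        z≢y refl = z≁c₄ (proj₂ (proj₂ (proj₂ (proj₂ (proj₂ xy)))))
      ... | no z≢c₁ | no z≁c₄ | no x≢c₂ = ⊥-elim (no3c around z~x z≢c₁ z≢y (~-sym e₁)
              (≢-sym x≢c₂) (≢-sym ≢₀) o₁~p (o₁≢ ∈₁) (o₁≢ ∈₅))
        where
        around = unrotate (B.hexOf xy)
        z≢y : z ≢ y
        z≢y refl = z≁c₄ (proj₂ (proj₂ (proj₂ (proj₂ (proj₂ xy)))))

    -- If no vertex next to p on any hexagon has further neighbours, all paths are plain; and
    -- otherwise they are so for a hexagon that has such a vertex, as three consecutive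
    -- vertices with neighbours off a hexagon are excluded.
    rootedHex : ∀ {c₁ c₂ c₃ c₄ c₅} → InHex S p c₁ c₂ c₃ c₄ c₅ → VRep S p
    rootedHex {c₁} {c₂} {c₃} {c₄} {c₅} C with any? (λ a → any? λ b → any? λ c → any? λ d → any? λ e →
        inHex? S? p a b c d e ×-dec any? (off? S? a p b))
    ... | yes (a , b , c , d , e , H , w , sw , w~a , w≢p , w≢b) = rootedSlim slim plain
      where
      module H = InHex H
      slim : Slim S p a b c d e
      slim = record { inHex = H
        ; deg₂ = λ sz z~b → oneOf λ z≢a z≢c → no3c H.hexagon o₁~p (o₁≢ H.∈₁) (o₁≢ H.∈₅)
            w~a w≢p w≢b z~b z≢a z≢c
        ; deg₅ = λ sz z~e → oneOf λ z≢p z≢d → no3c (swap H.hexagon) w~a w≢p w≢b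
            o₁~p (o₁≢ H.∈₁) (o₁≢ H.∈₅) z~e z≢p z≢d }
      module B = SlimBlock S? below slim
      plain : ∀ {x y z} → B.Path x y → S z → z ~ x → z ≢ p → z ~ c
      plain {x} {y} {z} xy sz z~x z≢p = decidable-stable (z ~? c) λ z≁c →
        no3c (unrotate (B.hexOf xy)) z~x z≢p
          (λ { refl → z≁c (proj₂ (proj₂ (proj₂ (proj₂ (proj₂ xy))))) })
          o₁~p (o₁≢ (proj₁ xy)) (o₁≢ H.∈₁) w~a w≢p w≢b
    ... | no none = choose₂ (any? (off? S? c₂ c₁ c₃))
      where
      module C = InHex C
      bare : ∀ {a b c d e} → InHex S p a b c d e → ∀ {z} → S z → z ~ a → z ≡ p ⊎ z ≡ b
      bare {a} {b} {c} {d} {e} H = ¬off⇒ (λ w → none (a , b , c , d , e , H , w))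
      plain : ∀ {a b c d e} (H : Slim S p a b c d e) → ∀ {x y z} → SlimBlock.Path S? below H x y →
        S z → z ~ x → z ≢ p → z ~ c
      plain H {x} {y} xy@(sx , _ , _ , sy , _ , y~c) sz z~x z≢p with bare (rotateIn (swapIn (record
        { hexagon = SlimBlock.hexOf S? below H xy
        ; ∈₀ = p∈S ; ∈₁ = H.∈₁ ; ∈₂ = H.∈₂ ; ∈₃ = H.∈₃ ; ∈₄ = sy ; ∈₅ = sx }))) sz z~x
        where module H = Slim H
      ... | inj₁ eq = ⊥-elim (z≢p eq)
      ... | inj₂ refl = y~c
      choose₂ : Dec (∃ (Off S c₂ c₁ c₃)) → VRep S p
      choose₂ (no bare₂) = rootedSlim slim (plain slim)
        where
        slim : Slim S p c₁ c₂ c₃ c₄ c₅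
        slim = record { inHex = C ; deg₂ = ¬off⇒ bare₂ ; deg₅ = bare (reflectIn C) }
      choose₂ (yes (w , sw , w~c₂ , w≢c₁ , w≢c₃)) = rootedSlim slim (plain slim)
        where
        slim : Slim S p c₅ c₄ c₃ c₂ c₁
        slim = record { inHex = reflectIn C
          ; deg₂ = λ sz z~c₄ → oneOf λ z≢c₅ z≢c₃ → no3nc C.hexagon o₁~p (o₁≢ C.∈₁) (o₁≢ C.∈₅)
              w~c₂ w≢c₁ w≢c₃ z~c₄ z≢c₃ z≢c₅
          ; deg₅ = bare C }

  -- Deep branches at a root

  Independent : ∀ {S p v w} → Deep S p v → Deep S p w → Set
  Independent (_ , _ , u , _ , _ , _ , t , _) (_ , _ , u′ , _ , _ , _ , t′ , _) = ¬ u ~ t′ × ¬ u′ ~ t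

  HexAt : Pred V 0ℓ → V → Set
  HexAt S p = ∃ λ a → ∃ λ b → ∃ λ c → ∃ λ d → ∃ λ e → InHex S p a b c d e

  hexAt? : ∀ {S} → Decidable S → Decidable (HexAt S)
  hexAt? S? p = any? λ a → any? λ b → any? λ c → any? λ d → any? λ e → inHex? S? p a b c d e

  -- An edge from the middle of one branch to the end of the other closes a hexagon through `p`.
  independent : ∀ {S p v w} → S p → (D : Deep S p v) (D′ : Deep S p w) → v ≢ w →
    HexAt S p ⊎ Independent D D′
  independent {S} {p} {v} {w} sp D@(sv , p~v , u , su , v~u , u≢p , t , st , u~t , t≢v)
    D′@(sw , p~w , u′ , su′ , w~u′ , u′≢p , t′ , st′ , u′~t′ , t′≢w) v≢w with u ~? t′ | u′ ~? t
  ... | no u≁t′ | no u′≁t = inj₂ (u≁t′ , u′≁t)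
  ... | yes u~t′ | _ = inj₁ (v , u , t′ , u′ , w , record
    { hexagon = hex p~v v~u u~t′ (~-sym u′~t′) (~-sym w~u′) (~-sym p~w) (≢-sym u≢p)
        (λ { refl → noC₄ p~v (~-sym u′~t′) (~-sym w~u′) (~-sym p~w) (≢-sym u′≢p) v≢w })
        (λ { refl → noC₄ p~v v~u (~-sym w~u′) (~-sym p~w) (≢-sym u≢p) v≢w })
        t′≢w u′≢p (≢-sym v≢w)
    ; ∈₀ = sp ; ∈₁ = sv ; ∈₂ = su ; ∈₃ = st′ ; ∈₄ = su′ ; ∈₅ = sw })
  ... | no _ | yes u′~t = inj₁ (w , u′ , t , u , v , record
    { hexagon = hex p~w w~u′ u′~t (~-sym u~t) (~-sym v~u) (~-sym p~v) (≢-sym u′≢p)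
        (λ { refl → noC₄ p~w (~-sym u~t) (~-sym v~u) (~-sym p~v) (≢-sym u≢p) (≢-sym v≢w) })
        (λ { refl → noC₄ p~w w~u′ (~-sym v~u) (~-sym p~v) (≢-sym u′≢p) (≢-sym v≢w) })
        t≢v u≢p v≢w
    ; ∈₀ = sp ; ∈₁ = sw ; ∈₂ = su′ ; ∈₃ = st ; ∈₄ = su ; ∈₅ = sv })

  armOf : ∀ {S p v} (D : Deep S p v) → ∃ λ u → ∃ λ t → Arm p v u t
  armOf (_ , p~v , u , _ , v~u , u≢p , t , _ , u~t , t≢v) = u , t , arm p~v v~u u~t u≢p t≢v

  module _ {S : Pred V 0ℓ} (S? : Decidable S) (below : Below S) where

    -- The branches of `p` outside `K` are stars and are set aside. The root `p` goes as well, so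
    -- that it can return as an isolated vertex or as a leaf before the stars do.
    module Stars {p : V} (p∈S : S p) {K : Pred V 0ℓ} (K? : Decidable K)
      (shallow : ∀ {v} → S v → p ~ v → ¬ K v → Shallow S p v) where

      Centre Kept : Pred V 0ℓ
      Centre v = S v × p ~ v × ¬ K v
      Kept x = S x × x ≢ p × (p ~ x → K x) × ¬ ∃ λ v → Centre v × v ~ x

      centre? : Decidable Centre
      centre? v = S? v ×-dec ((p ~? v) ×-dec ¬? (K? v))

      kept? : Decidable Kept
      kept? x = S? x ×-dec (¬? (x ≟ p) ×-dec (((p ~? x) →-dec K? x) ×-dec
        ¬? (any? λ v → centre? v ×-dec (v ~? x))))

      keptGoal : Goal Kept
      keptGoal = below kept? proj₁ (p , p∈S , λ (_ , ne , _) → ne refl)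

      p∉ : ¬ Kept p
      p∉ (_ , ne , _) = ne refl

      withStars : VRep (Kept ∪｛ p ｝) p → VRep S p
      withStars R = VRep-⊆ within (addStars R S? (inj₂ refl) p∈S centre? proj₁ (proj₁ ∘ proj₂)
        (λ { (_ , p~v , ¬k) (inj₁ (_ , _ , k , _)) → ¬k (k p~v) ; (_ , p~v , _) (inj₂ refl) → ~-irrefl refl p~v })
        (λ { {v} cv (inj₁ (_ , _ , _ , ¬c)) x~v → ⊥-elim (¬c (v , cv , ~-sym x~v)) ; _ (inj₂ eq) _ → eq })
        (λ (sv , p~v , ¬k) → shallow sv p~v ¬k)
        (λ { (inj₁ (s , _)) → s ; (inj₂ refl) → p∈S }))
        where
        within : S ⊆ (λ x → (Kept ∪｛ p ｝) x ⊎ ∃ λ v → Centre v × (S x × Star p v x))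
        within {x} s with x ≟ p | centre? x | any? (λ v → centre? v ×-dec (v ~? x))
        ... | yes eq | _ | _ = inj₁ (inj₂ eq)
        ... | no _ | yes c | _ = inj₂ (x , c , s , inj₁ refl)
        ... | no x≢p | no _ | yes (v , c , v~x) = inj₂ (v , c , s , inj₂ (v~x , x≢p))
        ... | no x≢p | no ¬c | no ¬v = inj₁ (inj₁ (s , x≢p ,
                (λ p~x → decidable-stable (K? x) λ ¬k → ¬c (s , p~x , ¬k)) , ¬v))

    -- With a single deep neighbour `v`, the root moves on to `v`, `p` becomes a leaf of `v`, and
    -- the arm leaving the smaller set is `v p o₁ o₂`. Two deep neighbours and the outer arm give
    -- `S₃₃₃` unless there is a hexagon at `p`.
    solveRooted : ∀ {p} → S p → Anchor S p → VRep S p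
    solveRooted {p} p∈S A with any? (deep? S? p)
    ... | no none = withStars (addIsolated (Goal.plain keptGoal) p∉ (λ (_ , _ , h , _) x~p → h (~-sym x~p)))
      where
      open Stars p∈S {K = λ _ → ⊥} (λ _ → no id)
        (λ sv p~v _ → ¬deep⇒shallow sv p~v (λ d → none (_ , d)))
    ... | yes (v , D@(sv , p~v , u , su , v~u , u≢p , t , st , u~t , t≢v))
        with any? (λ w → deep? S? p w ×-dec ¬? (w ≟ v))
    ... | no none = withStars (PortRep⇒VRep (~⇒≢ p~v) (PortRep-sym
        (addLeaf (Goal.rooted keptGoal v∈ (anchor A)) p∉ (~-sym p~v) (λ (_ , _ , h , _) x~p → h (~-sym x~p)))))
      where
      open Stars p∈S {K = λ w → w ≡ v} (λ w → w ≟ v)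
        (λ sw p~w w≢v → ¬deep⇒shallow sw p~w (λ d → none (_ , d , w≢v)))
      v∈ : Kept v
      v∈ = sv , ≢-sym (~-≢ p~v) , (λ _ → refl) , λ (w , (_ , p~w , _) , w~v) → noC₃ (~-sym p~w) p~v w~v
      deep-⊆ : ∀ {c w} → Deep Kept c w → Deep S c w
      deep-⊆ ((sw , _) , c~w , u , (su , _) , w~u , u≢c , t , (st , _) , rest) =
        sw , c~w , u , su , w~u , u≢c , t , st , rest
      anchor : Anchor S p → Anchor Kept v
      anchor (single h) = single λ (sc , _) d d′ → h sc (deep-⊆ d) (deep-⊆ d′)
      anchor (outer {o₁} {o₂} O ∉₁ ∉₂ ∉₃ ~₁ ~₂ ~₃) = outer
        (arm (~-sym p~v) (Arm.cv O) (Arm.vu O) (λ { refl → ∉₁ sv }) (Arm.u≢c O))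
        p∉ (∉₁ ∘ proj₁) (∉₂ ∘ proj₁)
        (λ (_ , _ , h , _) x~p → h (~-sym x~p))
        (λ (s , x≢p , _) x~o₁ → x≢p (~₁ s x~o₁))
        (λ (s , _) → ~₂ s)
    ... | yes (w , D′@(sw , p~w , u′ , su′ , w~u′ , u′≢p , t′ , st′ , u′~t′ , t′≢w) , w≢v) = fork A
      where
      fork : Anchor S p → VRep S p
      fork (single h) = ⊥-elim (w≢v (h p∈S D′ D))
      fork (outer O ∉₁ ∉₂ ∉₃ ~₁ ~₂ ~₃) with independent p∈S D D′ (≢-sym w≢v)
      ... | inj₁ (_ , _ , _ , _ , _ , H) = Rooted.rootedHex S? below p∈S O ∉₁ ∉₂ ∉₃ ~₁ ~₂ ~₃ H
      ... | inj₂ (u≁t′ , u′≁t) = ⊥-elim (noS₃₃₃ O (arm p~v v~u u~t u≢p t≢v) (arm p~w w~u′ u′~t′ u′≢p t′≢w)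
        (λ { refl → ∉₁ sv }) (λ { refl → ∉₁ sw }) (≢-sym w≢v)
        (λ q → ~₂ st (~-sym q)) (λ q → ~₂ st′ (~-sym q)) (~₃ su) u≁t′ (~₃ su′) u′≁t)

  -- Breadth-first search and induced cycles

  module Search {K : Pred V 0ℓ} (K? : Decidable K) {s : V} (s∈K : K s) where

    Within : ℕ → Pred V 0ℓ
    Within zero x = x ≡ s
    Within (suc k) x = Within k x ⊎ (K x × ∃ λ y → Within k y × y ~ x)

    within? : ∀ k → Decidable (Within k)
    within? zero x = x ≟ s
    within? (suc k) x = within? k x ⊎-dec (K? x ×-dec any? λ y → within? k y ×-dec (y ~? x))

    within⇒K : ∀ k {x} → Within k x → K x
    within⇒K zero refl = s∈K
    within⇒K (suc k) (inj₁ h) = within⇒K k h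
    within⇒K (suc k) (inj₂ (x∈K , _)) = x∈K

    within-≤ : ∀ {i j x} → i ℕ.≤′ j → Within i x → Within j x
    within-≤ ℕ.≤′-refl h = h
    within-≤ (ℕ.≤′-step i≤j) h = inj₁ (within-≤ i≤j h)

    Level : ℕ → Pred V 0ℓ
    Level k x = Within k x × (∀ {i} → i ℕ.< k → ¬ Within i x)

    level : ∀ k {x} → Within k x → ∃ λ m → Level m x
    level zero h = 0 , h , λ ()
    level (suc k) {x} h with within? k x
    ... | yes h′ = level k h′
    ... | no ¬h′ = suc k , h , λ i<k h′ → ¬h′ (within-≤ (ℕP.≤⇒≤′ (ℕ.s≤s⁻¹ i<k)) h′)

    record Geodesic (m : ℕ) (x : V) : Set where
      field
        at     : ℕ → V
        end    : at m ≡ x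
        levels : ∀ {i} → i ℕ.≤ m → Level i (at i)
        steps  : ∀ {i} → i ℕ.< m → at i ~ at (suc i)

      -- Such an edge would bring `at j` within distance `suc i` of `s`.
      chordless : ∀ {i j} → suc i ℕ.< j → j ℕ.≤ m → ¬ at i ~ at j
      chordless {i} {j} i<j j≤m q = proj₂ (levels j≤m) i<j
        (inj₂ (within⇒K j (proj₁ (levels j≤m)) , at i ,
          proj₁ (levels (ℕP.≤-trans (ℕP.<⇒≤ (ℕP.<-trans (ℕP.n<1+n i) i<j)) j≤m)) , q))

      distinct : ∀ {i j} → i ℕ.< j → j ℕ.≤ m → at i ≢ at j
      distinct {i} i<j j≤m eq = proj₂ (levels j≤m) i<j
        (subst (Within i) eq (proj₁ (levels (ℕP.≤-trans (ℕP.<⇒≤ i<j) j≤m))))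

    geodesic : ∀ m {x} → Level m x → Geodesic m x
    geodesic zero (refl , _) = record { at = λ _ → s ; end = refl
      ; levels = λ { ℕ.z≤n → refl , λ () } ; steps = λ () }
    geodesic (suc m) (inj₁ h , ¬h) = ⊥-elim (¬h (ℕP.n<1+n m) h)
    geodesic (suc m) {x} (inj₂ (x∈K , y , hy , y~x) , ¬h) = record
      { at = at′ ; end = at-new ; levels = levels′ ; steps = steps′ }
      where
      g : Geodesic m y
      g = geodesic m (hy , λ i<m h → ¬h (ℕ.s≤s i<m) (inj₂ (x∈K , y , h , y~x)))
      open Geodesic g
      at′ : ℕ → V
      at′ i = choose (i ℕP.≟ suc m) x (at i)
      at-new : at′ (suc m) ≡ x
      at-new = choose-yes (suc m ℕP.≟ suc m) refl
      at-old : ∀ {i} → i ℕ.≤ m → at′ i ≡ at i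
      at-old {i} i≤m = choose-no (i ℕP.≟ suc m) (λ { refl → ℕP.1+n≰n i≤m })
      levels′ : ∀ {i} → i ℕ.≤ suc m → Level i (at′ i)
      levels′ {i} i≤ with ℕP.m≤n⇒m<n∨m≡n i≤
      ... | inj₁ i<m = subst (Level i) (sym (at-old (ℕ.s≤s⁻¹ i<m))) (levels (ℕ.s≤s⁻¹ i<m))
      ... | inj₂ refl = subst (Level (suc m)) (sym at-new) (inj₂ (x∈K , y , hy , y~x) , ¬h)
      steps′ : ∀ {i} → i ℕ.< suc m → at′ i ~ at′ (suc i)
      steps′ {i} i< with ℕP.m≤n⇒m<n∨m≡n (ℕ.s≤s⁻¹ i<)
      ... | inj₁ i<m = subst₂ _~_ (sym (at-old (ℕP.<⇒≤ i<m))) (sym (at-old i<m)) (steps i<m)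
      ... | inj₂ refl = subst₂ _~_ (sym (trans (at-old ℕP.≤-refl) end)) (sym at-new) y~x

    Reached : Pred V 0ℓ
    Reached = Within n

    reached? : Decidable Reached
    reached? = within? n

    s∈ : Reached s
    s∈ = within-≤ (ℕP.z≤′n) refl

    reached⇒K : ∀ {x} → Reached x → K x
    reached⇒K = within⇒K n

    -- A vertex first reached after n steps would be the end of a path of n + 2 vertices.
    closed : ∀ {x y} → Reached x → K y → x ~ y → Reached y
    closed {x} {y} rx y∈K x~y = decidable-stable (reached? y) λ ¬ry →
      let g = geodesic (suc n) {y} (inj₂ (y∈K , x , rx , x~y) ,
                λ i<n h → ¬ry (within-≤ (ℕP.≤⇒≤′ (ℕ.s≤s⁻¹ i<n)) h))
          open Geodesic g
          i , j , i<j , eq = pigeonhole (ℕP.<-trans (ℕP.n<1+n n) (ℕP.n<1+n (suc n)))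
            (λ (i : Fin (2 ℕ.+ n)) → at (toℕ i))
      in distinct i<j (ℕ.s≤s⁻¹ (toℕ<n j)) eq

  -- A shortest path between two neighbours of p closes up to an induced cycle.
  module _ {K : Pred V 0ℓ} (K? : Decidable K) {s : V} (s∈K : K s) {p t : V}
    (p~s : p ~ s) (p~t : p ~ t) (s≢t : s ≢ t) (p∉K : ¬ K p)
    (ends : ∀ {x} → K x → x ~ p → x ≡ s ⊎ x ≡ t) where

    open Search K? s∈K

    module Closed (m : ℕ) (g : Geodesic m t) where
      open Geodesic g

      in-K : ∀ {i} → i ℕ.≤ m → K (at i)
      in-K {i} i≤m = within⇒K i (proj₁ (levels i≤m))

      start : at 0 ≡ s
      start = proj₁ (levels ℕ.z≤n)

      p≢at : ∀ {i} → i ℕ.≤ m → p ≢ at i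
      p≢at i≤m eq = p∉K (subst K (sym eq) (in-K i≤m))

      0<m : 0 ℕ.< m
      0<m = ℕP.n≢0⇒n>0 λ { refl → s≢t (trans (sym start) end) }

      φ : Fin (2 ℕ.+ m) → V
      φ zero = p
      φ (suc i) = at (toℕ i)

      private module C = Graph (cycle (2 ℕ.+ m))

      below-m : (i : Fin (suc m)) → toℕ i ℕ.≤ m
      below-m i = ℕ.s≤s⁻¹ (toℕ<n i)

      at-inj : ∀ {i j} → i ℕ.≤ m → j ℕ.≤ m → at i ≡ at j → i ≡ j
      at-inj {i} {j} i≤m j≤m eq with ℕP.<-cmp i j
      ... | tri< i<j _ _ = ⊥-elim (distinct i<j j≤m eq)
      ... | tri≈ _ i≡j _ = i≡j
      ... | tri> _ _ j<i = ⊥-elim (distinct j<i i≤m (sym eq))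

      φ-inj : Injective _≡_ _≡_ φ
      φ-inj {zero} {zero} _ = refl
      φ-inj {zero} {suc j} eq = ⊥-elim (p≢at (below-m j) eq)
      φ-inj {suc i} {zero} eq = ⊥-elim (p≢at (below-m i) (sym eq))
      φ-inj {suc i} {suc j} eq = cong suc (toℕ-injective (at-inj (below-m i) (below-m j) eq))

      Next : Fin (2 ℕ.+ m) → Fin (2 ℕ.+ m) → Set
      Next i j = suc (toℕ i) ≡ toℕ j ⊎ (suc (toℕ i) ≡ 2 ℕ.+ m × toℕ j ≡ 0)

      next : ∀ i j → Next i j → φ i ~ φ j
      next zero zero (inj₁ ())
      next zero zero (inj₂ (() , _))
      next zero (suc j) (inj₁ eq) =
        subst (λ k → p ~ at k) (ℕP.suc-injective eq) (subst (p ~_) (sym start) p~s)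
      next zero (suc j) (inj₂ (_ , ()))
      next (suc i) zero (inj₁ ())
      next (suc i) zero (inj₂ (eq , _)) = ~-sym
        (subst (λ k → p ~ at k) (sym (ℕP.suc-injective (ℕP.suc-injective eq))) (subst (p ~_) (sym end) p~t))
      next (suc i) (suc j) (inj₁ eq) =
        subst (λ k → at (toℕ i) ~ at k) eq′ (steps (subst (ℕ._≤ m) (sym eq′) (below-m j)))
        where
        eq′ : suc (toℕ i) ≡ toℕ j
        eq′ = ℕP.suc-injective eq
      next (suc i) (suc j) (inj₂ (_ , ()))

      prev : ∀ i j → φ i ~ φ j → Next i j ⊎ Next j i
      prev zero zero q = ⊥-elim (~-irrefl refl q)
      prev zero (suc j) q with ends (in-K (below-m j)) (~-sym q)
      ... | inj₁ eq = inj₁ (inj₁ (cong suc (sym (at-inj (below-m j) ℕ.z≤n (trans eq (sym start))))))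
      ... | inj₂ eq = inj₂ (inj₂ (cong (2 ℕ.+_) (at-inj (below-m j) ℕP.≤-refl (trans eq (sym end))) , refl))
      prev (suc i) zero q with prev zero (suc i) (~-sym q)
      ... | inj₁ h = inj₂ h
      ... | inj₂ h = inj₁ h
      prev (suc i) (suc j) q with ℕP.<-cmp (toℕ i) (toℕ j)
      ... | tri≈ _ eq _ = ⊥-elim (~-irrefl (cong at eq) q)
      ... | tri< i<j _ _ with ℕP.m≤n⇒m<n∨m≡n i<j
      ...   | inj₁ i+1<j = ⊥-elim (chordless i+1<j (below-m j) q)
      ...   | inj₂ eq = inj₁ (inj₁ (cong suc eq))
      prev (suc i) (suc j) q | tri> _ _ j<i with ℕP.m≤n⇒m<n∨m≡n j<i
      ...   | inj₁ j+1<i = ⊥-elim (chordless j+1<i (below-m i) (~-sym q))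
      ...   | inj₂ eq = inj₂ (inj₁ (cong suc eq))

      induced : cycle (2 ℕ.+ m) ⊑ graph
      induced = φ , φ-inj , λ i j → mk⇔
        (λ { (_ , inj₁ h) → next i j h ; (_ , inj₂ h) → ~-sym (next j i h) })
        (λ q → (λ { refl → ~-irrefl refl q }) , prev i j q)

      m≡4 : m ≡ 4
      m≡4 = decidable-stable (m ℕP.≟ 4) λ m≢4 →
        𝒳.cycle-free G∈𝒳 (2 ℕ.+ m) (ℕ.s≤s (ℕ.s≤s 0<m)) (m≢4 ∘ ℕP.suc-injective ∘ ℕP.suc-injective) induced

    hexThrough : Reached t → ∃ λ a → ∃ λ b → ∃ λ c → K a × K b × K c × Hex p s a b c t
    hexThrough r with level n r
    ... | m , l with geodesic m l
    ... | g with Closed.m≡4 m g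
    ... | refl = at 1 , at 2 , at 3 , in-K 1≤ , in-K 2≤ , in-K 3≤ ,
        hex p~s (subst (_~ at 1) start (steps 1≤)) (steps 2≤) (steps 3≤)
          (subst (at 3 ~_) end (steps ℕP.≤-refl)) (~-sym p~t)
          (p≢at 1≤) (λ eq → distinct (ℕP.m≤m+n 1 1) 2≤ (trans start eq))
          (distinct (ℕP.m≤m+n 2 1) 3≤) (λ eq → distinct (ℕP.m≤m+n 3 1) ℕP.≤-refl (trans eq (sym end)))
          (≢-sym (p≢at 3≤)) (≢-sym s≢t)
      where
      open Geodesic g
      open Closed 4 g
      1≤ : 1 ℕ.≤ 4
      1≤ = ℕP.m≤m+n 1 3
      2≤ : 2 ℕ.≤ 4
      2≤ = ℕP.m≤m+n 2 2
      3≤ : 3 ℕ.≤ 4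
      3≤ = ℕP.m≤m+n 3 1

  -- Cutting at a vertex or along an edge

  module _ {S : Pred V 0ℓ} (S? : Decidable S) (below : Below S) where

    -- Without hexagons, c separates v from w, and the two parts are glued along the edge c v.
    module Split (noHex : ∀ {p} → ¬ HexAt S p) {c v w : V} (c∈S : S c)
      (D : Deep S c v) (D′ : Deep S c w) (v≢w : v ≢ w) where

      private
        v∈S = proj₁ D
        c~v = proj₁ (proj₂ D)
        w∈S = proj₁ D′
        c~w = proj₁ (proj₂ D′)
        u = proj₁ (armOf D)
        t = proj₁ (proj₂ (armOf D))
        open module O = Arm (proj₂ (proj₂ (armOf D))) using ()
        u′ = proj₁ (armOf D′)
        open module O′ = Arm (proj₂ (proj₂ (armOf D′))) using ()
        u∈S = proj₁ (proj₂ (proj₂ (proj₂ D)))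
        t∈S = proj₁ (proj₂ (proj₂ (proj₂ (proj₂ (proj₂ (proj₂ (proj₂ D)))))))
        u′∈S = proj₁ (proj₂ (proj₂ (proj₂ D′)))

      -- With the other neighbours of `c` deleted, a shortest path from `v` to `w` would close up to
      -- an induced cycle through `c`.
      K : Pred V 0ℓ
      K x = S x × x ≢ c × (x ~ c → x ≡ v ⊎ x ≡ w)

      K? : Decidable K
      K? x = S? x ×-dec (¬? (x ≟ c) ×-dec ((x ~? c) →-dec ((x ≟ v) ⊎-dec (x ≟ w))))

      v∈K : K v
      v∈K = v∈S , ≢-sym (~-≢ c~v) , λ _ → inj₁ refl

      w∈K : K w
      w∈K = w∈S , ≢-sym (~-≢ c~w) , λ _ → inj₂ refl

      open Search K? v∈K renaming (Reached to L; reached? to L?)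

      w∉L : ¬ L w
      w∉L r = let a , b , d , a∈ , b∈ , d∈ , h =
                    hexThrough K? v∈K c~v c~w v≢w (λ (_ , ne , _) → ne refl) (λ (_ , _ , h) → h) r in
        noHex (v , a , b , d , w , record { hexagon = h ; ∈₀ = c∈S ; ∈₁ = v∈S
          ; ∈₂ = proj₁ a∈ ; ∈₃ = proj₁ b∈ ; ∈₄ = proj₁ d∈ ; ∈₅ = w∈S })

      L⇒v : ∀ {x} → L x → x ~ c → x ≡ v
      L⇒v l x~c with proj₂ (proj₂ (reached⇒K l)) x~c
      ... | inj₁ eq = eq
      ... | inj₂ refl = ⊥-elim (w∉L l)

      shut : ∀ {x y} → L x → S y → y ≢ c → ¬ y ~ c → x ~ y → L y
      shut l sy y≢c y≁c x~y = closed l (sy , y≢c , ⊥-elim ∘ y≁c) x~y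

      u′∉L : ¬ L u′
      u′∉L l = w∉L (closed l w∈K (~-sym O′.vu))

      u∈L : L u
      u∈L = shut s∈ u∈S O.u≢c (λ q → noC₃ c~v O.vu (~-sym q)) O.vu

      t≁c : ¬ t ~ c
      t≁c q = noC₄ c~v O.vu O.ut q (≢-sym O.u≢c) (≢-sym O.t≢v)

      t∈L : L t
      t∈L = shut u∈L t∈S (λ { refl → noC₃ c~v O.vu (~-sym O.ut) }) t≁c O.ut

      -- Each part is anchored by a branch that leads into the other: here by `v c w u′`, in `right`
      -- by `c v u t`.
      left : PortRep (L ∪｛ c ｝) v c
      left = addLeaf
        (Goal.rooted (below L? (proj₁ ∘ reached⇒K) (c , c∈S , c∉L)) s∈
          (outer (arm (~-sym c~v) c~w O′.vu (≢-sym v≢w) O′.u≢c) c∉L w∉L u′∉L L⇒v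
            (λ l q → w∉L (closed l w∈K q))
            (λ l q → u′∉L (shut l u′∈S O′.u≢c (λ r → noC₃ c~w O′.vu (~-sym r)) q))))
        c∉L (~-sym c~v) L⇒v
        where
        c∉L : ¬ L c
        c∉L l = proj₁ (proj₂ (reached⇒K l)) refl

      R : Pred V 0ℓ
      R x = S x × ¬ L x

      R? : Decidable R
      R? x = S? x ×-dec ¬? (L? x)

      ~v⇒c : ∀ {x} → R x → x ~ v → x ≡ c
      ~v⇒c {x} (sx , ∉L) x~v = decidable-stable (x ≟ c) λ x≢c →
        ∉L (shut s∈ sx x≢c (λ q → noC₃ c~v (~-sym x~v) (~-sym q)) (~-sym x~v))

      right : PortRep (R ∪｛ v ｝) c v
      right = addLeaf
        (Goal.rooted (below R? proj₁ (v , v∈S , λ (_ , ∉L) → ∉L s∈)) (c∈S , λ l → proj₁ (proj₂ (reached⇒K l)) refl)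
          (outer (proj₂ (proj₂ (armOf D))) (λ (_ , ∉L) → ∉L s∈) (λ (_ , ∉L) → ∉L u∈L) (λ (_ , ∉L) → ∉L t∈L)
            ~v⇒c
            (λ {x} (sx , ∉L) x~u → ∉L (shut u∈L sx (λ { refl → noC₃ c~v O.vu x~u })
              (λ q → noC₄ (~-sym q) x~u (~-sym O.vu) (~-sym c~v) (≢-sym O.u≢c) (λ { refl → ∉L s∈ }))
              (~-sym x~u)))
            (λ {x} (sx , ∉L) x~t → ∉L (shut t∈L sx (λ { refl → t≁c (~-sym x~t) })
              (λ q → noC₅ c~v O.vu O.ut (~-sym x~t) (~-sym q)) (~-sym x~t)))))
        (λ (_ , ∉L) → ∉L s∈) c~v ~v⇒c

      -- If `y` is deep, three independent branches at `c` form `S₃₃₃`. If it is shallow, `x` has no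
      -- neighbour in `S` but `y`; yet the vertex before `x` on a shortest path from `v` lies in
      -- `K`, and `y` does not.
      third : ∀ {x y} → L x → S y → y ~ c → y ≢ v → y ≢ w → ¬ x ~ y
      third {x} {y} l sy y~c y≢v y≢w x~y with deep? S? c y
      ... | yes D″ = noS₃₃₃ (proj₂ (proj₂ (armOf D))) (proj₂ (proj₂ (armOf D′))) (proj₂ (proj₂ (armOf D″)))
            v≢w (≢-sym y≢v) (≢-sym y≢w)
            (proj₁ (apart D D′ v≢w)) (proj₁ (apart D D″ (≢-sym y≢v))) (proj₂ (apart D D′ v≢w))
            (proj₁ (apart D′ D″ (≢-sym y≢w))) (proj₂ (apart D D″ (≢-sym y≢v)))
            (proj₂ (apart D′ D″ (≢-sym y≢w)))
        where
        apart : ∀ {y z} (E : Deep S c y) (E′ : Deep S c z) → y ≢ z → Independent E E′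
        apart E E′ y≢z = [ ⊥-elim ∘ noHex , id ]′ (independent c∈S E E′ y≢z)
      ... | no ¬deep with level n l
      ...   | zero , refl , _ = noC₃ (~-sym c~v) (~-sym y~c) x~y
      ...   | suc m , l′ = [ (λ eq → y≢v (trans (sym prev≡y) eq)) , (λ eq → y≢w (trans (sym prev≡y) eq)) ]′
                (proj₂ (proj₂ prev∈K) (subst (_~ c) (sym prev≡y) y~c))
        where
        open Geodesic (geodesic (suc m) l′)
        prev = at m
        prev~x : prev ~ x
        prev~x = subst (prev ~_) end (steps ℕP.≤-refl)
        prev∈K : K prev
        prev∈K = within⇒K m (proj₁ (levels (ℕP.n≤1+n m)))
        prev≡y : prev ≡ y
        prev≡y = ¬deep⇒shallow sy (~-sym y~c) ¬deep (proj₁ (reached⇒K l)) (~-sym x~y)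
          (proj₁ (proj₂ (reached⇒K l))) (proj₁ prev∈K) (~-sym prev~x)

      split : Rep S
      split = Rep-⊆ within (glue left (PortRep-sym right) L∪c? (inj₁ s∈) (inj₂ refl) (inj₂ refl) (inj₁ c∈R) apart)
        where
        c∈R : R c
        c∈R = c∈S , λ l → proj₁ (proj₂ (reached⇒K l)) refl
        L∪c? : Decidable (L ∪｛ c ｝)
        L∪c? x = L? x ⊎-dec (x ≟ c)
        within : S ⊆ (λ x → (L ∪｛ c ｝) x ⊎ (R ∪｛ v ｝) x)
        within {x} s with L? x
        ... | yes l = inj₁ (inj₁ l)
        ... | no ¬l = inj₂ (inj₁ (s , ¬l))
        apart : ∀ {x y} → (L ∪｛ c ｝) x → (R ∪｛ v ｝) y → x ≢ v → x ≢ c → y ≢ v → y ≢ c → ¬ x ~ y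
        apart (inj₂ x≡c) _ _ x≢c _ _ _ = x≢c x≡c
        apart (inj₁ _) (inj₂ y≡v) _ _ y≢v _ _ = y≢v y≡v
        apart {x} {y} (inj₁ l) (inj₁ (sy , ∉L)) _ _ y≢v y≢c x~y with y ~? c
        ... | no y≁c = ∉L (shut l sy y≢c y≁c x~y)
        ... | yes y~c with y ≟ w
        ... | yes refl = w∉L (closed l w∈K x~y)
        ... | no y≢w = third l sy y~c y≢v y≢w x~y

  SlimIn : Pred V 0ℓ → Set
  SlimIn S = ∃ λ a → ∃ λ b → ∃ λ c → ∃ λ d → ∃ λ e → ∃ λ f → Slim S a b c d e f

  -- Otherwise each of the three pairs of opposite vertices contains one with neighbours off the
  -- hexagon, and three such vertices are consecutive or pairwise non-adjacent.
  slimIn : ∀ {S} → Decidable S → ∀ {a b c d e f} → InHex S a b c d e f → SlimIn S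
  slimIn {S} S? {a} {b} {c} {d} {e} {f} H with any? (off? S? a f b) | any? (off? S? b a c)
    | any? (off? S? c b d) | any? (off? S? d c e) | any? (off? S? e d f) | any? (off? S? f e a)
  ... | _ | _ | no n₂ | _ | _ | no n₅ = a , b , c , d , e , f , record
    { inHex = H ; deg₂ = ¬off⇒ n₂ ; deg₅ = λ s q → [ inj₂ , inj₁ ]′ (¬off⇒ n₅ s q) }
  ... | no n₀ | _ | _ | no n₃ | _ | _ = b , c , d , e , f , a , record
    { inHex = rotateIn H ; deg₂ = ¬off⇒ n₃ ; deg₅ = λ s q → [ inj₂ , inj₁ ]′ (¬off⇒ n₀ s q) }
  ... | _ | no n₁ | _ | _ | no n₄ | _ = c , d , e , f , a , b , record
    { inHex = rotateIn (rotateIn H) ; deg₂ = ¬off⇒ n₄ ; deg₅ = λ s q → [ inj₂ , inj₁ ]′ (¬off⇒ n₁ s q) }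
  ... | yes (x , _ , x0 , x≢f , x≢b) | yes (y , _ , y1 , y≢a , y≢c) | yes (z , _ , z2 , z≢b , z≢d) | _ | _ | _ =
    ⊥-elim (no3c h x0 x≢b x≢f y1 y≢a y≢c z2 z≢b z≢d)
    where h = InHex.hexagon H
  ... | yes (x , _ , x0 , x≢f , x≢b) | yes (y , _ , y1 , y≢a , y≢c) | _ | _ | _ | yes (z , _ , z5 , z≢e , z≢a) =
    ⊥-elim (no3c (unrotate h) z5 z≢a z≢e x0 x≢f x≢b y1 y≢a y≢c)
    where h = InHex.hexagon H
  ... | yes (x , _ , x0 , x≢f , x≢b) | _ | yes (z , _ , z2 , z≢b , z≢d) | _ | yes (y , _ , y4 , y≢d , y≢f) | _ =
    ⊥-elim (no3nc h x0 x≢b x≢f z2 z≢b z≢d y4 y≢d y≢f)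
    where h = InHex.hexagon H
  ... | yes (x , _ , x0 , x≢f , x≢b) | _ | _ | _ | yes (y , _ , y4 , y≢d , y≢f) | yes (z , _ , z5 , z≢e , z≢a) =
    ⊥-elim (no3c (unrotate (unrotate h)) y4 y≢f y≢d z5 z≢e z≢a x0 x≢f x≢b)
    where h = InHex.hexagon H
  ... | _ | yes (y , _ , y1 , y≢a , y≢c) | yes (z , _ , z2 , z≢b , z≢d) | yes (x , _ , x3 , x≢c , x≢e) | _ | _ =
    ⊥-elim (no3c (rotate h) y1 y≢c y≢a z2 z≢b z≢d x3 x≢c x≢e)
    where h = InHex.hexagon H
  ... | _ | yes (y , _ , y1 , y≢a , y≢c) | _ | yes (x , _ , x3 , x≢c , x≢e) | _ | yes (z , _ , z5 , z≢e , z≢a) =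
    ⊥-elim (no3nc (rotate h) y1 y≢c y≢a x3 x≢c x≢e z5 z≢e z≢a)
    where h = InHex.hexagon H
  ... | _ | _ | yes (z , _ , z2 , z≢b , z≢d) | yes (x , _ , x3 , x≢c , x≢e) | yes (y , _ , y4 , y≢d , y≢f) | _ =
    ⊥-elim (no3c (rotate (rotate h)) z2 z≢d z≢b x3 x≢c x≢e y4 y≢d y≢f)
    where h = InHex.hexagon H
  ... | _ | _ | _ | yes (x , _ , x3 , x≢c , x≢e) | yes (y , _ , y4 , y≢d , y≢f) | yes (z , _ , z5 , z≢e , z≢a) =
    ⊥-elim (no3c (rotate (rotate (rotate h))) x3 x≢e x≢c y4 y≢d y≢f z5 z≢e z≢a)
    where h = InHex.hexagon H

  module _ {S : Pred V 0ℓ} (S? : Decidable S) (below : Below S) where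

    Plain : ∀ {c₀ c₁ c₂ c₃ c₄ c₅} → Slim S c₀ c₁ c₂ c₃ c₄ c₅ → Set
    Plain {c₀} {c₃ = c₃} C = ∀ {x y z} → SlimBlock.Path S? below C x y → S z → z ~ x → z ≡ c₀ ⊎ z ~ c₃

    -- The vertices connected to c₀ without using the parallel paths do not include c₃, so S falls
    -- apart along the edge c₀ c₁.
    module Cut {c₀ c₁ c₂ c₃ c₄ c₅ : V} (C : Slim S c₀ c₁ c₂ c₃ c₄ c₅)
      (¬crossing : ¬ Crossing S? below C) (plain : Plain C) where

      open Slim C
      private module B = SlimBlock S? below C

      K : Pred V 0ℓ
      K x = S x × x ≢ c₂ × ¬ ∃ (B.Path x)

      K? : Decidable K
      K? x = S? x ×-dec (¬? (x ≟ c₂) ×-dec ¬? (any? (B.path? x)))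

      ≁c₀⇒K : ∀ {x} → S x → x ≢ c₂ → ¬ x ~ c₀ → K x
      ≁c₀⇒K s x≢c₂ x≁c₀ = s , x≢c₂ , λ (_ , _ , q , _) → x≁c₀ q

      c₀∈K : K c₀
      c₀∈K = ≁c₀⇒K ∈₀ ≢₀ (~-irrefl refl)

      c₁∈K : K c₁
      c₁∈K = ∈₁ , ~-≢ e₁ , λ (_ , _ , _ , ne , _) → ne refl

      c₃∈K : K c₃
      c₃∈K = ≁c₀⇒K ∈₃ (≢-sym (~-≢ e₂)) B.h₃≁h₀

      c₄∈K : K c₄
      c₄∈K = ≁c₀⇒K ∈₄ (≢-sym ≢₂) (noC₃ e₄ e₅)

      c₅∉K : ¬ K c₅
      c₅∉K (_ , _ , ¬path) = ¬path (c₄ , B.c₅-path)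

      open Search K? c₀∈K renaming (Reached to L; reached? to L?)

      -- Since `c₅` has only the neighbours `c₀` and `c₄` in `S`, a path between them in `K` yields
      -- a hexagon `c₅ c₀ a b d c₄`. According to whether `a` is `c₁` and `d` is `c₃`, the result is
      -- a `C₄`, a crossing, a parallel path from `c₀` to `c₃` starting in `K`, or a `C₈`.
      c₄∉L : ¬ L c₄
      c₄∉L r with hexThrough K? c₀∈K e₅ (~-sym e₄) (≢-sym ≢₄) c₅∉K (λ (s , _) q → deg₅ s q) r
      ... | a , b , d , (sa , _ , ¬pa) , (sb , b≢c₂ , _) , (sd , _) ,
            hex _ c₀~a a~b b~d d~c₄ _ _ c₀≢b a≢d b≢c₄ _ _ with a ≟ c₁ | d ≟ c₃
      ... | yes refl | yes refl = noC₄ a~b b~d (~-sym e₂) (~-sym e₁) ≢₁ b≢c₂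
      ... | yes refl | no d≢c₃ =
            ¬crossing⇒ S? below C ¬crossing sb (~-sym a~b) (≢-sym c₀≢b) b≢c₂ sd (~-sym b~d) d~c₄
      ... | no a≢c₁ | yes refl = ¬pa (b , sa , ~-sym c₀~a , a≢c₁ , sb , ~-sym a~b , b~d)
      ... | no a≢c₁ | no d≢c₃ = noC₈ c₀~a a~b b~d d~c₄ (~-sym e₃) (~-sym e₂) (~-sym e₁) (~-sym e₀)
            c₀≢b a≢d b≢c₄ d≢c₃ (≢-sym ≢₂) (≢-sym ≢₁) (≢-sym ≢₀) (≢-sym a≢c₁)

      c₃∉L : ¬ L c₃
      c₃∉L l = c₄∉L (closed l c₄∈K e₃)

      c₁∈L : L c₁
      c₁∈L = closed s∈ c₁∈K e₀

      left : PortRep L c₀ c₁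
      left = Goal.ported (below L? (proj₁ ∘ reached⇒K) (c₂ , ∈₂ , c₂∉L)) s∈ c₁∈L (record
        { hexagon = hexagon ; ∉₂ = c₂∉L ; ∉₃ = c₃∉L ; ∉₄ = c₄∉L ; ∉₅ = c₅∉K ∘ reached⇒K
        ; ~₂ = λ l q → [ id , (λ { refl → ⊥-elim (c₃∉L l) }) ]′ (deg₂ (proj₁ (reached⇒K l)) q)
        ; ~₃ = λ l q → c₃∉L (closed l c₃∈K q)
        ; ~₄ = λ l q → c₄∉L (closed l c₄∈K q)
        ; ~₅ = λ l q → [ id , (λ { refl → ⊥-elim (c₄∉L l) }) ]′ (deg₅ (proj₁ (reached⇒K l)) q) })
        where
        c₂∉L : ¬ L c₂
        c₂∉L l = proj₁ (proj₂ (reached⇒K l)) refl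

      -- The vertices `c₀` and `c₁` belong to `L` and are added again, so that both parts contain
      -- the port.
      R : Pred V 0ℓ
      R x = S x × (¬ L x ⊎ (x ≡ c₀ ⊎ x ≡ c₁))

      R? : Decidable R
      R? x = S? x ×-dec (¬? (L? x) ⊎-dec ((x ≟ c₀) ⊎-dec (x ≟ c₁)))

      R⇒∉L : ∀ {x} → R x → x ≢ c₀ → x ≢ c₁ → ¬ L x
      R⇒∉L (_ , inj₁ ∉L) _ _ = ∉L
      R⇒∉L (_ , inj₂ (inj₁ eq)) x≢c₀ _ = ⊥-elim (x≢c₀ eq)
      R⇒∉L (_ , inj₂ (inj₂ eq)) _ x≢c₁ = ⊥-elim (x≢c₁ eq)

      slimR : Slim R c₀ c₁ c₂ c₃ c₄ c₅
      slimR = record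
        { inHex = record { hexagon = hexagon
          ; ∈₀ = ∈₀ , inj₂ (inj₁ refl) ; ∈₁ = ∈₁ , inj₂ (inj₂ refl)
          ; ∈₂ = ∈₂ , inj₁ (λ l → proj₁ (proj₂ (reached⇒K l)) refl)
          ; ∈₃ = ∈₃ , inj₁ c₃∉L ; ∈₄ = ∈₄ , inj₁ c₄∉L ; ∈₅ = ∈₅ , inj₁ (c₅∉K ∘ reached⇒K) }
        ; deg₂ = deg₂ ∘ proj₁ ; deg₅ = deg₅ ∘ proj₁ }

      belowR : Below R
      belowR T? T⊆R (x , (sx , _) , ¬tx) = below T? (proj₁ ∘ T⊆R) (x , sx , ¬tx)

      private module BR = SlimBlock R? belowR slimR

      -- Whatever hangs on `c₀` or `c₁` apart from the bundle is reached by the search, so within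
      -- `R` nothing has to be trimmed and `Core` is all of `R`.
      right : PortRep R c₀ c₁
      right = PortRep-⊆ (λ r → r , (λ (_ , o , _) → none₀ o) , (λ (_ , o , _) → none₁ o))
        (BR.corePort
          (λ ((sx , _) , x~c₀ , x≢c₁ , (sy , _) , y~x , y~c₃) (sz , _) →
            plain (sx , x~c₀ , x≢c₁ , sy , y~x , y~c₃) sz)
          (c₅ , c₄ , BR.c₅-path))
        where
        none₀ : ∀ {v} → ¬ BR.Outer₀ v
        none₀ {v} (rv , c₀~v , v≢c₁ , ¬path) = R⇒∉L rv (≢-sym (~-≢ c₀~v)) v≢c₁
          (closed s∈ (proj₁ rv , (λ { refl → noC₃ e₀ e₁ c₀~v }) ,
            λ (y , _ , x~c₀ , x≢c₁ , sy , y~v , y~c₃) → ¬path (y , rv , x~c₀ , x≢c₁ ,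
              (sy , inj₁ (λ l → c₃∉L (closed l c₃∈K y~c₃))) , y~v , y~c₃)) c₀~v)
        none₁ : ∀ {v} → ¬ BR.Outer₁ v
        none₁ {v} (rv , c₁~v , v≢c₀ , v≢c₂) = R⇒∉L rv v≢c₀ (≢-sym (~-≢ c₁~v))
          (closed c₁∈L (≁c₀⇒K (proj₁ rv) v≢c₂ (λ q → noC₃ (~-sym c₁~v) (~-sym e₀) q)) c₁~v)

      cut : Rep S
      cut = Rep-⊆ within (glue left right L? s∈ c₁∈L (∈₀ , inj₂ (inj₁ refl)) (∈₁ , inj₂ (inj₂ refl)) apart)
        where
        within : S ⊆ (λ x → L x ⊎ R x)
        within {x} s with L? x
        ... | yes l = inj₁ l
        ... | no ¬l = inj₂ (s , inj₁ ¬l)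
        apart : ∀ {x y} → L x → R y → x ≢ c₀ → x ≢ c₁ → y ≢ c₀ → y ≢ c₁ → ¬ x ~ y
        apart {x} {y} l r x≢c₀ x≢c₁ y≢c₀ y≢c₁ x~y with y ≟ c₂ | any? (B.path? y)
        ... | no y≢c₂ | no ¬path = R⇒∉L r y≢c₀ y≢c₁ (closed l (proj₁ r , y≢c₂ , ¬path) x~y)
        ... | yes refl | _ = [ x≢c₁ , (λ { refl → c₃∉L l }) ]′ (deg₂ (proj₁ (reached⇒K l)) x~y)
        ... | no _ | yes (_ , path) = [ x≢c₀ , (λ q → c₃∉L (closed l c₃∈K q)) ]′
              (plain path (proj₁ (reached⇒K l)) x~y)

    -- If some path of length three joining c₀ to c₃ has an attached vertex next to c₀, it
    -- takes the place of the path through c₁.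
    cutPlain : ∀ {c₀ c₁ c₂ c₃ c₄ c₅} (C : Slim S c₀ c₁ c₂ c₃ c₄ c₅) → ¬ Crossing S? below C → Rep S
    cutPlain {c₀} {c₁} {c₂} {c₃} {c₄} {c₅} C ¬crossing with any? (λ x → any? λ y → B.path? x y ×-dec
        any? λ z → S? z ×-dec ((z ~? x) ×-dec (¬? (z ≟ c₀) ×-dec ¬? (z ~? c₃))))
      where module B = SlimBlock S? below C
    ... | no none = Cut.cut C ¬crossing plain
      where
      plain : Plain C
      plain {x} {y} {z} xy sz z~x with z ≟ c₀ | z ~? c₃
      ... | yes eq | _ = inj₁ eq
      ... | no _ | yes q = inj₂ q
      ... | no z≢c₀ | no z≁c₃ = ⊥-elim (none (x , y , xy , z , sz , z~x , z≢c₀ , z≁c₃))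
    ... | yes (x , y , xy@(sx , x~c₀ , x≢c₁ , sy , y~x , y~c₃) , z , sz , z~x , z≢c₀ , z≁c₃) =
        -- The former path through `c₁` and `c₂` is now one of the parallel paths, and its presence
        -- rules out a crossing.
        Cut.cut C′ (¬both S? below C′ {c₁} {c₂} (∈₁ , ~-sym e₀ , ≢-sym x≢c₁ , ∈₂ , ~-sym e₁ , e₂) (≢-sym ≢₅)) plain
      where
      open Slim C
      module B = SlimBlock S? below C
      x≢c₅ : x ≢ c₅
      x≢c₅ refl = [ z≢c₀ , (λ { refl → z≁c₃ (~-sym e₃) }) ]′ (deg₅ sz z~x)
      h′ : Hex c₀ x y c₃ c₄ c₅
      h′ = hex (~-sym x~c₀) (~-sym y~x) y~c₃ e₃ e₄ e₅ (≢-sym (B.y≢h₀ xy)) (B.x≢h₃ xy)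
        (λ { refl → x≢c₅ (B.path-c₄ xy) }) ≢₃ ≢₄ (≢-sym x≢c₅)
      z≢y : z ≢ y
      z≢y refl = z≁c₃ y~c₃
      C′ : Slim S c₀ x y c₃ c₄ c₅
      C′ = record
        { inHex = record { hexagon = h′
          ; ∈₀ = ∈₀ ; ∈₁ = sx ; ∈₂ = sy ; ∈₃ = ∈₃ ; ∈₄ = ∈₄ ; ∈₅ = ∈₅ }
        ; deg₂ = λ _ w~y → oneOf λ w≢x w≢c₃ → no3c h′ (~-sym e₀) (≢-sym x≢c₁) (≢-sym ≢₅)
            z~x z≢c₀ z≢y w~y w≢x w≢c₃
        ; deg₅ = deg₅ }
      module B′ = SlimBlock S? below C′
      plain : Plain C′
      plain {x′} {y′} {w} p′@(sx′ , x′~c₀ , x′≢x , _ , _ , y′~c₃) sw w~x′ with w ≟ c₀ | w ~? c₃ | x′ ≟ c₅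
      ... | yes eq | _ | _ = inj₁ eq
      ... | no _ | yes q | _ = inj₂ q
      ... | no w≢c₀ | no w≁c₃ | yes refl =
            ⊥-elim ([ w≢c₀ , (λ { refl → w≁c₃ (~-sym e₃) }) ]′ (deg₅ sw w~x′))
      ... | no w≢c₀ | no w≁c₃ | no x′≢c₅ = ⊥-elim (no3c
            (unrotate (B′.hexOf p′))
            w~x′ w≢c₀ (λ { refl → w≁c₃ y′~c₃ }) e₅ (≢-sym x′≢c₅) (≢-sym x≢c₅)
            z~x z≢c₀ z≢y)

    -- When there is neither a hexagon nor a vertex with two deep branches, any vertex can be taken
    -- as a root with the anchor `single`.
    solvePlain : Rep S
    solvePlain with any? (λ a → hexAt? S? a)
    ... | yes (a , b , c , d , e , f , H) with slimIn S? H
    ... | _ , _ , _ , _ , _ , _ , C with crossing? S? below C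
    ... | no ¬crossing = cutPlain C ¬crossing
    ... | yes crossing = cutPlain (swapSlim C)
          (λ (z , (w , path) , z≢c₅) → ¬both S? below C path z≢c₅ crossing)
    solvePlain | no noHex with any? (λ c → S? c ×-dec any? λ v → any? λ w →
        deep? S? c v ×-dec (deep? S? c w ×-dec ¬? (v ≟ w)))
    ... | yes (c , c∈S , v , w , D , D′ , v≢w) =
          Split.split S? below (λ H → noHex (_ , H)) c∈S D D′ v≢w
    ... | no none with any? S?
    ... | no ¬any = empty (λ s → ¬any (_ , s))
    ... | yes (p , p∈S) = VRep.rep (solveRooted S? below p∈S
          (single λ {c} {v} {w} c∈S D D′ → decidable-stable (v ≟ w) λ v≢w →
            none (c , c∈S , v , w , D , D′ , v≢w)))

  -- Induction on the number of vertices

  toSubset : ∀ {S : Pred V 0ℓ} → Decidable S → Subset n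
  toSubset S? = tabulate (does ∘ S?)

  module _ {S : Pred V 0ℓ} (S? : Decidable S) where

    ∈⇒subset : ∀ {x} → S x → x ∈ₛ toSubset S?
    ∈⇒subset {x} s = lookup⇒[]= x (toSubset S?)
      (trans (lookup∘tabulate (does ∘ S?) x) (dec-true (S? x) s))

    subset⇒∈ : ∀ {x} → x ∈ₛ toSubset S? → S x
    subset⇒∈ {x} h with S? x | trans (sym (lookup∘tabulate (does ∘ S?) x)) ([]=⇒lookup h)
    ... | yes s | _ = s
    ... | no _ | ()

  -- A predicate has no size of its own; it is measured by the subset that its decision procedure
  -- tabulates, and a proper inclusion lowers that count.
  goal : ∀ m {S} (S? : Decidable S) → ∣ toSubset S? ∣ₛ ℕ.< m → Goal S
  goal (suc m) {S} S? size = record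
    { plain = solvePlain S? below
    ; rooted = solveRooted S? below
    ; ported = solvePorted S? below }
    where
    below : Below S
    below T? T⊆S (x , sx , ¬tx) = goal m T? (ℕP.<-≤-trans (p⊂q⇒∣p∣<∣q∣
      ((λ h → ∈⇒subset S? (T⊆S (subset⇒∈ T? h))) , x , ∈⇒subset S? sx , ¬tx ∘ subset⇒∈ T?))
      (ℕ.s≤s⁻¹ size))

  represent : Rep (λ _ → ⊤)
  represent = Goal.plain (goal _ (λ _ → yes tt) (ℕP.n<1+n _))

theorem24 : ∀ (n : ℕ) (G : BipartiteGraph n) → 𝒳 (BipartiteGraph.graph G) →
    IsUnitDisk (complement (BipartiteGraph.graph G))
theorem24 n G G∈𝒳 = Realisation.unitDisk G (Forbidden.represent G G∈𝒳)
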